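{- Let $q$ be a prime power. Let $P\in\mathbb{F}_q[x,y]$ satisfy $P(0,0)=0$ and $\frac{\partial P}{\partial y}(0,0)\neq 0$, and let $h=\deg_x P$ and $d=\deg_y P$. Let $F=\sum_{n\ge 0}a(n)x^n\in\mathbb{F}_q[[x]]\setminus\{0\}$ be the Furstenberg series associated with $P$. Then the minimal $q$-automaton that generates $a(n)_{n\ge 0}$ has size (number of states) at most $$q^{hd}+q^{(h-1)(d-1)}\,\mathcal{L}(h,d,d)+\lfloor\log_q h\rfloor+\lfloor\log_q\max(h,d)\rfloor+3.$$
   Context: Furstenberg series: for $P\in\mathbb{F}_q[x,y]$ with $P(0,0)=0$ and $\frac{\partial P}{\partial y}(0,0)\ne 0$, the Furstenberg series associated with $P$ is the unique $F\in\mathbb{F}_q[[x]]$ with $F(0)=0$ and $P(x,F)=0$. The height of $P$ is $\deg_x P$ and the degree of $P$ is $\deg_y P$. (The conditions on $P$ force $d\ge 1$, and $F\neq 0$ forces $h\ge 1$.) For a positive integer $n$, $\mathrm{parts}(n)$ is the set of integer partitions of $n$, and for a partition $\sigma$, $\mathrm{lcm}(\sigma)$ is the least common multiple of its parts. Define $$\mathcal{L}(l,m,n)=\max_{1\le i\le l,\ 1\le j\le m,\ 1\le k\le n}\ \max_{\sigma_1\in\mathrm{parts}(i),\ \sigma_2\in\mathrm{parts}(j),\ \sigma_3\in\mathrm{parts}(k)}\mathrm{lcm}\big(\mathrm{lcm}(\sigma_1),\mathrm{lcm}(\sigma_2),\mathrm{lcm}(\sigma_3)\big).$$ Automata: a $q$-automaton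 is a deterministic finite automaton with output, with input alphabet $\{0,1,\dots,q-1\}$. It generates $a(n)_{n\ge0}$ if its output is $a(n)$ when fed the standard base-$q$ representation of $n$, starting with the least significant digit. It is not affected by leading $0$s if it also outputs $a(n)$ when fed any base-$q$ representation of $n$ padded with leading $0$s (again least significant digit first). The minimal $q$-automaton of $a(n)_{n\ge 0}$ is the smallest automaton that generates $a(n)_{n\ge0}$ and is not affected by leading $0$s. Equivalently, its states are in bijection with the $q$-kernel $\ker_q(a(n)_{n\ge0})=\{a(q^e n+r)_{n\ge0}: e\ge 0,\ 0\le r\le q^e-1\}$, so its size is $|\ker_q(a(n)_{n\ge0})|$. -}

module Defs where

open import Algebra.Bundles using (CommutativeRing)
open import Algebra.Apartness.Bundles using (HeytingCommutativeRing; HeytingField)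
import Algebra.Definitions.RawMonoid as RawMonoidDefs
open import Data.Fin.Base using (Fin; toℕ)
open import Data.Digit using (Expansion; fromDigits)
open import Data.List.Base
  using (List; []; _∷_; _++_; map; foldr; foldl; filter; upTo; length; last; cartesianProductWith)
open import Data.List.Extrema.Nat using (max; xs≤max; argmax-all)
open import Data.List.Membership.Propositional using (_∈_)
open import Data.List.Membership.Propositional.Properties
  using (∈-cartesianProductWith⁺; ∈-filter⁺; ∈-filter⁻; ∈-upTo⁺)
open import Data.List.Relation.Unary.All as All using (All; []; _∷_; all?)
open import Data.List.Relation.Unary.All.Properties using (all-filter)
open import Data.List.Relation.Unary.Any using (here; there)
open import Data.List.Relation.Unary.Linked using (Linked; linked?)
import Data.Maybe.Relation.Unary.All as Maybe
open import Data.Nat.Base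
open import Data.Nat.LCM using (lcm)
open import Data.Nat.ListAction using (sum)
open import Data.Nat.Primality using (Prime)
open import Data.Nat.Properties
open import Data.Product.Base using (∃; _×_; _,_; proj₂)
open import Function.Base using (_∘_; id)
open import Function.Bundles using (_⇔_; mk⇔)
open import Level using () renaming (_⊔_ to _⊔ˡ_)
open import Relation.Binary.PropositionalEquality using (_≡_; _≢_; refl)
open import Relation.Nullary using (¬_; Dec)
open import Relation.Nullary.Decidable using (_×-dec_)

IsPrimePower : ℕ → Set
IsPrimePower q = ∃ λ p → ∃ λ k → Prime p × 1 ≤ k × q ≡ p ^ k

commutativeRing : ∀ {c ℓ₁ ℓ₂} → HeytingField c ℓ₁ ℓ₂ → CommutativeRing c ℓ₁
commutativeRing K =
  HeytingCommutativeRing.commutativeRing (HeytingField.heytingCommutativeRing K)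

module Algebraic {c ℓ} (R : CommutativeRing c ℓ) where

  open CommutativeRing R
    using (Carrier; _≈_; _≉_; 0#; +-rawMonoid) renaming (_+_ to _+ᴿ_; _*_ to _*ᴿ_)
  open RawMonoidDefs +-rawMonoid using () renaming (_×_ to _·_; sum to ∑)

  -- Coefficient lists, lowest degree first; trailing zeros are allowed.
  -- A bivariate polynomial is a polynomial in y with coefficients in R[x]:
  -- the entry i of the entry j is the coefficient of xⁱ yʲ.

  Poly : Set c
  Poly = List Carrier

  Poly₂ : Set c
  Poly₂ = List Poly

  entry : ∀ {a} {A : Set a} → A → List A → ℕ → A
  entry default []       _       = default
  entry default (x ∷ xs) zero    = x
  entry default (x ∷ xs) (suc n) = entry default xs n

  coeff : Poly₂ → (i j : ℕ) → Carrier
  coeff P i j = entry 0# (entry [] P j) i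

  -- The zero polynomial has no degree.

  IsDegX : Poly₂ → ℕ → Set ℓ
  IsDegX P h = (∀ i j → h < i → coeff P i j ≈ 0#) × ∃ λ j → coeff P h j ≉ 0#

  IsDegY : Poly₂ → ℕ → Set ℓ
  IsDegY P d = (∀ i j → d < j → coeff P i j ≈ 0#) × ∃ λ i → coeff P i d ≉ 0#

  eval : Poly → Carrier → Carrier
  eval p a = foldr (λ c r → c +ᴿ a *ᴿ r) 0# p

  eval₂ : Poly₂ → (a b : Carrier) → Carrier
  eval₂ P a b = foldr (λ p r → eval p a +ᴿ b *ᴿ r) 0# P

  scaleFrom : ℕ → Poly₂ → Poly₂
  scaleFrom n []      = []
  scaleFrom n (p ∷ P) = map (n ·_) p ∷ scaleFrom (suc n) P

  ∂y : Poly₂ → Poly₂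
  ∂y []      = []
  ∂y (_ ∷ P) = scaleFrom 1 P

  Series : Set c
  Series = ℕ → Carrier

  _≋_ : Series → Series → Set ℓ
  F ≋ G = ∀ n → F n ≈ G n

  0ˢ : Series
  0ˢ _ = 0#

  _⊕_ : Series → Series → Series
  (F ⊕ G) n = F n +ᴿ G n

  _⊗_ : Series → Series → Series
  (F ⊗ G) n = ∑ {suc n} λ i → F (toℕ i) *ᴿ G (n ∸ toℕ i)

  fromPoly : Poly → Series
  fromPoly = entry 0#

  -- P(x, F)
  substY : Poly₂ → Series → Series
  substY P F = foldr (λ p G → fromPoly p ⊕ (F ⊗ G)) 0ˢ P

  FurstenbergCondition : Poly₂ → Set ℓ
  FurstenbergCondition P = eval₂ P 0# 0# ≈ 0# × eval₂ (∂y P) 0# 0# ≉ 0#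

  -- Under FurstenbergCondition P there is exactly one such F.
  IsFurstenbergSeries : Poly₂ → Series → Set ℓ
  IsFurstenbergSeries P F = F 0 ≈ 0# × substY P F ≋ 0ˢ

-- Words are read least significant digit first.

record DFAO {o} (q : ℕ) (Output : Set o) : Set o where
  field
    size    : ℕ
    initial : Fin size
    δ       : Fin size → Fin q → Fin size
    output  : Fin size → Output

  run : Expansion q → Output
  run w = output (foldl δ initial w)

-- The head of an expansion is its least significant digit, so "leading"
-- zeros are at the end of the list. The standard representation of 0 is [].

IsStandardRep : ∀ {q} → ℕ → Expansion q → Set
IsStandardRep n w = fromDigits w ≡ n × Maybe.All (λ d → toℕ d ≢ 0) (last w)

module Automatic {o ℓ} {Output : Set o} (_≈_ : Output → Output → Set ℓ) {q : ℕ} where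

  open DFAO

  Generates : DFAO q Output → (ℕ → Output) → Set ℓ
  Generates M a = ∀ n w → IsStandardRep n w → run M w ≈ a n

  UnaffectedByLeadingZeros : DFAO q Output → (ℕ → Output) → Set ℓ
  UnaffectedByLeadingZeros M a =
    ∀ n w zs → IsStandardRep n w → All (λ d → toℕ d ≡ 0) zs → run M (w ++ zs) ≈ a n

  IsMinimalFor : DFAO q Output → (ℕ → Output) → Set (o ⊔ˡ ℓ)
  IsMinimalFor M a =
    Generates M a × UnaffectedByLeadingZeros M a ×
    (∀ M′ → Generates M′ a → UnaffectedByLeadingZeros M′ a → size M ≤ size M′)

IsPartition : ℕ → List ℕ → Set
IsPartition n σ = Linked _≥_ σ × All (1 ≤_) σ × sum σ ≡ n

isPartition? : ∀ n σ → Dec (IsPartition n σ)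
isPartition? n σ = linked? _≥?_ σ ×-dec (all? (1 ≤?_) σ ×-dec (sum σ ≟ n))

lists≤ : ∀ {a} {A : Set a} → ℕ → List A → List (List A)
lists≤ zero    xs = [] ∷ []
lists≤ (suc k) xs = [] ∷ cartesianProductWith _∷_ xs (lists≤ k xs)

parts : ℕ → List (List ℕ)
parts n = filter (isPartition? n) (lists≤ n (upTo (suc n)))

∈-lists≤ : ∀ {a} {A : Set a} {xs : List A} k {ys} →
           length ys ≤ k → All (_∈ xs) ys → ys ∈ lists≤ k xs
∈-lists≤ zero    {[]}     _         _          = here refl
∈-lists≤ (suc k) {[]}     _         _          = here refl
∈-lists≤ (suc k) {y ∷ ys} (s≤s len) (y∈ ∷ ys∈) =
  there (∈-cartesianProductWith⁺ _∷_ y∈ (∈-lists≤ k len ys∈))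

parts≤sum : ∀ σ → All (_≤ sum σ) σ
parts≤sum []      = []
parts≤sum (s ∷ σ) =
  m≤m+n s (sum σ) ∷ All.map (λ t≤ → ≤-trans t≤ (m≤n+m (sum σ) s)) (parts≤sum σ)

length≤sum : ∀ {σ} → All (1 ≤_) σ → length σ ≤ sum σ
length≤sum []           = z≤n
length≤sum (1≤s ∷ 1≤σ) = +-mono-≤ 1≤s (length≤sum 1≤σ)

∈-parts : ∀ {n σ} → σ ∈ parts n ⇔ IsPartition n σ
∈-parts {n} {σ} = mk⇔ (λ σ∈ → proj₂ (∈-filter⁻ (isPartition? n) {xs = lists≤ n (upTo (suc n))} σ∈)) complete
  where
  complete : IsPartition n σ → σ ∈ parts n
  complete isP@(_ , 1≤σ , refl) =
    ∈-filter⁺ (isPartition? n)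
      (∈-lists≤ n (length≤sum 1≤σ) (All.map (∈-upTo⁺ ∘ s≤s) (parts≤sum σ)))
      isP

-- The maximum over an empty list is 0.
maxOver : ∀ {a} {A : Set a} → List A → (A → ℕ) → ℕ
maxOver xs f = max 0 (map f xs)

infix 5 maxOver
syntax maxOver xs (λ x → e) = max[ x ∈ xs ] e

[1⋯_] : ℕ → List ℕ
[1⋯ n ] = map suc (upTo n)

lcmOf : List ℕ → ℕ
lcmOf = foldr lcm 1

𝓛 : ℕ → ℕ → ℕ → ℕ
𝓛 l m n =
  max[ i ∈ [1⋯ l ] ] max[ j ∈ [1⋯ m ] ] max[ k ∈ [1⋯ n ] ]
  max[ σ₁ ∈ parts i ] max[ σ₂ ∈ parts j ] max[ σ₃ ∈ parts k ]
    lcm (lcm (lcmOf σ₁) (lcmOf σ₂)) (lcmOf σ₃)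

-- ⌊log_b n⌋ for b ≥ 2 and n ≥ 1.
⌊log[_]_⌋ : ℕ → ℕ → ℕ
⌊log[ b ] n ⌋ = max 0 (filter (λ e → b ^ e ≤? n) (upTo (suc n)))

n<b^n : ∀ {b} → 2 ≤ b → ∀ n → n < b ^ n
n<b^n 2≤b zero = s≤s z≤n
n<b^n {b} 2≤b (suc n) = begin-strict
  suc n        ≤⟨ n<b^n 2≤b n ⟩
  b ^ n        <⟨ ^-monoʳ-< b 2≤b (n<1+n n) ⟩
  b ^ suc n    ∎
  where open ≤-Reasoning

⌊log⌋-spec : ∀ {b n} → 2 ≤ b → 1 ≤ n →
             b ^ ⌊log[ b ] n ⌋ ≤ n × n < b ^ suc ⌊log[ b ] n ⌋
⌊log⌋-spec {b} {n} 2≤b 1≤n = lower , ≰⇒> upper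
  where
  below? : ∀ e → Dec (b ^ e ≤ n)
  below? e = b ^ e ≤? n

  lower : b ^ ⌊log[ b ] n ⌋ ≤ n
  lower = argmax-all id {P = λ e → b ^ e ≤ n} 1≤n (all-filter below? (upTo (suc n)))

  upper : ¬ b ^ suc ⌊log[ b ] n ⌋ ≤ n
  upper le = <-irrefl refl (All.lookup (xs≤max 0 _)
    (∈-filter⁺ below? (∈-upTo⁺ (s≤s (≤-trans (<⇒≤ (n<b^n 2≤b _)) le))) le))

module Submission where

-- Write P = (y - F) R and D = ∂P/∂y (x, F). A polynomial S represents the series S(x, F) / D,
-- and F is represented by y ∂P/∂y. Passing from a(n) to a(qn + r) amounts to the operator Λ_r
-- that extracts from S P^(q-1) the exponents ≡ r of x and ≡ q - 1 of y. A step with r ≥ 1 leads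
-- into the Λ-stable space of polynomials of degree < h in x and < d in y, which has q^(hd)
-- elements; it remains to bound the orbit of y ∂P/∂y under Λ_0.
--
-- On the columns x^0 and x^h and on the row y^(d-1), Λ_0 acts by a univariate operator
-- s ↦ Λ_0 (s p^(q-1)), that is s/p ↦ Λ_0 (s/p). If σ lists the degrees of the irreducible factors
-- of p, then p divides a power of x^(q^D) - x for every common multiple D of σ, and after
-- ⌊log_q deg⌋ + 1 steps these orbits have period D. At times differing by multiples of D only the
-- (h-1)(d-1) interior coefficients can differ, so the pigeonhole principle bounds the orbit.

-- Residues and diagonals are avoided: that S represents f means S ≡ D f modulo y - F in
-- K[[x]][[y]]. As F(0) = 0, the congruence can be evaluated at (0, 0), and D(0), the value of ∂P/∂y
-- at (0, 0), is nonzero, so f(0) can be read off from S. Differentiating (y - F) R gives R modulo y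
-- - F, hence ∂P/∂y ≡ D and y ∂P/∂y ≡ F D.
--
-- The borders split off because an extreme coefficient of S P^(q-1) involves only extreme
-- coefficients of S and P. The interior does depend on the borders, so the orbit is no product of
-- independent cycles; this is why interiors are compared only at times where the borders agree. The
-- common period is an lcm over one partition for each border: the row y^d of P has degree at most h
-- in x and the two columns have degree at most d in y, whence `𝓛 h d d`.
--
-- Minimality concerns an actual automaton, so one of bounded size is built and then reduced, which
-- requires deciding reachability and equivalence of states.

open import Defs
open import Algebra.Apartness.Bundles using (HeytingField)
open import Algebra.Bundles using (CommutativeRing)
import Algebra.Properties.CommutativeMonoid.Mult as Mult
import Algebra.Properties.CommutativeMonoid.Sum as Sum
import Algebra.Properties.CommutativeSemiring.Binomial as BinomialTheorem
import Algebra.Properties.CommutativeSemiring.Exp as Exp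
import Algebra.Properties.Ring as RingProperties
import Algebra.Solver.Ring.NaturalCoefficients.Default as Solver
open import Data.Digit using (Expansion; fromDigits)
open import Data.Empty using (⊥)
open import Data.Fin.Base using (Fin; toℕ; fromℕ<; funToFin; finToFun; splitAt; join)
import Data.Fin.Base as Fin
import Data.Fin.Permutation as Permutation
import Data.Fin.Properties as Fin
open import Data.Fin.Properties using (funToFin-finToFin; finToFun-funToFin)
open import Data.List.Base
  using (List; []; _∷_; _++_; map; length; foldl; filter; allFin; lookup; take; drop)
open import Data.List.Extrema.Nat using (xs≤max)
open import Data.List.Membership.Propositional using (_∈_)
open import Data.List.Membership.Propositional.Properties
  using (∈-filter⁺; ∈-allFin; ∈-lookup; ∈-map⁺; ∈-upTo⁺)
open import Data.List.Properties
  using (length-++; foldl-++; length-filter; length-take; length-drop; length-tabulate; take++drop≡id)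
open import Data.List.Relation.Binary.Permutation.Propositional using (↭-sym)
open import Data.List.Relation.Binary.Permutation.Propositional.Properties using (All-resp-↭)
open import Data.List.Relation.Unary.All as All using (All; []; _∷_)
open import Data.List.Relation.Unary.All.Properties using (++⁺; ++⁻ˡ; ++⁻ʳ; all-filter)
open import Data.List.Relation.Unary.AllPairs using (AllPairs; _∷_)
import Data.List.Relation.Unary.Any as Any
open import Data.List.Relation.Unary.Any.Properties using (lookup-index)
open import Data.List.Relation.Unary.Linked using ([-])
open import Data.List.Relation.Unary.Unique.Propositional.Properties using (allFin⁺; filter⁺)
import Data.Maybe.Relation.Unary.All as Maybe
open import Data.Nat.Base as ℕ using (ℕ; zero; suc; _≤_; _<_; _∸_; _⊔_; _!; z≤n; s≤s)
open import Data.Nat.Combinatorics using (_C_; k![n∸k]!∣n!; nCn≡1)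
open import Data.Nat.Combinatorics.Specification using (nCk≡n!/k![n-k]!)
open import Data.Nat.Divisibility using (_∣_; divides; ∣-trans; m∣m*n; ∣1⇒≡1; >⇒∤)
open import Data.Nat.DivMod
  using (_%_; m/n*n≡m; m<n⇒m%n≡m; n%n≡0; [m+n]%n≡m%n; [m+kn]%n≡m%n)
open import Data.Nat.GCD using (gcd)
open import Data.Nat.Induction using (<-wellFounded)
open import Data.Nat.LCM using (lcm; m∣lcm[m,n]; n∣lcm[m,n]; gcd*lcm)
open import Data.Nat.ListAction using (sum)
open import Data.Nat.ListAction.Properties using (sum-++; sum-↭)
open import Data.Nat.Primality using (Prime; euclidsLemma; prime⇒nonZero; ¬prime[0]; ¬prime[1])
import Data.Nat.Properties as ℕ
open import Data.Nat.Properties using (_!*_!≢0)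
import Data.Nat.Solver as ℕSolver
open import Data.Product.Base using (∃; _×_; _,_; proj₁; proj₂)
open import Data.Sum.Base using (_⊎_; inj₁; inj₂; [_,_]′)
open import Data.Vec.Functional using (removeAt)
open import Function.Base using (_∘_; id)
open import Function.Bundles using (Inverse; Equivalence)
open import Induction.WellFounded using (Acc; acc)
import Level
open import Level using () renaming (_⊔_ to _⊔ˡ_)
open import Relation.Binary.Bundles using (Setoid)
import Relation.Binary.Construct.Flip.EqAndOrd as Flip
open import Relation.Binary.Definitions using (Decidable; Tri; tri<; tri≈; tri>)
open import Relation.Binary.PropositionalEquality as ≡ using (_≡_; _≢_)
import Relation.Binary.Reasoning.Setoid as SetoidReasoning
open import Relation.Nullary using (¬_; Dec; yes; no; contradiction)
open import Relation.Nullary.Decidable using (map′; _×-dec_; _⊎-dec_; ¬?; decidable-stable)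
open import Relation.Unary using () renaming (Decidable to Decidable₁)

open import Algebra.Properties.CommutativeSemigroup ℕ.+-commutativeSemigroup using (x∙yz≈y∙xz)
open import Data.List.Sort (Flip.decTotalOrder ℕ.≤-decTotalOrder) using (sort; sort-↭; sort-↗)

-- Power series

module PowerSeries {c ℓ} (R : CommutativeRing c ℓ) where

  open CommutativeRing R
  open Algebraic R public using (Series; 0ˢ)
    renaming (_≋_ to infix 4 _≋_; _⊕_ to infixl 6 _⊕_; _⊗_ to infixl 7 _⊗_)
  open Solver commutativeSemiring using (solve; _:=_; _:+_; _:*_)
  open SetoidReasoning setoid

  tail : Series → Series
  tail f n = f (suc n)

  shift : Series → Series
  shift f zero    = 0#
  shift f (suc n) = f n

  const : Carrier → Series
  const a zero    = a
  const a (suc n) = 0#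

  scale : Carrier → Series → Series
  scale a f n = a * f n

  -- Hiding the convolution sum leaves only the recursion `⋆-zero`, `⋆-suc` on the first coefficient
  -- of `f`; the laws of the product are proved by induction on the coefficient index through it.
  opaque
    infixl 7 _⋆_
    _⋆_ : Series → Series → Series
    _⋆_ = _⊗_

    ⋆≈⊗ : ∀ f g → (f ⋆ g) ≋ (f ⊗ g)
    ⋆≈⊗ f g n = refl

    ⋆-zero : ∀ f g → (f ⋆ g) 0 ≈ f 0 * g 0
    ⋆-zero f g = +-identityʳ _

    ⋆-suc : ∀ f g n → (f ⋆ g) (suc n) ≈ f 0 * g (suc n) + (tail f ⋆ g) n
    ⋆-suc f g n = refl

  ⋆-cong : ∀ {f f′ g g′} → f ≋ f′ → g ≋ g′ → (f ⋆ g) ≋ (f′ ⋆ g′)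
  ⋆-cong {f} {f′} {g} {g′} p q zero = begin
    (f ⋆ g) 0      ≈⟨ ⋆-zero f g ⟩
    f 0 * g 0      ≈⟨ *-cong (p 0) (q 0) ⟩
    f′ 0 * g′ 0    ≈⟨ ⋆-zero f′ g′ ⟨
    (f′ ⋆ g′) 0    ∎
  ⋆-cong {f} {f′} {g} {g′} p q (suc n) = begin
    (f ⋆ g) (suc n)                          ≈⟨ ⋆-suc f g n ⟩
    f 0 * g (suc n) + (tail f ⋆ g) n         ≈⟨ +-cong (*-cong (p 0) (q (suc n))) (⋆-cong (p ∘ suc) q n) ⟩
    f′ 0 * g′ (suc n) + (tail f′ ⋆ g′) n     ≈⟨ ⋆-suc f′ g′ n ⟨
    (f′ ⋆ g′) (suc n)                        ∎

  -- Peels off the last summand where `⋆-suc` peels off the first; commutativity follows by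
  -- comparing the two recursions.
  ⋆-sucʳ : ∀ f g n → (f ⋆ g) (suc n) ≈ (f ⋆ tail g) n + f (suc n) * g 0
  ⋆-sucʳ f g zero = begin
    (f ⋆ g) 1                        ≈⟨ ⋆-suc f g 0 ⟩
    f 0 * g 1 + (tail f ⋆ g) 0       ≈⟨ +-cong (sym (⋆-zero f (tail g))) (⋆-zero (tail f) g) ⟩
    (f ⋆ tail g) 0 + f 1 * g 0       ∎
  ⋆-sucʳ f g (suc n) = begin
    (f ⋆ g) (suc (suc n))                                      ≈⟨ ⋆-suc f g (suc n) ⟩
    f 0 * g (suc (suc n)) + (tail f ⋆ g) (suc n)               ≈⟨ +-congˡ (⋆-sucʳ (tail f) g n) ⟩
    f 0 * g (suc (suc n)) + ((tail f ⋆ tail g) n + f (suc (suc n)) * g 0) ≈⟨ +-assoc _ _ _ ⟨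
    f 0 * g (suc (suc n)) + (tail f ⋆ tail g) n + f (suc (suc n)) * g 0   ≈⟨ +-congʳ (⋆-suc f (tail g) n) ⟨
    (f ⋆ tail g) (suc n) + f (suc (suc n)) * g 0               ∎

  ⋆-comm : ∀ f g → (f ⋆ g) ≋ (g ⋆ f)
  ⋆-comm f g zero = begin
    (f ⋆ g) 0    ≈⟨ ⋆-zero f g ⟩
    f 0 * g 0    ≈⟨ *-comm _ _ ⟩
    g 0 * f 0    ≈⟨ ⋆-zero g f ⟨
    (g ⋆ f) 0    ∎
  ⋆-comm f g (suc n) = begin
    (f ⋆ g) (suc n)                      ≈⟨ ⋆-suc f g n ⟩
    f 0 * g (suc n) + (tail f ⋆ g) n     ≈⟨ +-cong (*-comm _ _) (⋆-comm (tail f) g n) ⟩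
    g (suc n) * f 0 + (g ⋆ tail f) n     ≈⟨ +-comm _ _ ⟩
    (g ⋆ tail f) n + g (suc n) * f 0     ≈⟨ ⋆-sucʳ g f n ⟨
    (g ⋆ f) (suc n)                      ∎

  ⋆-distribʳ : ∀ f g h → ((g ⊕ h) ⋆ f) ≋ ((g ⋆ f) ⊕ (h ⋆ f))
  ⋆-distribʳ f g h zero = begin
    ((g ⊕ h) ⋆ f) 0              ≈⟨ ⋆-zero (g ⊕ h) f ⟩
    (g 0 + h 0) * f 0            ≈⟨ distribʳ _ _ _ ⟩
    g 0 * f 0 + h 0 * f 0        ≈⟨ +-cong (⋆-zero g f) (⋆-zero h f) ⟨
    (g ⋆ f) 0 + (h ⋆ f) 0        ∎
  ⋆-distribʳ f g h (suc n) = begin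
    ((g ⊕ h) ⋆ f) (suc n)                                                       ≈⟨ ⋆-suc (g ⊕ h) f n ⟩
    (g 0 + h 0) * f (suc n) + ((tail g ⊕ tail h) ⋆ f) n                         ≈⟨ +-congˡ (⋆-distribʳ f (tail g) (tail h) n) ⟩
    (g 0 + h 0) * f (suc n) + ((tail g ⋆ f) n + (tail h ⋆ f) n)                 ≈⟨ solve 5 (λ a b x u v → (a :+ b) :* x :+ (u :+ v) := (a :* x :+ u) :+ (b :* x :+ v)) refl _ _ _ _ _ ⟩
    (g 0 * f (suc n) + (tail g ⋆ f) n) + (h 0 * f (suc n) + (tail h ⋆ f) n)     ≈⟨ +-cong (⋆-suc g f n) (⋆-suc h f n) ⟨
    (g ⋆ f) (suc n) + (h ⋆ f) (suc n)                                           ∎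

  scale-⋆ : ∀ a f g → (scale a f ⋆ g) ≋ scale a (f ⋆ g)
  scale-⋆ a f g zero = begin
    (scale a f ⋆ g) 0    ≈⟨ ⋆-zero (scale a f) g ⟩
    a * f 0 * g 0        ≈⟨ *-assoc _ _ _ ⟩
    a * (f 0 * g 0)      ≈⟨ *-congˡ (⋆-zero f g) ⟨
    a * (f ⋆ g) 0        ∎
  scale-⋆ a f g (suc n) = begin
    (scale a f ⋆ g) (suc n)                            ≈⟨ ⋆-suc (scale a f) g n ⟩
    a * f 0 * g (suc n) + (scale a (tail f) ⋆ g) n     ≈⟨ +-congˡ (scale-⋆ a (tail f) g n) ⟩
    a * f 0 * g (suc n) + a * (tail f ⋆ g) n           ≈⟨ solve 4 (λ a x y z → a :* x :* y :+ a :* z := a :* (x :* y :+ z)) refl _ _ _ _ ⟩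
    a * (f 0 * g (suc n) + (tail f ⋆ g) n)             ≈⟨ *-congˡ (⋆-suc f g n) ⟨
    a * (f ⋆ g) (suc n)                                ∎

  0⋆ : ∀ f → (0ˢ ⋆ f) ≋ 0ˢ
  0⋆ f zero = trans (⋆-zero 0ˢ f) (zeroˡ _)
  0⋆ f (suc n) = begin
    (0ˢ ⋆ f) (suc n)                 ≈⟨ ⋆-suc 0ˢ f n ⟩
    0# * f (suc n) + (0ˢ ⋆ f) n      ≈⟨ +-cong (zeroˡ _) (0⋆ f n) ⟩
    0# + 0#                          ≈⟨ +-identityˡ 0# ⟩
    0#                               ∎

  const-⋆ : ∀ a f → (const a ⋆ f) ≋ scale a f
  const-⋆ a f zero = ⋆-zero (const a) f
  const-⋆ a f (suc n) = begin
    (const a ⋆ f) (suc n)          ≈⟨ ⋆-suc (const a) f n ⟩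
    a * f (suc n) + (0ˢ ⋆ f) n     ≈⟨ +-congˡ (0⋆ f n) ⟩
    a * f (suc n) + 0#             ≈⟨ +-identityʳ _ ⟩
    a * f (suc n)                  ∎

  ⋆-assoc : ∀ f g h → ((f ⋆ g) ⋆ h) ≋ (f ⋆ (g ⋆ h))
  ⋆-assoc f g h zero = begin
    ((f ⋆ g) ⋆ h) 0      ≈⟨ ⋆-zero (f ⋆ g) h ⟩
    (f ⋆ g) 0 * h 0      ≈⟨ *-congʳ (⋆-zero f g) ⟩
    f 0 * g 0 * h 0      ≈⟨ *-assoc _ _ _ ⟩
    f 0 * (g 0 * h 0)    ≈⟨ *-congˡ (⋆-zero g h) ⟨
    f 0 * (g ⋆ h) 0      ≈⟨ ⋆-zero f (g ⋆ h) ⟨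
    (f ⋆ (g ⋆ h)) 0      ∎
  ⋆-assoc f g h (suc n) = begin
    ((f ⋆ g) ⋆ h) (suc n)
      ≈⟨ ⋆-suc (f ⋆ g) h n ⟩
    (f ⋆ g) 0 * h (suc n) + (tail (f ⋆ g) ⋆ h) n
      ≈⟨ +-cong (*-congʳ (⋆-zero f g)) (⋆-cong {g = h} (⋆-suc f g) (λ _ → refl) n) ⟩
    f 0 * g 0 * h (suc n) + ((scale (f 0) (tail g) ⊕ (tail f ⋆ g)) ⋆ h) n
      ≈⟨ +-congˡ (⋆-distribʳ h (scale (f 0) (tail g)) (tail f ⋆ g) n) ⟩
    f 0 * g 0 * h (suc n) + ((scale (f 0) (tail g) ⋆ h) n + ((tail f ⋆ g) ⋆ h) n)
      ≈⟨ +-congˡ (+-cong (scale-⋆ (f 0) (tail g) h n) (⋆-assoc (tail f) g h n)) ⟩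
    f 0 * g 0 * h (suc n) + (f 0 * (tail g ⋆ h) n + (tail f ⋆ (g ⋆ h)) n)
      ≈⟨ solve 5 (λ a b x u v → a :* b :* x :+ (a :* u :+ v) := a :* (b :* x :+ u) :+ v) refl _ _ _ _ _ ⟩
    f 0 * (g 0 * h (suc n) + (tail g ⋆ h) n) + (tail f ⋆ (g ⋆ h)) n
      ≈⟨ +-congʳ (*-congˡ (⋆-suc g h n)) ⟨
    f 0 * (g ⋆ h) (suc n) + (tail f ⋆ (g ⋆ h)) n
      ≈⟨ ⋆-suc f (g ⋆ h) n ⟨
    (f ⋆ (g ⋆ h)) (suc n) ∎

  -- Available as a ring so that the construction can be iterated: series in y over K[[x]] serve as
  -- bivariate series, and the semiring solver applies on both levels.
  seriesRing : CommutativeRing c ℓ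
  seriesRing = record
    { Carrier = Series
    ; _≈_ = _≋_
    ; _+_ = _⊕_
    ; _*_ = _⋆_
    ; -_ = λ f n → - f n
    ; 0# = 0ˢ
    ; 1# = const 1#
    ; isCommutativeRing = record
      { isRing = record
        { +-isAbelianGroup = record
          { isGroup = record
            { isMonoid = record
              { isSemigroup = record
                { isMagma = record
                  { isEquivalence = record
                    { refl = λ n → refl
                    ; sym = λ p n → sym (p n)
                    ; trans = λ p q n → trans (p n) (q n)
                    }
                  ; ∙-cong = λ p q n → +-cong (p n) (q n)
                  }
                ; assoc = λ f g h n → +-assoc (f n) (g n) (h n)
                }
              ; identity = (λ f n → +-identityˡ (f n)) , (λ f n → +-identityʳ (f n))
              }
            ; inverse = (λ f n → -‿inverseˡ (f n)) , (λ f n → -‿inverseʳ (f n))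
            ; ⁻¹-cong = λ p n → -‿cong (p n)
            }
          ; comm = λ f g n → +-comm (f n) (g n)
          }
        ; *-cong = ⋆-cong
        ; *-assoc = ⋆-assoc
        ; *-identity = 1⋆ , λ f n → trans (⋆-comm f (const 1#) n) (1⋆ f n)
        ; distrib = (λ f g h n → trans (⋆-comm f (g ⊕ h) n) (trans (⋆-distribʳ f g h n) (+-cong (⋆-comm g f n) (⋆-comm h f n)))) , ⋆-distribʳ
        }
      ; *-comm = ⋆-comm
      }
    }
    where
    1⋆ : ∀ f → (const 1# ⋆ f) ≋ f
    1⋆ f n = trans (const-⋆ 1# f n) (*-identityˡ (f n))

  shift-cong : ∀ {f g} → f ≋ g → shift f ≋ shift g
  shift-cong p zero    = refl
  shift-cong p (suc n) = p n

  shift-⋆ : ∀ f g → (shift f ⋆ g) ≋ shift (f ⋆ g)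
  shift-⋆ f g zero = trans (⋆-zero (shift f) g) (zeroˡ _)
  shift-⋆ f g (suc n) = begin
    (shift f ⋆ g) (suc n)         ≈⟨ ⋆-suc (shift f) g n ⟩
    0# * g (suc n) + (f ⋆ g) n    ≈⟨ +-congʳ (zeroˡ _) ⟩
    0# + (f ⋆ g) n                ≈⟨ +-identityˡ _ ⟩
    (f ⋆ g) n                     ∎

  head+tail : ∀ f → f ≋ (const (f 0) ⊕ shift (tail f))
  head+tail f zero    = sym (+-identityʳ _)
  head+tail f (suc n) = sym (+-identityˡ _)

  X : Series
  X = shift (const 1#)

  X⋆ : ∀ f → (X ⋆ f) ≋ shift f
  X⋆ f n = trans (shift-⋆ (const 1#) f n)
    (shift-cong (λ m → trans (const-⋆ 1# f m) (*-identityˡ (f m))) n)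

  const-cong : ∀ {a b} → a ≈ b → const a ≋ const b
  const-cong p zero    = p
  const-cong p (suc n) = refl

  const-* : ∀ a b → const (a * b) ≋ (const a ⋆ const b)
  const-* a b zero    = sym (⋆-zero (const a) (const b))
  const-* a b (suc n) = sym (trans (const-⋆ a (const b) (suc n)) (zeroʳ a))

  const-+ : ∀ a b → const (a + b) ≋ (const a ⊕ const b)
  const-+ a b zero    = refl
  const-+ a b (suc n) = sym (+-identityˡ 0#)

module Degrees {c ℓ} (R : CommutativeRing c ℓ) where

  open PowerSeries R
  open CommutativeRing R
  open SetoidReasoning setoid
  open Exp (CommutativeRing.commutativeSemiring seriesRing) using (_^_)
  open Exp commutativeSemiring using () renaming (_^_ to _^ᴿ_)

  Deg≤ : ℕ → Series → Set ℓ
  Deg≤ n f = ∀ k → n < k → f k ≈ 0#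

  Deg≤-resp : ∀ {n f g} → f ≋ g → Deg≤ n f → Deg≤ n g
  Deg≤-resp p d k n<k = trans (sym (p k)) (d k n<k)

  Deg≤-mono : ∀ {m n f} → m ≤ n → Deg≤ m f → Deg≤ n f
  Deg≤-mono m≤n d k n<k = d k (ℕ.≤-<-trans m≤n n<k)

  Deg≤-⊕ : ∀ {n f g} → Deg≤ n f → Deg≤ n g → Deg≤ n (f ⊕ g)
  Deg≤-⊕ d e k n<k = trans (+-cong (d k n<k) (e k n<k)) (+-identityˡ 0#)

  Deg≤-const : ∀ {n} a → Deg≤ n (const a)
  Deg≤-const a (suc k) _ = refl

  Deg≤-shift : ∀ {n f} → Deg≤ n f → Deg≤ (suc n) (shift f)
  Deg≤-shift d (suc k) (s≤s n<k) = d k n<k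

  private
    0-tail : ∀ f → Deg≤ 0 f → tail f ≋ 0ˢ
    0-tail f d k = d (suc k) (s≤s z≤n)

    0-deg-⋆ : ∀ f g → Deg≤ 0 f → ∀ k → (f ⋆ g) k ≈ f 0 * g k
    0-deg-⋆ f g d zero    = ⋆-zero f g
    0-deg-⋆ f g d (suc k) = begin
      (f ⋆ g) (suc k)                      ≈⟨ ⋆-suc f g k ⟩
      f 0 * g (suc k) + (tail f ⋆ g) k     ≈⟨ +-congˡ (trans (⋆-cong {g = g} (0-tail f d) (λ _ → refl) k) (0⋆ g k)) ⟩
      f 0 * g (suc k) + 0#                 ≈⟨ +-identityʳ _ ⟩
      f 0 * g (suc k)                      ∎

  Deg≤-⋆ : ∀ {a b} f g → Deg≤ a f → Deg≤ b g → Deg≤ (a ℕ.+ b) (f ⋆ g)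
  Deg≤-⋆ {zero} f g d e k b<k = trans (0-deg-⋆ f g d k) (trans (*-congˡ (e k b<k)) (zeroʳ _))
  Deg≤-⋆ {suc a} {b} f g d e (suc k) (s≤s a+b<k) = begin
    (f ⋆ g) (suc k)                      ≈⟨ ⋆-suc f g k ⟩
    f 0 * g (suc k) + (tail f ⋆ g) k     ≈⟨ +-cong (*-congˡ (e (suc k) (ℕ.m<n⇒m<1+n (ℕ.≤-<-trans (ℕ.m≤n+m b a) a+b<k)))) (Deg≤-⋆ (tail f) g (λ m a<m → d (suc m) (s≤s a<m)) e k a+b<k) ⟩
    f 0 * 0# + 0#                        ≈⟨ +-identityʳ _ ⟩
    f 0 * 0#                             ≈⟨ zeroʳ _ ⟩
    0#                                   ∎

  ⋆-top : ∀ {a b} f g → Deg≤ a f → Deg≤ b g → (f ⋆ g) (a ℕ.+ b) ≈ f a * g b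
  ⋆-top {zero} f g d e = 0-deg-⋆ f g d _
  ⋆-top {suc a} {b} f g d e = begin
    (f ⋆ g) (suc (a ℕ.+ b))                          ≈⟨ ⋆-suc f g _ ⟩
    f 0 * g (suc (a ℕ.+ b)) + (tail f ⋆ g) (a ℕ.+ b) ≈⟨ +-cong (trans (*-congˡ (e _ (s≤s (ℕ.m≤n+m b a)))) (zeroʳ _)) (⋆-top (tail f) g (λ m a<m → d (suc m) (s≤s a<m)) e) ⟩
    0# + f (suc a) * g b                             ≈⟨ +-identityˡ _ ⟩
    f (suc a) * g b                                  ∎

  Deg≤-^ : ∀ {a} f → Deg≤ a f → ∀ m → Deg≤ (m ℕ.* a) (f ^ m)
  Deg≤-^ f d zero    = Deg≤-const 1#
  Deg≤-^ f d (suc m) = Deg≤-⋆ f (f ^ m) d (Deg≤-^ f d m)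

  ^-top : ∀ {a} f → Deg≤ a f → ∀ m → (f ^ m) (m ℕ.* a) ≈ f a ^ᴿ m
  ^-top f d zero    = refl
  ^-top f d (suc m) = trans (⋆-top f (f ^ m) d (Deg≤-^ f d m)) (*-congˡ (^-top f d m))

  shiftBy : ℕ → Series → Series
  shiftBy zero    f = f
  shiftBy (suc k) f = shift (shiftBy k f)

  X^⋆ : ∀ k f → (X ^ k ⋆ f) ≋ shiftBy k f
  X^⋆ zero    f n = trans (const-⋆ 1# f n) (*-identityˡ _)
  X^⋆ (suc k) f n = trans (⋆-assoc X (X ^ k) f n) (trans (X⋆ (X ^ k ⋆ f) n) (shift-cong (X^⋆ k f) n))

  shiftBy-+ : ∀ k f n → shiftBy k f (k ℕ.+ n) ≡ f n
  shiftBy-+ zero    f n = ≡.refl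
  shiftBy-+ (suc k) f n = shiftBy-+ k f n

  shiftBy-< : ∀ k f n → n < k → shiftBy k f n ≡ 0#
  shiftBy-< (suc k) f zero    _         = ≡.refl
  shiftBy-< (suc k) f (suc n) (s≤s n<k) = shiftBy-< k f n n<k

  -- The univariate Cartier operator Λ_r, with an arbitrary modulus Q in place of q.
  section : ℕ → ℕ → Series → Series
  section Q r f n = f (r ℕ.+ n ℕ.* Q)

  section-cong : ∀ Q r {f g} → f ≋ g → section Q r f ≋ section Q r g
  section-cong Q r p n = p _

  section-X^ : ∀ Q r f → r < Q → section Q r (X ^ Q ⋆ f) ≋ shift (section Q r f)
  section-X^ Q r f r<Q zero = begin
    (X ^ Q ⋆ f) (r ℕ.+ 0)     ≈⟨ X^⋆ Q f _ ⟩
    shiftBy Q f (r ℕ.+ 0)     ≡⟨ ≡.cong (shiftBy Q f) (ℕ.+-identityʳ r) ⟩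
    shiftBy Q f r             ≡⟨ shiftBy-< Q f r r<Q ⟩
    0#                        ∎
  section-X^ Q r f r<Q (suc n) = begin
    (X ^ Q ⋆ f) (r ℕ.+ (Q ℕ.+ n ℕ.* Q))     ≈⟨ X^⋆ Q f _ ⟩
    shiftBy Q f (r ℕ.+ (Q ℕ.+ n ℕ.* Q))     ≡⟨ ≡.cong (shiftBy Q f) (x∙yz≈y∙xz r Q (n ℕ.* Q)) ⟩
    shiftBy Q f (Q ℕ.+ (r ℕ.+ n ℕ.* Q))     ≡⟨ shiftBy-+ Q f _ ⟩
    f (r ℕ.+ n ℕ.* Q)                       ∎

  section-section : ∀ Q Q′ f → section Q 0 (section Q′ 0 f) ≋ section (Q ℕ.* Q′) 0 f
  section-section Q Q′ f n = reflexive (≡.cong f (ℕ.*-assoc n Q Q′))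

  -- Dropping the low coefficients of `f` that vanish reduces to f(0) ≠ 0, and then the coefficients
  -- of `g` vanish one after the other. The bound `N` makes the search for the first nonzero
  -- coefficient terminate.
  ⋆-cancelˡ : (∀ a → a ≈ 0# ⊎ ¬ (a ≈ 0#)) → (∀ {a b} → ¬ (a ≈ 0#) → a * b ≈ 0# → b ≈ 0#) →
              ∀ N f g → (∃ λ n → n < N × ¬ (f n ≈ 0#)) → (f ⋆ g) ≋ 0ˢ → g ≋ 0ˢ
  ⋆-cancelˡ ≈0? dom (suc N) f g (m , m<N , fm≉0) fg≈0 with ≈0? (f 0)
  ... | inj₂ f0≉0 = λ n → below (suc n) n (ℕ.n<1+n n)
    where
    vanish : ∀ n (f′ : Series) → (∀ k → k ≤ n → g k ≈ 0#) → (f′ ⋆ g) n ≈ 0#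
    vanish zero    f′ z = trans (⋆-zero f′ g) (trans (*-congˡ (z 0 z≤n)) (zeroʳ _))
    vanish (suc n) f′ z = begin
      (f′ ⋆ g) (suc n)                       ≈⟨ ⋆-suc f′ g n ⟩
      f′ 0 * g (suc n) + (tail f′ ⋆ g) n     ≈⟨ +-cong (trans (*-congˡ (z (suc n) ℕ.≤-refl)) (zeroʳ _)) (vanish n (tail f′) (λ k k≤n → z k (ℕ.m≤n⇒m≤1+n k≤n))) ⟩
      0# + 0#                                ≈⟨ +-identityˡ _ ⟩
      0#                                     ∎

    at : ∀ n → (∀ k → k < n → g k ≈ 0#) → g n ≈ 0#
    at zero    z = dom f0≉0 (trans (sym (⋆-zero f g)) (fg≈0 0))
    at (suc n) z = dom f0≉0 (begin
      f 0 * g (suc n)                        ≈⟨ +-identityʳ _ ⟨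
      f 0 * g (suc n) + 0#                   ≈⟨ +-congˡ (vanish n (tail f) (λ k k≤n → z k (s≤s k≤n))) ⟨
      f 0 * g (suc n) + (tail f ⋆ g) n       ≈⟨ ⋆-suc f g n ⟨
      (f ⋆ g) (suc n)                        ≈⟨ fg≈0 (suc n) ⟩
      0#                                     ∎)

    below : ∀ n k → k < n → g k ≈ 0#
    below (suc n) k (s≤s k≤n) = at k (λ j j<k → below n j (ℕ.<-≤-trans j<k k≤n))
  ⋆-cancelˡ ≈0? dom (suc N) f g (zero , _ , f0≉0) fg≈0 | inj₁ f0≈0 = contradiction f0≈0 f0≉0
  ⋆-cancelˡ ≈0? dom (suc N) f g (suc m , s≤s m<N , fm≉0) fg≈0 | inj₁ f0≈0 =
    ⋆-cancelˡ ≈0? dom N (tail f) g (m , m<N , fm≉0) λ n → begin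
      (tail f ⋆ g) n                       ≈⟨ +-identityˡ _ ⟨
      0# + (tail f ⋆ g) n                  ≈⟨ +-congʳ (trans (*-congʳ f0≈0) (zeroˡ _)) ⟨
      f 0 * g (suc n) + (tail f ⋆ g) n     ≈⟨ ⋆-suc f g n ⟨
      (f ⋆ g) (suc n)                      ≈⟨ fg≈0 (suc n) ⟩
      0#                                   ∎

-- The Frobenius map in characteristic p

module Frobenius {c ℓ} (A : CommutativeRing c ℓ) where

  open CommutativeRing A
  open Exp commutativeSemiring
  open SetoidReasoning setoid
  open Mult +-commutativeMonoid using (×-congʳ; ×-assocˡ) renaming (_×_ to _·_)
  private
    module Binomial = BinomialTheorem commutativeSemiring
    module Σ = Sum +-commutativeMonoid

  Additive : ℕ → Set (c ⊔ˡ ℓ)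
  Additive n = ∀ x y → (x + y) ^ n ≈ x ^ n + y ^ n

  additive-* : ∀ m n → Additive m → Additive n → Additive (m ℕ.* n)
  additive-* m n am an x y = begin
    (x + y) ^ (m ℕ.* n)             ≈⟨ ^-assocʳ (x + y) m n ⟨
    ((x + y) ^ m) ^ n               ≈⟨ ^-congˡ n (am x y) ⟩
    (x ^ m + y ^ m) ^ n             ≈⟨ an _ _ ⟩
    (x ^ m) ^ n + (y ^ m) ^ n       ≈⟨ +-cong (^-assocʳ x m n) (^-assocʳ y m n) ⟩
    x ^ (m ℕ.* n) + y ^ (m ℕ.* n)   ∎

  additive-^ : ∀ m k → Additive m → Additive (m ℕ.^ k)
  additive-^ m zero    am x y = trans (*-identityʳ _) (+-cong (sym (*-identityʳ x)) (sym (*-identityʳ y)))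
  additive-^ m (suc k) am = additive-* m (m ℕ.^ k) am (additive-^ m k am)

  ×-1-* : ∀ n x → n · x ≈ (n · 1#) * x
  ×-1-* zero    x = sym (zeroˡ x)
  ×-1-* (suc n) x = trans (+-cong (sym (*-identityˡ x)) (×-1-* n x)) (sym (distribʳ x 1# (n · 1#)))

  char-∣ : ∀ {p n} → p · 1# ≈ 0# → p ∣ n → ∀ x → n · x ≈ 0#
  char-∣ {p} char (divides m ≡.refl) x = begin
    (m ℕ.* p) · x          ≈⟨ ×-assocˡ x m p ⟨
    m · (p · x)            ≈⟨ ×-congʳ m (trans (×-1-* p x) (trans (*-congʳ char) (zeroˡ x))) ⟩
    m · 0#                 ≈⟨ trans (×-1-* m 0#) (zeroʳ _) ⟩
    0#                     ∎

  -- p divides p! = C(p, k) k! (p - k)!, but none of the factors of k! and (p - k)!, which are all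
  -- positive and smaller than p.
  prime-∣-C : ∀ {p k} → Prime p → 0 < k → k < p → p ∣ p C k
  prime-∣-C {p} {k} pr 0<k k<p = [ id , (λ d → contradiction d p∤k![p∸k]!) ]′
    (euclidsLemma (p C k) (k ! ℕ.* (p ∸ k) !) pr (≡.subst (p ∣_) (≡.sym product≡p!) (n∣n! p pr)))
    where
    instance
      k![p∸k]!≢0 = k !* (p ∸ k) !≢0

    n∣n! : ∀ n → Prime n → n ∣ n !
    n∣n! (suc n) _ = m∣m*n (n !)

    product≡p! : (p C k) ℕ.* (k ! ℕ.* (p ∸ k) !) ≡ p !
    product≡p! = ≡.trans (≡.cong (ℕ._* (k ! ℕ.* (p ∸ k) !)) (nCk≡n!/k![n-k]! (ℕ.<⇒≤ k<p)))
      (m/n*n≡m (k![n∸k]!∣n! (ℕ.<⇒≤ k<p)))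

    p∤! : ∀ m → m < p → ¬ p ∣ m !
    p∤! zero    0<p p∣1 = contradiction (∣1⇒≡1 p∣1) λ { ≡.refl → ¬prime[1] pr }
    p∤! (suc m) m<p p∣! = [ (λ d → contradiction d (>⇒∤ m<p)) , p∤! m (ℕ.<⇒≤ m<p) ]′
      (euclidsLemma (suc m) (m !) pr p∣!)

    p∤k![p∸k]! : ¬ p ∣ k ! ℕ.* (p ∸ k) !
    p∤k![p∸k]! d = [ p∤! k k<p , p∤! (p ∸ k) (ℕ.∸-monoʳ-< 0<k (ℕ.<⇒≤ k<p)) ]′
      (euclidsLemma (k !) ((p ∸ k) !) pr d)

  prime-additive : ∀ {p} → Prime p → p · 1# ≈ 0# → Additive p
  prime-additive {zero}  pr char x y = contradiction pr ¬prime[0]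
  prime-additive {suc p} pr char x y = begin
    (x + y) ^ suc p                                             ≈⟨ Binomial.theorem (suc p) x y ⟩
    Σ.sum term                                                  ≡⟨⟩
    term Fin.zero + Σ.sum (term ∘ Fin.suc)                      ≈⟨ +-cong head≈ (Σ.sum-init-last (term ∘ Fin.suc)) ⟩
    y ^ suc p + (Σ.sum inner + term (Fin.suc (Fin.fromℕ p)))    ≈⟨ +-congˡ (+-cong inner≈ last≈) ⟩
    y ^ suc p + (0# + x ^ suc p)                                ≈⟨ trans (+-congˡ (+-identityˡ _)) (+-comm _ _) ⟩
    x ^ suc p + y ^ suc p                                       ∎
    where
    term : Fin (suc (suc p)) → Carrier
    term = Binomial.binomialTerm x y (suc p)

    inner : Fin p → Carrier
    inner i = term (Fin.suc (Fin.inject₁ i))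

    head≈ : term Fin.zero ≈ y ^ suc p
    head≈ = trans (+-identityʳ _) (*-identityˡ _)

    last≈ : term (Fin.suc (Fin.fromℕ p)) ≈ x ^ suc p
    last≈ rewrite Fin.toℕ-fromℕ p | nCn≡1 (suc p) | ℕ.n∸n≡0 p = trans (+-identityʳ _) (*-identityʳ _)

    inner≈ : Σ.sum inner ≈ 0#
    inner≈ = trans (Σ.sum-cong-≋ {p} {inner} {λ _ → 0#} λ i → char-∣ char
        (prime-∣-C pr (s≤s z≤n) (s≤s (≡.subst (_< p) (≡.sym (Fin.toℕ-inject₁ i)) (Fin.toℕ<n i)))) _)
      (Σ.sum-replicate-zero p)

-- Finite fields

module _ {n} (f : Fin n → Fin n) (f-injective : ∀ {i j} → f i ≡ f j → i ≡ j) where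

  -- A missed value could be punched out of the codomain, which would put n elements injectively
  -- into n - 1 places.
  injective⇒surjective : ∀ i → ∃ λ j → f j ≡ i
  injective⇒surjective = onto f f-injective
    where
    onto : ∀ {n} (f : Fin n → Fin n) → (∀ {i j} → f i ≡ f j → i ≡ j) → ∀ i → ∃ λ j → f j ≡ i
    onto {suc n} f f-inj i with Fin.any? (λ j → f j Fin.≟ i)
    ... | yes hit = hit
    ... | no miss with Fin.pigeonhole (ℕ.n<1+n n) (λ j → Fin.punchOut {i = i} {j = f j} (λ e → miss (j , ≡.sym e)))
    ... | j , k , j<k , e = contradiction (f-inj (Fin.punchOut-injective (λ e′ → miss (j , ≡.sym e′)) (λ e′ → miss (k , ≡.sym e′)) e)) (Fin.<⇒≢ j<k)

  injective⇒permutation : Permutation.Permutation n n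
  injective⇒permutation = Permutation.permutation f (proj₁ ∘ injective⇒surjective)
    (proj₂ ∘ injective⇒surjective)
    (λ i → f-injective (proj₂ (injective⇒surjective (f i))))

enumerated⇒decidable : ∀ {c ℓ n} {S : Setoid c ℓ} → Inverse S (≡.setoid (Fin n)) → Decidable (Setoid._≈_ S)
enumerated⇒decidable {S = S} enumeration a b =
  map′ (λ e → trans (sym (strictlyInverseʳ a)) (trans (from-cong e) (strictlyInverseʳ b))) to-cong (to a Fin.≟ to b)
  where
  open Setoid S using (trans; sym)
  open Inverse enumeration

module _ {c ℓ} (A : CommutativeRing c ℓ) where

  open CommutativeRing A

  NoZeroDivisors : Set (c ⊔ˡ ℓ)
  NoZeroDivisors = ∀ {a b} → ¬ (a ≈ 0#) → a * b ≈ 0# → b ≈ 0#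

module FiniteDomain {c ℓ} (A : CommutativeRing c ℓ) {N : ℕ}
  (enumeration : Inverse (CommutativeRing.setoid A) (≡.setoid (Fin N)))
  (zero-product : NoZeroDivisors A)
  where

  open CommutativeRing A
  open Inverse enumeration
  open SetoidReasoning (CommutativeRing.setoid A)
  open RingProperties ring using (x∙y⁻¹≈ε⇒x≈y; x≈y⇒x∙y⁻¹≈ε; x[y-z]≈xy-xz; +-cancelˡ; +-cancelʳ)
  open Mult +-commutativeMonoid using () renaming (_×_ to _·_)
  open Exp commutativeSemiring using (_^_; ^-congˡ)
  private
    module Σ = Sum +-commutativeMonoid
    module Π = Sum *-commutativeMonoid

  infix 4 _≈?_

  _≈?_ : Decidable _≈_
  _≈?_ = enumerated⇒decidable enumeration

  *-cancelˡ : ∀ {a b b′} → ¬ (a ≈ 0#) → a * b ≈ a * b′ → b ≈ b′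
  *-cancelˡ {a} {b} {b′} a≉0 e = x∙y⁻¹≈ε⇒x≈y b b′ (zero-product a≉0
    (trans (x[y-z]≈xy-xz a b b′) (x≈y⇒x∙y⁻¹≈ε e)))

  module _ (φ : Carrier → Carrier) (φ-cong : ∀ {a b} → a ≈ b → φ a ≈ φ b)
           (φ-injective : ∀ {a b} → φ a ≈ φ b → a ≈ b) where

    private
      π : Permutation.Permutation N N
      π = injective⇒permutation (λ i → to (φ (from i))) λ {i} {j} e →
        ≡.trans (≡.sym (strictlyInverseˡ i)) (≡.trans (to-cong (φ-injective
          (trans (sym (strictlyInverseʳ _)) (trans (from-cong e) (strictlyInverseʳ _)))))
          (strictlyInverseˡ j))

    sum-reindex : Σ.sum (λ i → φ (from i)) ≈ Σ.sum from
    sum-reindex = sym (trans (Σ.sum-permute from π)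
      (Σ.sum-cong-≋ λ i → strictlyInverseʳ (φ (from i))))

    product-reindex : ∀ (g : Carrier → Carrier) → (∀ {a b} → a ≈ b → g a ≈ g b) →
                      Π.sum (λ i → g (φ (from i))) ≈ Π.sum (λ i → g (from i))
    product-reindex g g-cong = sym (trans (Π.sum-permute (λ i → g (from i)) π)
      (Π.sum-cong-≋ λ i → g-cong (strictlyInverseʳ (φ (from i)))))

  -- Translation by 1 permutes the elements, so their sum does not change when 1 is added N times.
  card·1≈0 : N · 1# ≈ 0#
  card·1≈0 = +-cancelˡ (Σ.sum from) _ _ (begin
    Σ.sum from + N · 1#                    ≈⟨ +-congˡ (Σ.sum-replicate N) ⟨
    Σ.sum from + Σ.sum {N} (λ _ → 1#)      ≈⟨ Σ.∑-distrib-+ from (λ _ → 1#) ⟨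
    Σ.sum (λ i → from i + 1#)              ≈⟨ sum-reindex (_+ 1#) +-congʳ (+-cancelʳ 1# _ _) ⟩
    Σ.sum from                             ≈⟨ +-identityʳ _ ⟨
    Σ.sum from + 0#                        ∎)

  private
    nonzero-part : Carrier → Carrier
    nonzero-part x with x ≈? 0#
    ... | yes _ = 1#
    ... | no  _ = x

    nonzero-part-cong : ∀ {x y} → x ≈ y → nonzero-part x ≈ nonzero-part y
    nonzero-part-cong {x} {y} e with x ≈? 0# | y ≈? 0#
    ... | yes _   | yes _   = refl
    ... | no _    | no _    = e
    ... | yes x≈0 | no y≉0  = contradiction (trans (sym e) x≈0) y≉0
    ... | no x≉0  | yes y≈0 = contradiction (trans e y≈0) x≉0

    at-zero : Carrier → Carrier → Carrier
    at-zero a x with x ≈? 0#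
    ... | yes _ = a
    ... | no  _ = 1#

    at-zero-0 : ∀ a {x} → x ≈ 0# → at-zero a x ≈ a
    at-zero-0 a {x} x≈0 with x ≈? 0#
    ... | yes _  = refl
    ... | no x≉0 = contradiction x≈0 x≉0

    at-zero-1 : ∀ a {x} → ¬ (x ≈ 0#) → at-zero a x ≈ 1#
    at-zero-1 a {x} x≉0 with x ≈? 0#
    ... | yes x≈0 = contradiction x≈0 x≉0
    ... | no _    = refl

    product-at-zero : ∀ {n} a (x : Fin n → Carrier) i → x i ≈ 0# → (∀ j → j ≢ i → ¬ (x j ≈ 0#)) →
                      Π.sum (λ j → at-zero a (x j)) ≈ a
    product-at-zero {suc n} a x i xi≈0 others = begin
      Π.sum (λ j → at-zero a (x j))                                          ≈⟨ Π.sum-remove {i = i} (λ j → at-zero a (x j)) ⟩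
      at-zero a (x i) * Π.sum (removeAt (λ j → at-zero a (x j)) i)           ≈⟨ *-cong (at-zero-0 a xi≈0) (trans (Π.sum-cong-≋ {n} (λ j → at-zero-1 a (others (Fin.punchIn i j) (Fin.punchInᵢ≢i i j)))) (Π.sum-replicate-zero n)) ⟩
      a * 1#                                                                 ≈⟨ *-identityʳ a ⟩
      a                                                                      ∎

    product-nonzero : ∀ {a n} (x : Fin n → Carrier) → ¬ (a ≈ 0#) → (∀ i → ¬ (x i ≈ 0#)) → ¬ (Π.sum x ≈ 0#)
    product-nonzero {a} {zero}  x a≉0 nz 1≈0 = a≉0 (trans (sym (*-identityʳ a)) (trans (*-congˡ 1≈0) (zeroʳ a)))
    product-nonzero {a} {suc n} x a≉0 nz e   = product-nonzero (x ∘ Fin.suc) a≉0 (nz ∘ Fin.suc) (zero-product (nz Fin.zero) e)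

    nonzero-part-* : ∀ {a} x → ¬ (a ≈ 0#) → nonzero-part (a * x) * at-zero a x ≈ a * nonzero-part x
    nonzero-part-* {a} x a≉0 with x ≈? 0# | a * x ≈? 0#
    ... | yes _   | yes _    = *-comm 1# a
    ... | no _    | no _     = *-identityʳ _
    ... | yes x≈0 | no ax≉0  = contradiction (trans (*-congˡ x≈0) (zeroʳ a)) ax≉0
    ... | no x≉0  | yes ax≈0 = contradiction (zero-product a≉0 ax≈0) x≉0

    nonzero-part-≉0 : ∀ {a} x → ¬ (a ≈ 0#) → ¬ (nonzero-part x ≈ 0#)
    nonzero-part-≉0 {a} x a≉0 e with x ≈? 0#
    ... | yes _   = a≉0 (trans (sym (*-identityʳ a)) (trans (*-congˡ e) (zeroʳ a)))
    ... | no x≉0  = x≉0 e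

  -- Multiplication by a ≉ 0 permutes the nonzero elements; the factor at-zero
  -- makes the index of 0 contribute a as well, so that exactly N factors a appear.
  fermat : ∀ a → a ^ N ≈ a
  fermat a with a ≈? 0#
  ... | yes a≈0 = trans (^-congˡ N a≈0) (trans (0^ N (to 0#)) (sym a≈0))
    where
    0^ : ∀ n → Fin n → 0# ^ n ≈ 0#
    0^ (suc n) _ = zeroˡ _
  ... | no a≉0 = *-cancelˡ (product-nonzero g a≉0 (λ i → nonzero-part-≉0 (from i) a≉0)) (begin
    Π.sum g * a ^ N                                                 ≈⟨ *-congˡ (Π.sum-replicate N) ⟨
    Π.sum g * Π.sum {N} (λ _ → a)                                   ≈⟨ *-comm _ _ ⟩
    Π.sum {N} (λ _ → a) * Π.sum g                                   ≈⟨ Π.∑-distrib-+ (λ _ → a) g ⟨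
    Π.sum (λ i → a * g i)                                           ≈⟨ Π.sum-cong-≋ (λ i → nonzero-part-* (from i) a≉0) ⟨
    Π.sum (λ i → nonzero-part (a * from i) * at-zero a (from i))    ≈⟨ Π.∑-distrib-+ (λ i → nonzero-part (a * from i)) (λ i → at-zero a (from i)) ⟩
    Π.sum (λ i → nonzero-part (a * from i)) * Π.sum (λ i → at-zero a (from i))
      ≈⟨ *-cong (product-reindex (a *_) *-congˡ (*-cancelˡ a≉0) nonzero-part nonzero-part-cong)
                (product-at-zero a from (to 0#) (strictlyInverseʳ 0#) λ j j≢0 e → j≢0 (≡.trans (≡.sym (strictlyInverseˡ j)) (to-cong e))) ⟩
    Π.sum g * a                                                     ∎)
    where
    g : Fin N → Carrier
    g i = nonzero-part (from i)

-- Inverses are demanded for elements that are not equal to 0 instead of apart from 0; equality is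
-- decidable through the enumeration, and this is the form in which case distinctions deliver the
-- hypothesis.
record FiniteField c ℓ (q : ℕ) : Set (Level.suc (c ⊔ˡ ℓ)) where
  field
    commutativeRing-K : CommutativeRing c ℓ
  open CommutativeRing commutativeRing-K
  field
    enumeration : Inverse (CommutativeRing.setoid commutativeRing-K) (≡.setoid (Fin q))
    primePower  : IsPrimePower q
    inverse     : ∀ a → ¬ (a ≈ 0#) → ∃ λ b → a * b ≈ 1#

  zero-product : ∀ {a b} → ¬ (a ≈ 0#) → a * b ≈ 0# → b ≈ 0#
  zero-product {a} {b} a≉0 ab≈0 with inverse a a≉0
  ... | a⁻¹ , aa⁻¹≈1 = begin
    b               ≈⟨ *-identityˡ b ⟨
    1# * b          ≈⟨ *-congʳ aa⁻¹≈1 ⟨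
    a * a⁻¹ * b     ≈⟨ *-congʳ (*-comm a a⁻¹) ⟩
    a⁻¹ * a * b     ≈⟨ *-assoc a⁻¹ a b ⟩
    a⁻¹ * (a * b)   ≈⟨ *-congˡ ab≈0 ⟩
    a⁻¹ * 0#        ≈⟨ zeroʳ a⁻¹ ⟩
    0#              ∎
    where open SetoidReasoning (CommutativeRing.setoid commutativeRing-K)

  open FiniteDomain commutativeRing-K enumeration zero-product public

module _ {c ℓ} (A : CommutativeRing c ℓ) where

  open CommutativeRing A
  open Mult +-commutativeMonoid using () renaming (_×_ to _·_)

  HasChar : ℕ → Set (c ⊔ˡ ℓ)
  HasChar p = ∀ x → p · x ≈ 0#

module _ {c ℓ} (A : CommutativeRing c ℓ) where

  open CommutativeRing A
  open Mult +-commutativeMonoid using () renaming (_×_ to _·_)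
  open Mult (CommutativeRing.+-commutativeMonoid (PowerSeries.seriesRing A)) using () renaming (_×_ to _·ˢ_)

  ·-coefficient : ∀ m f n → (m ·ˢ f) n ≡ m · f n
  ·-coefficient zero    f n = ≡.refl
  ·-coefficient (suc m) f n = ≡.cong (f n +_) (·-coefficient m f n)

  hasChar-series : ∀ p → HasChar A p → HasChar (PowerSeries.seriesRing A) p
  hasChar-series p char f n = trans (reflexive (·-coefficient p f n)) (char (f n))

-- Power series over a finite field

module FieldSeries {c ℓ q} (𝔽 : FiniteField c ℓ q) where

  open FiniteField 𝔽 public
    renaming (commutativeRing-K to K)
  open PowerSeries K public
  open Degrees K public
  S₁ : CommutativeRing c ℓ
  S₁ = seriesRing

  S₂ : CommutativeRing c ℓ
  S₂ = PowerSeries.seriesRing S₁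

  module K where
    open CommutativeRing K public
    open Exp commutativeSemiring public
  module S₁ where
    open CommutativeRing S₁ public
    open Exp commutativeSemiring public
  module S₂ where
    open CommutativeRing S₂ public
    open Exp commutativeSemiring public
  private
    p = proj₁ primePower
    k = proj₁ (proj₂ primePower)
    p-prime = proj₁ (proj₂ (proj₂ primePower))
    1≤k = proj₁ (proj₂ (proj₂ (proj₂ primePower)))
    q≡p^k = proj₂ (proj₂ (proj₂ (proj₂ primePower)))

  2≤q : 2 ≤ q
  2≤q = ≡.subst (2 ≤_) (≡.sym q≡p^k) (ℕ.≤-trans (≡.subst (2 ≤_) (≡.sym (ℕ.^-identityʳ p)) (2≤prime p-prime))
    (ℕ.^-monoʳ-≤ p {{prime⇒nonZero p-prime}} 1≤k))
    where
    2≤prime : ∀ {p} → Prime p → 2 ≤ p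
    2≤prime {zero}        pr = contradiction pr ¬prime[0]
    2≤prime {suc zero}    pr = contradiction pr ¬prime[1]
    2≤prime {suc (suc p)} pr = s≤s (s≤s z≤n)

  q-nonZero : ℕ.NonZero q
  q-nonZero = ℕ.>-nonZero (ℕ.≤-trans (s≤s z≤n) 2≤q)

  q^t>0 : ∀ t → 0 < q ℕ.^ t
  q^t>0 t = ℕ.m^n>0 q {{q-nonZero}} t

  2≤q^ : ∀ {t} → 1 ≤ t → 2 ≤ q ℕ.^ t
  2≤q^ {t} 1≤t = ℕ.≤-trans 2≤q (≡.subst (_≤ q ℕ.^ t) (ℕ.^-identityʳ q) (ℕ.^-monoʳ-≤ q {{q-nonZero}} 1≤t))

  -- Counting elements gives p^k · 1 = 0, which is the product of k factors p · 1; since there are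
  -- no zero divisors, p · 1 = 0.
  char : HasChar K p
  char x = trans (×-1-* p x) (trans (*-congʳ (p·1≈0 k (≡.subst (λ n → n · 1# ≈ 0#) q≡p^k card·1≈0))) (zeroˡ x))
    where
    open CommutativeRing K
    open Mult +-commutativeMonoid using (×-assocˡ) renaming (_×_ to _·_)
    open Frobenius K using (×-1-*)

    p·1≈0 : ∀ k → (p ℕ.^ k) · 1# ≈ 0# → p · 1# ≈ 0#
    p·1≈0 zero    e = trans (×-1-* p 1#) (trans (*-congˡ (trans (sym (+-identityʳ 1#)) e)) (zeroʳ _))
    p·1≈0 (suc k) e with (p · 1#) ≈? 0#
    ... | yes p≈0 = p≈0
    ... | no p≉0  = p·1≈0 k (zero-product p≉0 (trans (sym (×-1-* p _)) (trans (×-assocˡ 1# p (p ℕ.^ k)) e)))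

  additive : ∀ (A : CommutativeRing c ℓ) → HasChar A p → ∀ t → Frobenius.Additive A (q ℕ.^ t)
  additive A charA t = Frobenius.additive-^ A q t (≡.subst (Frobenius.Additive A) (≡.sym q≡p^k)
    (Frobenius.additive-^ A p k (Frobenius.prime-additive A p-prime (charA _))))

  additive-S₁ : ∀ t → Frobenius.Additive S₁ (q ℕ.^ t)
  additive-S₁ = additive S₁ (hasChar-series K p char)

  additive-S₂ : ∀ t → Frobenius.Additive S₂ (q ℕ.^ t)
  additive-S₂ = additive S₂ (hasChar-series S₁ p (hasChar-series K p char))

  fermat-^ : ∀ t a → a K.^ (q ℕ.^ t) K.≈ a
  fermat-^ zero    a = K.*-identityʳ a
  fermat-^ (suc t) a = K.trans (K.sym (K.^-assocʳ a q (q ℕ.^ t))) (K.trans (K.^-congˡ (q ℕ.^ t) (fermat a)) (fermat-^ t a))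

  const-^ : ∀ a n → const a S₁.^ n ≋ const (a K.^ n)
  const-^ a zero    = λ _ → K.refl
  const-^ a (suc n) = S₁.trans (S₁.*-congˡ {const a} (const-^ a n)) (S₁.sym (const-* a (a K.^ n)))

  frobenius-head+tail : ∀ t F → F S₁.^ (q ℕ.^ t) ≋ (const (F 0) ⊕ (X S₁.^ (q ℕ.^ t) ⋆ tail F S₁.^ (q ℕ.^ t)))
  frobenius-head+tail t F = begin
    F S₁.^ Q                                              ≈⟨ S₁.^-congˡ Q (S₁.trans (head+tail F) (S₁.+-congˡ {const (F 0)} (S₁.sym (X⋆ (tail F))))) ⟩
    (const (F 0) ⊕ (X ⋆ tail F)) S₁.^ Q                   ≈⟨ additive-S₁ t (const (F 0)) (X ⋆ tail F) ⟩
    (const (F 0) S₁.^ Q) ⊕ ((X ⋆ tail F) S₁.^ Q)          ≈⟨ S₁.+-cong (S₁.trans (const-^ (F 0) Q) (const-cong (fermat-^ t (F 0)))) (S₁.^-distrib-* X (tail F) Q) ⟩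
    const (F 0) ⊕ (X S₁.^ Q ⋆ tail F S₁.^ Q)              ∎
    where
    open SetoidReasoning S₁.setoid
    Q = q ℕ.^ t

  -- Since a^q = a in K, F^Q is F(x^Q), which leaves the section as the factor F. The induction on
  -- the coefficient index removes one coefficient of F at a time, so that no substitution of x^Q is
  -- needed.
  section-frobenius : ∀ t r F G → r < q ℕ.^ t →
    section (q ℕ.^ t) r (F S₁.^ (q ℕ.^ t) ⋆ G) ≋ (F ⋆ section (q ℕ.^ t) r G)
  section-frobenius t r F G r<Q = λ n → at n F
    where
    open SetoidReasoning K.setoid
    Q = q ℕ.^ t

    step : ∀ F → section Q r (F S₁.^ Q ⋆ G) ≋ (scale (F 0) (section Q r G) ⊕ shift (section Q r (tail F S₁.^ Q ⋆ G)))
    step F n = begin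
      (F S₁.^ Q ⋆ G) (r ℕ.+ n ℕ.* Q)
        ≈⟨ S₁.trans (⋆-cong {g = G} (frobenius-head+tail t F) S₁.refl) (⋆-distribʳ G (const (F 0)) (X S₁.^ Q ⋆ tail F S₁.^ Q)) _ ⟩
      (const (F 0) ⋆ G) (r ℕ.+ n ℕ.* Q) K.+ ((X S₁.^ Q ⋆ tail F S₁.^ Q) ⋆ G) (r ℕ.+ n ℕ.* Q)
        ≈⟨ K.+-cong (const-⋆ (F 0) G _) (⋆-assoc (X S₁.^ Q) (tail F S₁.^ Q) G _) ⟩
      F 0 K.* G (r ℕ.+ n ℕ.* Q) K.+ (X S₁.^ Q ⋆ (tail F S₁.^ Q ⋆ G)) (r ℕ.+ n ℕ.* Q)
        ≈⟨ K.+-congˡ (section-X^ Q r (tail F S₁.^ Q ⋆ G) r<Q n) ⟩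
      F 0 K.* G (r ℕ.+ n ℕ.* Q) K.+ shift (section Q r (tail F S₁.^ Q ⋆ G)) n ∎

    at : ∀ n F → section Q r (F S₁.^ Q ⋆ G) n K.≈ (F ⋆ section Q r G) n
    at zero F = K.trans (step F 0) (K.trans (K.+-identityʳ _) (K.sym (⋆-zero F (section Q r G))))
    at (suc n) F = K.trans (step F (suc n)) (K.trans (K.+-congˡ (at n (tail F))) (K.sym (⋆-suc F (section Q r G) n)))

-- Irreducible polynomials over a finite field

module _ {c ℓ} (A : CommutativeRing c ℓ) where

  open CommutativeRing A

  subRing : ∀ {p} (P : Carrier → Set p) → (∀ {x y} → P x → P y → P (x + y)) →
            (∀ {x y} → P x → P y → P (x * y)) → (∀ {x} → P x → P (- x)) → P 0# → P 1# →
            CommutativeRing (c ⊔ˡ p) ℓ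
  subRing P P-+ P-* P-neg P-0 P-1 = record
    { Carrier = ∃ P
    ; _≈_ = λ x y → proj₁ x ≈ proj₁ y
    ; _+_ = λ (x , Px) (y , Py) → x + y , P-+ Px Py
    ; _*_ = λ (x , Px) (y , Py) → x * y , P-* Px Py
    ; -_ = λ (x , Px) → - x , P-neg Px
    ; 0# = 0# , P-0
    ; 1# = 1# , P-1
    ; isCommutativeRing = record
      { isRing = record
        { +-isAbelianGroup = record
          { isGroup = record
            { isMonoid = record
              { isSemigroup = record
                { isMagma = record
                  { isEquivalence = record { refl = refl ; sym = sym ; trans = trans }
                  ; ∙-cong = +-cong
                  }
                ; assoc = λ x y z → +-assoc _ _ _
                }
              ; identity = (λ x → +-identityˡ _) , (λ x → +-identityʳ _)
              }
            ; inverse = (λ x → -‿inverseˡ _) , (λ x → -‿inverseʳ _)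
            ; ⁻¹-cong = -‿cong
            }
          ; comm = λ x y → +-comm _ _
          }
        ; *-cong = *-cong
        ; *-assoc = λ x y z → *-assoc _ _ _
        ; *-identity = (λ x → *-identityˡ _) , (λ x → *-identityʳ _)
        ; distrib = (λ x y z → distribˡ _ _ _) , (λ x y z → distribʳ _ _ _)
        }
      ; *-comm = λ x y → *-comm _ _
      }
    }

  module _ (m : Carrier) where

    open SetoidReasoning (CommutativeRing.setoid A)
    open Solver commutativeSemiring using (solve; _:=_; _:+_; _:*_)
    open RingProperties ring using (-‿distribʳ-*; -‿+-comm)

    infix 4 _≡ₘ_
    -- The cofactor is part of the congruence and is used as data later: the R in P = (y - F) R is
    -- the cofactor of a congruence modulo y - F.
    _≡ₘ_ : Carrier → Carrier → Set (c ⊔ˡ ℓ)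
    a ≡ₘ b = ∃ λ k → a ≈ b + m * k

    ≈⇒≡ₘ : ∀ {a b} → a ≈ b → a ≡ₘ b
    ≈⇒≡ₘ {a} {b} e = 0# , trans e (sym (trans (+-congˡ (zeroʳ m)) (+-identityʳ b)))

    ≡ₘ-trans : ∀ {a b d} → a ≡ₘ b → b ≡ₘ d → a ≡ₘ d
    ≡ₘ-trans {a} {b} {d} (k , a≈) (l , b≈) = l + k , (begin
      a                     ≈⟨ a≈ ⟩
      b + m * k             ≈⟨ +-congʳ b≈ ⟩
      d + m * l + m * k     ≈⟨ solve 4 (λ d m k l → d :+ m :* l :+ m :* k := d :+ m :* (l :+ k)) refl d m k l ⟩
      d + m * (l + k)       ∎)

    ≡ₘ-sym : ∀ {a b} → a ≡ₘ b → b ≡ₘ a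
    ≡ₘ-sym {a} {b} (k , a≈) = - k , (begin
      b                           ≈⟨ +-identityʳ b ⟨
      b + 0#                      ≈⟨ +-congˡ (trans (*-congˡ (-‿inverseʳ k)) (zeroʳ m)) ⟨
      b + m * (k - k)             ≈⟨ solve 4 (λ b m k l → b :+ m :* (k :+ l) := b :+ m :* k :+ m :* l) refl b m k (- k) ⟩
      b + m * k + m * - k         ≈⟨ +-congʳ a≈ ⟨
      a + m * - k                 ∎)

    ≡ₘ-+ : ∀ {a b a′ b′} → a ≡ₘ a′ → b ≡ₘ b′ → a + b ≡ₘ a′ + b′
    ≡ₘ-+ {a} {b} {a′} {b′} (k , a≈) (l , b≈) = k + l ,
      trans (+-cong a≈ b≈) (solve 5 (λ a b m k l → (a :+ m :* k) :+ (b :+ m :* l) := a :+ b :+ m :* (k :+ l)) refl a′ b′ m k l)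

    ≡ₘ-* : ∀ {a b a′ b′} → a ≡ₘ a′ → b ≡ₘ b′ → a * b ≡ₘ a′ * b′
    ≡ₘ-* {a} {b} {a′} {b′} (k , a≈) (l , b≈) = a′ * l + k * b′ + m * (k * l) ,
      trans (*-cong a≈ b≈) (solve 5 (λ a b m k l → (a :+ m :* k) :* (b :+ m :* l) := a :* b :+ m :* (a :* l :+ k :* b :+ m :* (k :* l))) refl a′ b′ m k l)

    ≡ₘ-neg : ∀ {a a′} → a ≡ₘ a′ → - a ≡ₘ - a′
    ≡ₘ-neg {a} {a′} (k , a≈) = - k , trans (-‿cong a≈) (trans (sym (-‿+-comm a′ (m * k))) (+-congˡ (-‿distribʳ-* m k)))

    quotientRing : CommutativeRing c (c ⊔ˡ ℓ)
    quotientRing = record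
      { Carrier = Carrier
      ; _≈_ = _≡ₘ_
      ; _+_ = _+_
      ; _*_ = _*_
      ; -_ = -_
      ; 0# = 0#
      ; 1# = 1#
      ; isCommutativeRing = record
        { isRing = record
          { +-isAbelianGroup = record
            { isGroup = record
              { isMonoid = record
                { isSemigroup = record
                  { isMagma = record
                    { isEquivalence = record { refl = ≈⇒≡ₘ refl ; sym = ≡ₘ-sym ; trans = ≡ₘ-trans }
                    ; ∙-cong = ≡ₘ-+
                    }
                  ; assoc = λ x y z → ≈⇒≡ₘ (+-assoc x y z)
                  }
                ; identity = (λ x → ≈⇒≡ₘ (+-identityˡ x)) , (λ x → ≈⇒≡ₘ (+-identityʳ x))
                }
              ; inverse = (λ x → ≈⇒≡ₘ (-‿inverseˡ x)) , (λ x → ≈⇒≡ₘ (-‿inverseʳ x))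
              ; ⁻¹-cong = ≡ₘ-neg
              }
            ; comm = λ x y → ≈⇒≡ₘ (+-comm x y)
            }
          ; *-cong = ≡ₘ-*
          ; *-assoc = λ x y z → ≈⇒≡ₘ (*-assoc x y z)
          ; *-identity = (λ x → ≈⇒≡ₘ (*-identityˡ x)) , (λ x → ≈⇒≡ₘ (*-identityʳ x))
          ; distrib = (λ x y z → ≈⇒≡ₘ (distribˡ x y z)) , (λ x y z → ≈⇒≡ₘ (distribʳ x y z))
          }
        ; *-comm = λ x y → ≈⇒≡ₘ (*-comm x y)
        }
      }

module Polynomials {c ℓ q} (𝔽 : FiniteField c ℓ q) where

  open FieldSeries 𝔽

  Deg< : ℕ → Series → Set ℓ
  Deg< n f = ∀ k → n ≤ k → f k K.≈ K.0#

  Poly : Series → Set ℓ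
  Poly f = ∃ λ n → Deg< n f

  Monic : ℕ → Series → Set ℓ
  Monic e f = Deg≤ e f × f e K.≈ K.1#

  Deg<-mono : ∀ {m n f} → m ≤ n → Deg< m f → Deg< n f
  Deg<-mono m≤n d k n≤k = d k (ℕ.≤-trans m≤n n≤k)

  Deg<-⊕ : ∀ {n f g} → Deg< n f → Deg< n g → Deg< n (f ⊕ g)
  Deg<-⊕ d e k n≤k = K.trans (K.+-cong (d k n≤k) (e k n≤k)) (K.+-identityˡ K.0#)

  Deg<-neg : ∀ {n f} → Deg< n f → Deg< n (S₁.- f)
  Deg<-neg d k n≤k = K.trans (K.-‿cong (d k n≤k)) -0#≈0#
    where open RingProperties K.ring using (-0#≈0#)

  Deg<-resp : ∀ {n f g} → f ≋ g → Deg< n f → Deg< n g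
  Deg<-resp p d k n≤k = K.trans (K.sym (p k)) (d k n≤k)

  Poly-⊕ : ∀ {f g} → Poly f → Poly g → Poly (f ⊕ g)
  Poly-⊕ (m , d) (n , e) = m ℕ.⊔ n , Deg<-⊕ (Deg<-mono (ℕ.m≤m⊔n m n) d) (Deg<-mono (ℕ.m≤n⊔m m n) e)

  Poly-⋆ : ∀ {f g} → Poly f → Poly g → Poly (f ⋆ g)
  Poly-⋆ {f} {g} (m , d) (n , e) = suc (m ℕ.+ n) , Deg≤-⋆ f g (Deg<-mono (ℕ.n≤1+n m) d) (Deg<-mono (ℕ.n≤1+n n) e)

  Poly-neg : ∀ {f} → Poly f → Poly (S₁.- f)
  Poly-neg (n , d) = n , Deg<-neg d

  Poly-1 : Poly S₁.1#
  Poly-1 = 1 , Deg≤-const K.1#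

  Poly-^ : ∀ {f} → Poly f → ∀ n → Poly (f S₁.^ n)
  Poly-^ pf zero    = Poly-1
  Poly-^ pf (suc n) = Poly-⋆ pf (Poly-^ pf n)

  Deg≤-shiftBy : ∀ m {f} → Deg≤ 0 f → Deg≤ m (shiftBy m f)
  Deg≤-shiftBy zero    d = d
  Deg≤-shiftBy (suc m) {f} d = Deg≤-shift {f = shiftBy m f} (Deg≤-shiftBy m d)

  shiftBy-at : ∀ m f → shiftBy m f m ≡ f 0
  shiftBy-at zero    f = ≡.refl
  shiftBy-at (suc m) f = shiftBy-at m f

  leading : ∀ n f → Deg< n f → f ≋ 0ˢ ⊎ ∃ λ i → i < n × Deg≤ i f × ¬ (f i K.≈ K.0#)
  leading zero    f d = inj₁ λ k → d k z≤n
  leading (suc n) f d with f n ≈? K.0#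
  ... | no fn≉0  = inj₂ (n , ℕ.n<1+n n , d , fn≉0)
  ... | yes fn≈0 with leading n f (λ k n≤k → case k n≤k (ℕ.m≤n⇒m<n∨m≡n n≤k))
    where
    case : ∀ k → n ≤ k → n < k ⊎ n ≡ k → f k K.≈ K.0#
    case k _ (inj₁ n<k)    = d k n<k
    case k _ (inj₂ ≡.refl) = fn≈0
  ...   | inj₁ f≋0 = inj₁ f≋0
  ...   | inj₂ (i , i<n , rest) = inj₂ (i , ℕ.m<n⇒m<1+n i<n , rest)

  -- As `f` is monic, the coefficient of `g` just below its current bound is a coefficient of
  -- `f ⋆ g`, so the bound can be lowered step by step. Some bound on `g` must be known at the
  -- start: x - 1 times its inverse series is 1.
  cofactor-Deg< : ∀ {e f} → Monic e f → ∀ n {g} → Deg< n g → ∀ m → Deg< (e ℕ.+ m) (f ⋆ g) → Deg< m g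
  cofactor-Deg< mf zero    d m _ k _ = d k z≤n
  cofactor-Deg< {e} {f} (df , fe≈1) (suc n) {g} d m dfg with suc n ℕ.≤? m
  ... | yes n<m = Deg<-mono n<m d
  ... | no n≮m = cofactor-Deg< {f = f} (df , fe≈1) n (λ k n≤k → case k (ℕ.m≤n⇒m<n∨m≡n n≤k)) m dfg
    where
    case : ∀ k → n < k ⊎ n ≡ k → g k K.≈ K.0#
    case k (inj₁ n<k) = d k n<k
    case k (inj₂ ≡.refl) = begin
      g n                   ≈⟨ K.*-identityˡ _ ⟨
      K.1# K.* g n          ≈⟨ K.*-congʳ fe≈1 ⟨
      f e K.* g n           ≈⟨ ⋆-top f g df d ⟨
      (f ⋆ g) (e ℕ.+ n)     ≈⟨ dfg _ (ℕ.+-monoʳ-≤ e (ℕ.≮⇒≥ n≮m)) ⟩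
      K.0#                  ∎
      where open SetoidReasoning K.setoid

  divide : ∀ {e f} → Monic e f → ∀ n g → Deg< n g → ∃ λ c → ∃ λ r → g ≋ f ⋆ c ⊕ r × Deg< e r × Poly c
  divide {e} {f} (df , fe≈1) zero g d = 0ˢ , g ,
    S₁.sym (S₁.trans (S₁.+-congʳ {g} (S₁.zeroʳ f)) (S₁.+-identityˡ g)) , (λ k _ → d k z≤n) , 0 , λ _ _ → K.refl
  divide {e} {f} mf@(df , fe≈1) (suc n) g d with suc n ℕ.≤? e
  ... | yes n<e = 0ˢ , g ,
    S₁.sym (S₁.trans (S₁.+-congʳ {g} (S₁.zeroʳ f)) (S₁.+-identityˡ g)) , Deg<-mono n<e d , 0 , λ _ _ → K.refl
  ... | no n≮e with divide {f = f} mf n (g S₁.- f ⋆ t) lower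
    where
    m = n ∸ e
    t = shiftBy m (const (g n))
    open SetoidReasoning K.setoid

    e+m≡n : e ℕ.+ m ≡ n
    e+m≡n = ℕ.m+[n∸m]≡n (ℕ.≮⇒≥ n≮e)

    Deg≤-t : Deg≤ m t
    Deg≤-t = Deg≤-shiftBy m (Deg≤-const (g n))

    lower : Deg< n (g S₁.- f ⋆ t)
    lower k n≤k with ℕ.m≤n⇒m<n∨m≡n n≤k
    ... | inj₁ n<k = Deg<-⊕ {f = g} d (Deg<-neg (≡.subst (λ j → Deg≤ j (f ⋆ t)) e+m≡n (Deg≤-⋆ f t df Deg≤-t))) k n<k
    ... | inj₂ ≡.refl = begin
      g n K.- (f ⋆ t) n             ≡⟨ ≡.cong (λ j → g n K.- (f ⋆ t) j) e+m≡n ⟨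
      g n K.- (f ⋆ t) (e ℕ.+ m)     ≈⟨ K.+-congˡ (K.-‿cong (⋆-top f t df Deg≤-t)) ⟩
      g n K.- f e K.* t m           ≈⟨ K.+-congˡ (K.-‿cong (K.*-cong fe≈1 (K.reflexive (shiftBy-at m _)))) ⟩
      g n K.- K.1# K.* g n          ≈⟨ K.+-congˡ (K.-‿cong (K.*-identityˡ _)) ⟩
      g n K.- g n                   ≈⟨ K.-‿inverseʳ _ ⟩
      K.0#                          ∎
  ...   | c , r , e′ , dr , pc = c ⊕ shiftBy (n ∸ e) (const (g n)) , r , eq , dr ,
          Poly-⊕ {f = c} pc (_ , Deg≤-shiftBy (n ∸ e) (Deg≤-const (g n)))
    where
    t = shiftBy (n ∸ e) (const (g n))
    open SetoidReasoning S₁.setoid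
    open Solver S₁.commutativeSemiring using (solve; _:=_; _:+_; _:*_)

    eq : g ≋ f ⋆ (c ⊕ t) ⊕ r
    eq = begin
      g                                   ≈⟨ S₁.+-identityʳ g ⟨
      g ⊕ 0ˢ                              ≈⟨ S₁.+-congˡ {g} (S₁.-‿inverseˡ (f ⋆ t)) ⟨
      g ⊕ ((S₁.- (f ⋆ t)) ⊕ f ⋆ t)        ≈⟨ S₁.+-assoc g (S₁.- (f ⋆ t)) (f ⋆ t) ⟨
      g S₁.- f ⋆ t ⊕ f ⋆ t                ≈⟨ S₁.+-congʳ {f ⋆ t} e′ ⟩
      f ⋆ c ⊕ r ⊕ f ⋆ t                   ≈⟨ solve 4 (λ f c r t → f :* c :+ r :+ f :* t := f :* (c :+ t) :+ r) S₁.refl f c r t ⟩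
      f ⋆ (c ⊕ t) ⊕ r                     ∎

funToFin-cong : ∀ {m n} {f g : Fin m → Fin n} → (∀ i → f i ≡ g i) → funToFin f ≡ funToFin g
funToFin-cong {zero}  e = ≡.refl
funToFin-cong {suc m} e = ≡.cong₂ Fin.combine (e Fin.zero) (funToFin-cong (e ∘ Fin.suc))

module Extension {c ℓ q} (𝔽 : FiniteField c ℓ q) where

  open Polynomials 𝔽
  open FieldSeries 𝔽

  extend : ∀ {e} → (Fin e → K.Carrier) → Series
  extend {zero}  g n       = K.0#
  extend {suc e} g zero    = g Fin.zero
  extend {suc e} g (suc n) = extend (g ∘ Fin.suc) n

  extend-cong : ∀ {e} {g h : Fin e → K.Carrier} → (∀ i → g i K.≈ h i) → extend g ≋ extend h
  extend-cong {zero}  p n       = K.refl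
  extend-cong {suc e} p zero    = p Fin.zero
  extend-cong {suc e} p (suc n) = extend-cong (p ∘ Fin.suc) n

  extend-Deg< : ∀ {e} (g : Fin e → K.Carrier) → Deg< e (extend g)
  extend-Deg< {zero}  g n       _         = K.refl
  extend-Deg< {suc e} g (suc n) (s≤s e≤n) = extend-Deg< (g ∘ Fin.suc) n e≤n

  extend-restrict : ∀ e f → Deg< e f → extend {e} (f ∘ toℕ) ≋ f
  extend-restrict zero    f d n       = K.sym (d n z≤n)
  extend-restrict (suc e) f d zero    = K.refl
  extend-restrict (suc e) f d (suc n) = extend-restrict e (tail f) (λ k e≤k → d (suc k) (s≤s e≤k)) n

  extend-at : ∀ {e} (g : Fin e → K.Carrier) i → extend g (toℕ i) ≡ g i
  extend-at g Fin.zero    = ≡.refl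
  extend-at g (Fin.suc i) = extend-at (g ∘ Fin.suc) i

  encode : ∀ {e} → (Fin e → K.Carrier) → Fin (q ℕ.^ e)
  encode g = funToFin (to ∘ g)
    where open Inverse enumeration

  decode : ∀ {e} → Fin (q ℕ.^ e) → Fin e → K.Carrier
  decode k = from ∘ finToFun k
    where open Inverse enumeration

  encode-cong : ∀ {e} {g h : Fin e → K.Carrier} → (∀ i → g i K.≈ h i) → encode g ≡ encode h
  encode-cong {e} p = funToFin-cong {e} (to-cong ∘ p)
    where open Inverse enumeration

  decode-encode : ∀ {e} (g : Fin e → K.Carrier) i → decode (encode g) i K.≈ g i
  decode-encode g i = K.trans (from-cong (finToFun-funToFin (to ∘ g) i)) (strictlyInverseʳ (g i))
    where open Inverse enumeration

  encode-decode : ∀ {e} (k : Fin (q ℕ.^ e)) → encode (decode {e} k) ≡ k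
  encode-decode {e} k = ≡.trans (funToFin-cong {e} (strictlyInverseˡ ∘ finToFun {q} {e} k)) (funToFin-finToFin {e} {q} k)
    where open Inverse enumeration

module Irreducible {c ℓ q} (𝔽 : FiniteField c ℓ q) where

  open Polynomials 𝔽
  open FieldSeries 𝔽

  module _ {e f} (monic : Monic e f)
    (irreducible : ∀ i → 0 < i → i < e → ∀ a c → Monic i a → Poly c → ¬ f ≋ a ⋆ c)
    where

    open Extension 𝔽
    open SetoidReasoning S₁.setoid
    open Solver S₁.commutativeSemiring using (solve; _:=_; _:+_; _:*_)

    Multiple : Series → Set (c ⊔ˡ ℓ)
    Multiple g = ∃ λ k → Poly k × g ≋ f ⋆ k

    -- Euclid's lemma: replace a by the remainder of f modulo a, which is again a
    -- multiplier taking b into the multiples of f, until a becomes constant.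
    euclid : ∀ n {a b} → Deg< n a → n ≤ e → ¬ (a ≋ 0ˢ) → Poly b → Multiple (a ⋆ b) → Multiple b
    euclid zero    {a} da _ a≉0 _ _ = contradiction (λ k → da k z≤n) a≉0
    euclid (suc n) {a} {b} da n≤e a≉0 pb (k , pk , ab≋fk) with leading (suc n) a da
    ... | inj₁ a≋0 = contradiction a≋0 a≉0
    ... | inj₂ (i , s≤s i≤n , da , ai≉0) with inverse (a i) ai≉0
    ...   | u , ai*u≈1 = byDegree i i≤n monic-a′
      where
      a′ = const u ⋆ a
      k′ = const u ⋆ k

      monic-a′ : Monic i a′
      monic-a′ = Deg≤-⋆ (const u) a (Deg≤-const u) da ,
                 K.trans (const-⋆ u a i) (K.trans (K.*-comm u (a i)) ai*u≈1)

      pk′ : Poly k′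
      pk′ = Poly-⋆ {const u} {k} (1 , Deg≤-const u) pk

      a′b≋fk′ : a′ ⋆ b ≋ f ⋆ k′
      a′b≋fk′ = begin
        const u ⋆ a ⋆ b      ≈⟨ S₁.*-assoc (const u) a b ⟩
        const u ⋆ (a ⋆ b)    ≈⟨ S₁.*-congˡ {const u} ab≋fk ⟩
        const u ⋆ (f ⋆ k)    ≈⟨ solve 3 (λ u f k → u :* (f :* k) := f :* (u :* k)) S₁.refl (const u) f k ⟩
        f ⋆ k′               ∎

      byDegree : ∀ i → i ≤ n → Monic i a′ → Multiple b
      byDegree zero _ (d , a′0≈1) = k′ , pk′ , (begin
        b            ≈⟨ S₁.*-identityˡ b ⟨
        S₁.1# ⋆ b    ≈⟨ S₁.*-congʳ {b} a′≋1 ⟨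
        a′ ⋆ b       ≈⟨ a′b≋fk′ ⟩
        f ⋆ k′       ∎)
        where
        a′≋1 : a′ ≋ S₁.1#
        a′≋1 zero    = a′0≈1
        a′≋1 (suc j) = d (suc j) (s≤s z≤n)
      byDegree (suc i) i<n m with divide {f = a′} m (suc e) f (proj₁ monic)
      ... | c , r , f≋ , dr , pc with leading (suc i) r dr
      -- A vanishing remainder would make `a′` a proper monic factor of `f`.
      ...   | inj₁ r≋0 = contradiction (S₁.trans f≋ (S₁.trans (S₁.+-congˡ {a′ ⋆ c} r≋0) (S₁.+-identityʳ (a′ ⋆ c))))
                (irreducible (suc i) (s≤s z≤n) (ℕ.≤-<-trans i<n n≤e) a′ c m pc)
      -- From f = a′ c + r and a′ b = f k′ follows r b = f (b - k′ c), so r is a multiplier of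
      -- smaller degree than a′.
      ...   | inj₂ (j , _ , _ , rj≉0) = euclid n {r} (Deg<-mono i<n dr) (ℕ.<⇒≤ n≤e) (λ r≋0 → rj≉0 (r≋0 j)) pb
                (b ⊕ S₁.- (k′ ⋆ c) , Poly-⊕ {b} pb (Poly-neg {k′ ⋆ c} (Poly-⋆ {k′} pk′ pc)) , S₁.sym (begin
                  f ⋆ (b ⊕ S₁.- (k′ ⋆ c))                          ≈⟨ S₁.distribˡ f b (S₁.- (k′ ⋆ c)) ⟩
                  f ⋆ b ⊕ f ⋆ (S₁.- (k′ ⋆ c))                      ≈⟨ S₁.+-congʳ {f ⋆ (S₁.- (k′ ⋆ c))} (S₁.*-congʳ {b} f≋) ⟩
                  (a′ ⋆ c ⊕ r) ⋆ b ⊕ f ⋆ (S₁.- (k′ ⋆ c))           ≈⟨ solve 6 (λ a c r b f n → (a :* c :+ r) :* b :+ f :* n := r :* b :+ (a :* b :* c :+ f :* n)) S₁.refl a′ c r b f (S₁.- (k′ ⋆ c)) ⟩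
                  r ⋆ b ⊕ (a′ ⋆ b ⋆ c ⊕ f ⋆ (S₁.- (k′ ⋆ c)))       ≈⟨ S₁.+-congˡ {r ⋆ b} (S₁.+-congʳ {f ⋆ (S₁.- (k′ ⋆ c))} (S₁.trans (S₁.*-congʳ {c} a′b≋fk′) (S₁.*-assoc f k′ c))) ⟩
                  r ⋆ b ⊕ (f ⋆ (k′ ⋆ c) ⊕ f ⋆ (S₁.- (k′ ⋆ c)))     ≈⟨ S₁.+-congˡ {r ⋆ b} (S₁.distribˡ f (k′ ⋆ c) (S₁.- (k′ ⋆ c))) ⟨
                  r ⋆ b ⊕ f ⋆ (k′ ⋆ c S₁.- k′ ⋆ c)                 ≈⟨ S₁.+-congˡ {r ⋆ b} (S₁.trans (S₁.*-congˡ {f} (S₁.-‿inverseʳ (k′ ⋆ c))) (S₁.zeroʳ f)) ⟩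
                  r ⋆ b ⊕ 0ˢ                                       ≈⟨ S₁.+-identityʳ (r ⋆ b) ⟩
                  r ⋆ b                                            ∎))

    -- Residues are taken among polynomials: in K[[x]] the element `f` is invertible as soon as f(0)
    -- ≠ 0, and the quotient would collapse.
    polyRing : CommutativeRing (c ⊔ˡ ℓ) ℓ
    polyRing = subRing S₁ Poly (λ {f} → Poly-⊕ {f}) (λ {f} → Poly-⋆ {f}) (λ {f} → Poly-neg {f}) (0 , λ _ _ → K.refl) Poly-1

    f̂ : CommutativeRing.Carrier polyRing
    f̂ = f , suc e , proj₁ monic

    residueRing : CommutativeRing (c ⊔ˡ ℓ) (c ⊔ˡ ℓ)
    residueRing = quotientRing polyRing f̂

    private
      module P = CommutativeRing polyRing
      module Q where
        open CommutativeRing residueRing public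
        open Exp commutativeSemiring public

      rem : P.Carrier → P.Carrier
      rem (g , n , d) with divide {f = f} monic n g d
      ... | c , r , _ , dr , pc = r , e , dr

      rem-Deg< : ∀ g → Deg< e (proj₁ (rem g))
      rem-Deg< (g , n , d) with divide {f = f} monic n g d
      ... | c , r , _ , dr , pc = dr

      rem≈ : ∀ g → g Q.≈ rem g
      rem≈ (g , n , d) with divide {f = f} monic n g d
      ... | c , r , g≋ , dr , pc = (c , pc) , S₁.trans g≋ (S₁.+-comm (f ⋆ c) r)

      rem-unique : ∀ {r r′} → r Q.≈ r′ → Deg< e (proj₁ r) → Deg< e (proj₁ r′) → r P.≈ r′
      rem-unique {r , _} {r′ , _} ((k , n , dk) , r≋) d d′ = begin
        r               ≈⟨ r≋ ⟩
        r′ ⊕ f ⋆ k      ≈⟨ S₁.+-congˡ {r′} (S₁.trans (S₁.*-congˡ {f} k≋0) (S₁.zeroʳ f)) ⟩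
        r′ ⊕ 0ˢ         ≈⟨ S₁.+-identityʳ r′ ⟩
        r′              ∎
        where
        fk≋ : r ⊕ S₁.- r′ ≋ f ⋆ k
        fk≋ = begin
          r ⊕ S₁.- r′                   ≈⟨ S₁.+-congʳ {S₁.- r′} r≋ ⟩
          r′ ⊕ f ⋆ k ⊕ S₁.- r′          ≈⟨ xyx⁻¹≈y r′ (f ⋆ k) ⟩
          f ⋆ k                         ∎
          where open RingProperties S₁.ring using (xyx⁻¹≈y)

        k≋0 : k ≋ 0ˢ
        k≋0 j = cofactor-Deg< {f = f} monic n dk 0
          (≡.subst (λ n → Deg< n (f ⋆ k)) (≡.sym (ℕ.+-identityʳ e)) (Deg<-resp fk≋ (Deg<-⊕ {f = r} d (Deg<-neg d′)))) j z≤n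

      -- Remainders modulo `f` are tuples of e coefficients, and their uniqueness makes the count
      -- exactly q^e.
      residues : Inverse Q.setoid (≡.setoid (Fin (q ℕ.^ e)))
      residues = record
        { to = to
        ; from = from
        ; to-cong = λ {g} {h} → to-cong {g} {h}
        ; from-cong = λ { {k} ≡.refl → Q.refl {from k} }
        ; inverse = (λ {k} {g} g≈ → ≡.trans (to-cong {g} {from k} g≈) (to-from k))
                  , λ { {g} ≡.refl → from-to g }
        }
        where
        to : P.Carrier → Fin (q ℕ.^ e)
        to g = encode {e} (proj₁ (rem g) ∘ toℕ)

        from : Fin (q ℕ.^ e) → P.Carrier
        from k = extend (decode {e} k) , e , extend-Deg< (decode {e} k)

        rem-cong : ∀ {g h} → g Q.≈ h → rem g P.≈ rem h
        rem-cong {g} {h} g≈h = rem-unique {rem g} {rem h}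
          (Q.trans {rem g} {h} {rem h} (Q.trans {rem g} {g} {h} (Q.sym {g} {rem g} (rem≈ g)) g≈h) (rem≈ h)) (rem-Deg< g) (rem-Deg< h)

        to-cong : ∀ {g h} → g Q.≈ h → to g ≡ to h
        to-cong {g} {h} g≈h = encode-cong {e} (rem-cong {g} {h} g≈h ∘ toℕ)

        from-to : ∀ g → from (to g) Q.≈ g
        from-to g = Q.trans {from (to g)} {rem g} {g} (≈⇒≡ₘ polyRing f̂ {from (to g)} {rem g}
          (S₁.trans (extend-cong {e} (decode-encode {e} (proj₁ (rem g) ∘ toℕ))) (extend-restrict e (proj₁ (rem g)) (rem-Deg< g))))
          (Q.sym {g} {rem g} (rem≈ g))

        to-from : ∀ k → to (from k) ≡ k
        to-from k = ≡.trans (encode-cong {e} λ i → K.trans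
            (rem-unique {rem (from k)} {from k} (Q.sym {from k} {rem (from k)} (rem≈ (from k))) (rem-Deg< (from k)) (extend-Deg< (decode {e} k)) (toℕ i))
            (K.reflexive (extend-at (decode {e} k) i)))
          (encode-decode {e} k)

      residues-domain : ∀ {a b} → ¬ (a Q.≈ Q.0#) → a Q.* b Q.≈ Q.0# → b Q.≈ Q.0#
      residues-domain {a} {b} a≉0 ab≈0 = multiple⇒≈0 {b} (euclid e {proj₁ (rem a)} {proj₁ b} (rem-Deg< a) ℕ.≤-refl
          (λ r≋0 → a≉0 (Q.trans {a} {rem a} {Q.0#} (rem≈ a) (≈⇒≡ₘ polyRing f̂ {rem a} {Q.0#} r≋0))) (proj₂ b)
          (≈0⇒multiple {rem a Q.* b} (Q.trans {rem a Q.* b} {a Q.* b} {Q.0#} (Q.*-cong {rem a} {a} {b} {b} (Q.sym {a} {rem a} (rem≈ a)) (Q.refl {b})) ab≈0)))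
        where
        ≈0⇒multiple : ∀ {g} → g Q.≈ Q.0# → Multiple (proj₁ g)
        ≈0⇒multiple ((k , pk) , g≋) = k , pk , S₁.trans g≋ (S₁.+-identityˡ (f ⋆ k))

        multiple⇒≈0 : ∀ {g} → Multiple (proj₁ g) → g Q.≈ Q.0#
        multiple⇒≈0 (k , pk , g≋) = (k , pk) , S₁.trans g≋ (S₁.sym (S₁.+-identityˡ (f ⋆ k)))

      Poly-X : Poly X
      Poly-X = 2 , Deg≤-shift {f = S₁.1#} (Deg≤-const K.1#)

      X̂ : P.Carrier
      X̂ = X , Poly-X

      X̂^ : ∀ m → X̂ Q.^ ((q ℕ.^ e) ℕ.^ m) Q.≈ X̂
      X̂^ zero    = Q.*-identityʳ X̂
      X̂^ (suc m) = Q.trans {X̂ Q.^ (Qe ℕ.* Qe ℕ.^ m)} {(X̂ Q.^ Qe) Q.^ (Qe ℕ.^ m)} {X̂} (Q.sym {(X̂ Q.^ Qe) Q.^ (Qe ℕ.^ m)} {X̂ Q.^ (Qe ℕ.* Qe ℕ.^ m)} (Q.^-assocʳ X̂ Qe (Qe ℕ.^ m)))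
          (Q.trans {(X̂ Q.^ Qe) Q.^ (Qe ℕ.^ m)} {X̂ Q.^ (Qe ℕ.^ m)} {X̂} (Q.^-congˡ (Qe ℕ.^ m) {X̂ Q.^ Qe} {X̂} (fermat-residues X̂)) (X̂^ m))
        where
        Qe = q ℕ.^ e
        fermat-residues = FiniteDomain.fermat residueRing residues (λ {a} {b} → residues-domain {a} {b})

      proj₁-^ : ∀ n → proj₁ (X̂ Q.^ n) ≡ X S₁.^ n
      proj₁-^ zero    = ≡.refl
      proj₁-^ (suc n) = ≡.cong (X ⋆_) (proj₁-^ n)

    -- Fermat's theorem in K[x]/(f), a finite domain with q^e elements, applied m times to the class
    -- of x.
    divides-X^-X : ∀ m → Multiple (X S₁.^ (q ℕ.^ (m ℕ.* e)) S₁.- X)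
    divides-X^-X m with X̂^ m
    ... | (k , pk) , eq = k , pk , (begin
      X S₁.^ (q ℕ.^ (m ℕ.* e)) S₁.- X        ≡⟨ ≡.cong (λ n → X S₁.^ n S₁.- X) (≡.trans (≡.cong (q ℕ.^_) (ℕ.*-comm m e)) (≡.sym (ℕ.^-*-assoc q e m))) ⟩
      X S₁.^ ((q ℕ.^ e) ℕ.^ m) S₁.- X        ≡⟨ ≡.cong (λ g → g S₁.- X) (proj₁-^ ((q ℕ.^ e) ℕ.^ m)) ⟨
      proj₁ (X̂ Q.^ ((q ℕ.^ e) ℕ.^ m)) S₁.- X ≈⟨ S₁.+-congʳ {S₁.- X} eq ⟩
      X ⊕ f ⋆ k S₁.- X                       ≈⟨ xyx⁻¹≈y X (f ⋆ k) ⟩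
      f ⋆ k                                  ∎)
      where open RingProperties S₁.ring using (xyx⁻¹≈y)

-- Factorization into irreducible polynomials

module Factorization {c ℓ q} (𝔽 : FiniteField c ℓ q) where

  open Polynomials 𝔽
  open FieldSeries 𝔽
  open Extension 𝔽

  X^[_]-X : ℕ → Series
  X^[ Q ]-X = X S₁.^ Q S₁.- X

  -- Keeps of the irreducible factors only their degrees and the one consequence that is used later.
  -- The exponent is the number of factors because factors may be repeated.
  record Factored (e : ℕ) (f : Series) : Set (c ⊔ˡ ℓ) where
    constructor factored
    field
      degrees : List ℕ
      positive : All (1 ≤_) degrees
      total : sum degrees ≡ e
      divides-power : ∀ D → All (_∣ D) degrees →
        ∃ λ w → Poly w × f ⋆ w ≋ X^[ q ℕ.^ D ]-X S₁.^ length degrees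

  data Reducible (e : ℕ) (f : Series) : Set (c ⊔ˡ ℓ) where
    _⋆⟨_,_,_,_,_⟩ : ∀ {i} a → 0 < i → i < e → Monic i a → ∀ {b} → Poly b → f ≋ a ⋆ b → Reducible e f

  module _ {e f} (monic : Monic e f) where

    private
      candidate : ∀ i → Fin (q ℕ.^ i) → Series
      candidate i k = shiftBy i S₁.1# ⊕ extend (decode {i} k)

      candidate-monic : ∀ i k → Monic i (candidate i k)
      candidate-monic i k = Deg<-⊕ {f = shiftBy i S₁.1#} (Deg≤-shiftBy i (Deg≤-const K.1#)) (Deg<-mono (ℕ.n≤1+n i) (extend-Deg< (decode {i} k)))
        , K.trans (K.+-cong (K.reflexive (shiftBy-at i S₁.1#)) (extend-Deg< (decode {i} k) i ℕ.≤-refl)) (K.+-identityʳ K.1#)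

      candidate-complete : ∀ {i a} → Monic i a → candidate i (encode {i} (a ∘ toℕ)) ≋ a
      candidate-complete {i} {a} (da , ai≈1) n with ℕ.<-cmp n i
      ... | tri< n<i _ _ = begin
        shiftBy i S₁.1# n K.+ extend (decode {i} (encode {i} (a ∘ toℕ))) n   ≈⟨ K.+-cong (K.reflexive (shiftBy-< i S₁.1# n n<i)) (extend-cong {i} (decode-encode {i} (a ∘ toℕ)) n) ⟩
        K.0# K.+ extend {i} (a ∘ toℕ) n                              ≈⟨ K.+-identityˡ _ ⟩
        extend {i} (a ∘ toℕ) n                                       ≡⟨ ≡.cong (extend {i} (a ∘ toℕ)) (Fin.toℕ-fromℕ< n<i) ⟨
        extend {i} (a ∘ toℕ) (toℕ (fromℕ< n<i))                      ≡⟨ extend-at {i} (a ∘ toℕ) (fromℕ< n<i) ⟩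
        a (toℕ (fromℕ< n<i))                                         ≡⟨ ≡.cong a (Fin.toℕ-fromℕ< n<i) ⟩
        a n                                                          ∎
        where open SetoidReasoning K.setoid
      ... | tri≈ _ ≡.refl _ = K.trans (proj₂ (candidate-monic i (encode {i} (a ∘ toℕ)))) (K.sym ai≈1)
      ... | tri> _ _ i<n = K.trans (proj₁ (candidate-monic i (encode {i} (a ∘ toℕ))) n i<n) (K.sym (da n i<n))

      Divides : (i : ℕ) → Fin (q ℕ.^ i) → Set (c ⊔ˡ ℓ)
      Divides i k = ∃ λ b → Poly b × f ≋ candidate i k ⋆ b

      divides? : ∀ i k → Dec (Divides i k)
      divides? i k with divide {f = candidate i k} (candidate-monic i k) (suc e) f (proj₁ monic)
      ... | b , r , f≋ , dr , pb with leading i r dr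
      ...   | inj₁ r≋0 = yes (b , pb , S₁.trans f≋ (S₁.trans (S₁.+-congˡ {candidate i k ⋆ b} r≋0) (S₁.+-identityʳ (candidate i k ⋆ b))))
      ...   | inj₂ (j , j<i , _ , rj≉0) = no λ (b′ , pb′ , f≋′) → rj≉0 (remainder≈0 b′ pb′ f≋′ j)
        where
        a = candidate i k
        open SetoidReasoning S₁.setoid
        open RingProperties S₁.ring using (xyx⁻¹≈y; x[y-z]≈xy-xz)

        remainder≈0 : ∀ b′ → Poly b′ → f ≋ a ⋆ b′ → r ≋ 0ˢ
        remainder≈0 b′ pb′ f≋′ = S₁.trans r≋ (S₁.trans (S₁.*-congˡ {a} b′-b≋0) (S₁.zeroʳ a))
          where
          r≋ : r ≋ a ⋆ (b′ S₁.- b)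
          r≋ = begin
            r                             ≈⟨ xyx⁻¹≈y (a ⋆ b) r ⟨
            a ⋆ b ⊕ r S₁.- a ⋆ b          ≈⟨ S₁.+-congʳ {S₁.- (a ⋆ b)} (S₁.trans (S₁.sym f≋) f≋′) ⟩
            a ⋆ b′ S₁.- a ⋆ b             ≈⟨ x[y-z]≈xy-xz a b′ b ⟨
            a ⋆ (b′ S₁.- b)               ∎

          b′-b≋0 : b′ S₁.- b ≋ 0ˢ
          b′-b≋0 n = let m , dm = Poly-⊕ {b′} pb′ (Poly-neg {b} pb) in
              cofactor-Deg< {f = a} (candidate-monic i k) m dm 0
                (≡.subst (λ j → Deg< j (a ⋆ (b′ S₁.- b))) (≡.sym (ℕ.+-identityʳ i)) (Deg<-resp r≋ dr)) n z≤n

    -- There are q^i monic candidates of degree i, and division with remainder decides for each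
    -- whether it divides `f`.
    reducible? : Reducible e f ⊎ (∀ i → 0 < i → i < e → ∀ a b → Monic i a → Poly b → ¬ f ≋ a ⋆ b)
    reducible? = decide (Fin.any? {e} (λ i → (0 ℕ.<? toℕ i) ×-dec Fin.any? (divides? (toℕ i))))
      where
      decide : Dec (∃ λ (i : Fin e) → 0 < toℕ i × ∃ (Divides (toℕ i))) →
               Reducible e f ⊎ (∀ i → 0 < i → i < e → ∀ a b → Monic i a → Poly b → ¬ f ≋ a ⋆ b)
      decide (yes (i , 0<i , k , b , pb , f≋)) = inj₁ (candidate (toℕ i) k ⋆⟨ 0<i , Fin.toℕ<n i , candidate-monic (toℕ i) k , pb , f≋ ⟩)
      decide (no none) = inj₂ λ i 0<i i<e a b ma pb f≋ → none (fromℕ< i<e ,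
        ≡.subst (λ j → 0 < j × ∃ (Divides j)) (≡.sym (Fin.toℕ-fromℕ< i<e))
          (0<i , encode {i} (a ∘ toℕ) , b , pb , S₁.trans f≋ (S₁.*-congʳ {b} (S₁.sym (candidate-complete {i} {a} ma)))))

  cofactor-monic : ∀ {i j f a b} → Monic (i ℕ.+ j) f → Monic i a → Poly b → f ≋ a ⋆ b → Monic j b
  cofactor-monic {i} {j} {f} {a} {b} (df , f≈1) ma@(da , ai≈1) (m , dm) f≋ = db , (begin
      b j                   ≈⟨ K.*-identityˡ _ ⟨
      K.1# K.* b j          ≈⟨ K.*-congʳ ai≈1 ⟨
      a i K.* b j           ≈⟨ ⋆-top a b da db ⟨
      (a ⋆ b) (i ℕ.+ j)     ≈⟨ f≋ _ ⟨
      f (i ℕ.+ j)           ≈⟨ f≈1 ⟩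
      K.1#                  ∎)
    where
    open SetoidReasoning K.setoid
    db : Deg≤ j b
    db = cofactor-Deg< {f = a} ma m dm (suc j) (≡.subst (λ n → Deg< n (a ⋆ b)) (≡.sym (ℕ.+-suc i j)) (Deg<-resp f≋ df))

  -- Proper monic factors are split off until only irreducible ones remain. Degree lists are
  -- concatenated, and the powers of x^(q^D) - x multiply accordingly.
  factorize : ∀ {e f} → Monic e f → Factored e f
  factorize {e} {f} = go e e f ℕ.≤-refl
    where
    open SetoidReasoning S₁.setoid
    open Solver S₁.commutativeSemiring using (solve; _:=_; _:*_)

    go : ∀ n e f → e ≤ n → Monic e f → Factored e f
    go n zero f _ (df , f0≈1) = factored [] [] ≡.refl λ D _ → S₁.1# , Poly-1 , S₁.trans (S₁.*-identityʳ f) f≋1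
      where
      f≋1 : f ≋ S₁.1#
      f≋1 zero    = f0≈1
      f≋1 (suc k) = df (suc k) (s≤s z≤n)
    go (suc n) (suc e) f e≤n monic = step (reducible? {f = f} monic)
      where
      step : Reducible (suc e) f ⊎ (∀ i → 0 < i → i < suc e → ∀ a b → Monic i a → Poly b → ¬ f ≋ a ⋆ b) → Factored (suc e) f
      step (inj₂ irreducible) = factored (suc e ∷ []) (s≤s z≤n ∷ []) (ℕ.+-identityʳ (suc e)) power
        where
        power : ∀ D → All (_∣ D) (suc e ∷ []) → ∃ λ w → Poly w × f ⋆ w ≋ X^[ q ℕ.^ D ]-X S₁.^ 1
        power D (divides m ≡.refl ∷ []) =
          let w , pw , eq = Irreducible.divides-X^-X 𝔽 {f = f} monic irreducible m
          in w , pw , S₁.sym (S₁.trans (S₁.*-identityʳ X^[ q ℕ.^ (m ℕ.* suc e) ]-X) eq)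
      step (inj₁ (_⋆⟨_,_,_,_,_⟩ {suc i} a _ i<e ma {b} pb f≋)) =
        merge (go n (suc i) a (ℕ.≤-trans (ℕ.≤-pred i<e) (ℕ.≤-pred e≤n)) ma)
              (go n j b (ℕ.≤-trans (ℕ.m∸n≤m e i) (ℕ.≤-pred e≤n)) (cofactor-monic {suc i} {j} {f} {a} {b} (≡.subst (λ e → Monic e f) (≡.sym i+j≡e) monic) ma pb f≋))
        where
        j = e ∸ i

        i+j≡e : suc i ℕ.+ j ≡ suc e
        i+j≡e = ≡.cong suc (ℕ.m+[n∸m]≡n (ℕ.<⇒≤ (ℕ.≤-pred i<e)))

        merge : Factored (suc i) a → Factored j b → Factored (suc e) f
        merge (factored σ σ≥1 Σσ power) (factored τ τ≥1 Στ power′) = factored (σ ++ τ) (++⁺ σ≥1 τ≥1)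
          (≡.trans (sum-++ σ τ) (≡.trans (≡.cong₂ ℕ._+_ Σσ Στ) i+j≡e)) power″
          where
          power″ : ∀ D → All (_∣ D) (σ ++ τ) → ∃ λ w → Poly w × f ⋆ w ≋ X^[ q ℕ.^ D ]-X S₁.^ length (σ ++ τ)
          power″ D ∣D =
            let w , pw , aw≋ = power D (++⁻ˡ σ ∣D)
                w′ , pw′ , bw′≋ = power′ D (++⁻ʳ σ ∣D)
                g = X^[ q ℕ.^ D ]-X
            in w ⋆ w′ , Poly-⋆ {w} pw pw′ , (begin
              f ⋆ (w ⋆ w′)                          ≈⟨ S₁.*-congʳ {w ⋆ w′} f≋ ⟩
              a ⋆ b ⋆ (w ⋆ w′)                      ≈⟨ solve 4 (λ a b w v → a :* b :* (w :* v) := a :* w :* (b :* v)) S₁.refl a b w w′ ⟩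
              a ⋆ w ⋆ (b ⋆ w′)                      ≈⟨ S₁.*-cong aw≋ bw′≋ ⟩
              g S₁.^ length σ ⋆ g S₁.^ length τ     ≈⟨ S₁.^-homo-* g (length σ) (length τ) ⟨
              g S₁.^ (length σ ℕ.+ length τ)        ≡⟨ ≡.cong (g S₁.^_) (length-++ σ) ⟨
              g S₁.^ length (σ ++ τ)                ∎)

-- Univariate Cartier operators

∣lcmOf : ∀ σ → All (_∣ lcmOf σ) σ
∣lcmOf []      = []
∣lcmOf (s ∷ σ) = m∣lcm[m,n] s (lcmOf σ) ∷ All.map (λ d → ∣-trans d (n∣lcm[m,n] s (lcmOf σ))) (∣lcmOf σ)

module Cartier {c ℓ q} (𝔽 : FiniteField c ℓ q) where

  open Polynomials 𝔽
  open FieldSeries 𝔽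
  open Factorization 𝔽

  -- cartier t p s / p consists of the coefficients of s / p at the multiples of q ^ t.
  cartier : ℕ → Series → Series → Series
  cartier t p s = section (q ℕ.^ t) 0 (s ⋆ p S₁.^ ℕ.pred (q ℕ.^ t))

  cartier-cong : ∀ t p {s s′} → s ≋ s′ → cartier t p s ≋ cartier t p s′
  cartier-cong t p e = section-cong (q ℕ.^ t) 0 (S₁.*-congʳ {p S₁.^ ℕ.pred (q ℕ.^ t)} e)

  private
    suc-pred : ∀ t → suc (ℕ.pred (q ℕ.^ t)) ≡ q ℕ.^ t
    suc-pred t = ℕ.suc-pred (q ℕ.^ t) {{ℕ.>-nonZero (q^t>0 t)}}

    open Solver S₁.commutativeSemiring using (solve; _:=_; _:*_)
    open SetoidReasoning S₁.setoid

    section-power : ∀ t {F G H} → H ≋ F S₁.^ (q ℕ.^ t) ⋆ G →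
                    section (q ℕ.^ t) 0 H ≋ F ⋆ section (q ℕ.^ t) 0 G
    section-power t {F} {G} e = S₁.trans (section-cong (q ℕ.^ t) 0 e) (section-frobenius t 0 F G (q^t>0 t))

    ^-pred : ∀ t F → F S₁.^ (q ℕ.^ t) ≋ F ⋆ F S₁.^ ℕ.pred (q ℕ.^ t)
    ^-pred t F = S₁.reflexive (≡.cong (F S₁.^_) (≡.sym (suc-pred t)))

  -- For the fractions this is clear: taking the coefficients of s/p at multiples of Q′ and then of
  -- Q amounts to multiples of Q Q′. For the numerators the exponents of p add up as (Q - 1) Q′ +
  -- (Q′ - 1) = Q Q′ - 1.
  cartier-∘ : ∀ t u p s → cartier t p (cartier u p s) ≋ cartier (t ℕ.+ u) p s
  cartier-∘ t u p s = begin
    section Q 0 (section Q′ 0 (s ⋆ p S₁.^ ℕ.pred Q′) ⋆ P)       ≈⟨ section-cong Q 0 (S₁.trans (S₁.*-comm _ P) (S₁.sym (section-power u {P} {s ⋆ p S₁.^ ℕ.pred Q′} S₁.refl))) ⟩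
    section Q 0 (section Q′ 0 (P S₁.^ Q′ ⋆ (s ⋆ p S₁.^ ℕ.pred Q′)))
      ≈⟨ section-section Q Q′ (P S₁.^ Q′ ⋆ (s ⋆ p S₁.^ ℕ.pred Q′)) ⟩
    section (Q ℕ.* Q′) 0 (P S₁.^ Q′ ⋆ (s ⋆ p S₁.^ ℕ.pred Q′))   ≈⟨ section-cong (Q ℕ.* Q′) 0 exponents ⟩
    section (Q ℕ.* Q′) 0 (s ⋆ p S₁.^ ℕ.pred (Q ℕ.* Q′))         ≡⟨ ≡.cong (λ n → section n 0 (s ⋆ p S₁.^ ℕ.pred n)) (ℕ.^-distribˡ-+-* q t u) ⟨
    cartier (t ℕ.+ u) p s                                       ∎
    where
    Q = q ℕ.^ t
    Q′ = q ℕ.^ u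
    P = p S₁.^ ℕ.pred Q

    pred-* : ∀ a b → 0 < a → 0 < b → ℕ.pred a ℕ.* b ℕ.+ ℕ.pred b ≡ ℕ.pred (a ℕ.* b)
    pred-* (suc a) (suc b) _ _ = ℕ.+-comm (a ℕ.* suc b) b

    exponents : P S₁.^ Q′ ⋆ (s ⋆ p S₁.^ ℕ.pred Q′) ≋ s ⋆ p S₁.^ ℕ.pred (Q ℕ.* Q′)
    exponents = begin
      P S₁.^ Q′ ⋆ (s ⋆ p S₁.^ ℕ.pred Q′)                           ≈⟨ S₁.*-congʳ {s ⋆ p S₁.^ ℕ.pred Q′} (S₁.^-assocʳ p (ℕ.pred Q) Q′) ⟩
      p S₁.^ (ℕ.pred Q ℕ.* Q′) ⋆ (s ⋆ p S₁.^ ℕ.pred Q′)            ≈⟨ solve 3 (λ a s b → a :* (s :* b) := s :* (a :* b)) S₁.refl _ s _ ⟩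
      s ⋆ (p S₁.^ (ℕ.pred Q ℕ.* Q′) ⋆ p S₁.^ ℕ.pred Q′)            ≈⟨ S₁.*-congˡ {s} (S₁.^-homo-* p (ℕ.pred Q ℕ.* Q′) (ℕ.pred Q′)) ⟨
      s ⋆ p S₁.^ (ℕ.pred Q ℕ.* Q′ ℕ.+ ℕ.pred Q′)                   ≡⟨ ≡.cong (λ n → s ⋆ p S₁.^ n) (pred-* Q Q′ (q^t>0 t) (q^t>0 u)) ⟩
      s ⋆ p S₁.^ ℕ.pred (Q ℕ.* Q′)                                 ∎

  -- Expanding a fraction: s/p = w s/h.
  cartier-⋆ : ∀ t {p w h} s → p ⋆ w ≋ h → w ⋆ cartier t p s ≋ cartier t h (w ⋆ s)
  cartier-⋆ t {p} {w} {h} s pw≋h = S₁.sym (section-power t (begin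
    w ⋆ s ⋆ h S₁.^ k                      ≈⟨ S₁.*-congˡ {w ⋆ s} (S₁.trans (S₁.^-congˡ k (S₁.sym pw≋h)) (S₁.^-distrib-* p w k)) ⟩
    w ⋆ s ⋆ (p S₁.^ k ⋆ w S₁.^ k)         ≈⟨ solve 4 (λ w s a b → w :* s :* (a :* b) := w :* b :* (s :* a)) S₁.refl w s _ _ ⟩
    w ⋆ w S₁.^ k ⋆ (s ⋆ p S₁.^ k)         ≈⟨ S₁.*-congʳ {s ⋆ p S₁.^ k} (^-pred t w) ⟨
    w S₁.^ (q ℕ.^ t) ⋆ (s ⋆ p S₁.^ k)     ∎))
    where k = ℕ.pred (q ℕ.^ t)

  -- With Q = q^t, the section of s/g^Q is the section of s divided by g, written here over the
  -- denominator g^Q.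
  cartier-power-self : ∀ t g s → cartier t (g S₁.^ (q ℕ.^ t)) s ≋ g S₁.^ ℕ.pred (q ℕ.^ t) ⋆ section (q ℕ.^ t) 0 s
  cartier-power-self t g s = section-power t (begin
    s ⋆ (g S₁.^ Q) S₁.^ k      ≈⟨ S₁.*-comm s _ ⟩
    (g S₁.^ Q) S₁.^ k ⋆ s      ≈⟨ S₁.*-congʳ {s} (S₁.trans (S₁.^-assocʳ g Q k) (S₁.trans (S₁.reflexive (≡.cong (g S₁.^_) (ℕ.*-comm Q k))) (S₁.sym (S₁.^-assocʳ g k Q)))) ⟩
    (g S₁.^ k) S₁.^ Q ⋆ s      ∎)
    where
    Q = q ℕ.^ t
    k = ℕ.pred Q

  -- With M = q^t, the fraction g^(M-1) s / g^M is s/g; the operators for both denominators agree on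
  -- it.
  cartier-power : ∀ D t g s → cartier D (g S₁.^ (q ℕ.^ t)) (g S₁.^ ℕ.pred (q ℕ.^ t) ⋆ s) ≋ g S₁.^ ℕ.pred (q ℕ.^ t) ⋆ cartier D g s
  cartier-power D t g s = section-power D (begin
    a ⋆ s ⋆ (g S₁.^ (q ℕ.^ t)) S₁.^ k          ≈⟨ S₁.*-congˡ {a ⋆ s} (S₁.trans (S₁.^-congˡ k (^-pred t g)) (S₁.^-distrib-* g a k)) ⟩
    a ⋆ s ⋆ (g S₁.^ k ⋆ a S₁.^ k)              ≈⟨ solve 4 (λ a s b c → a :* s :* (b :* c) := a :* c :* (s :* b)) S₁.refl a s _ _ ⟩
    a ⋆ a S₁.^ k ⋆ (s ⋆ g S₁.^ k)              ≈⟨ S₁.*-congʳ {s ⋆ g S₁.^ k} (^-pred D a) ⟨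
    a S₁.^ (q ℕ.^ D) ⋆ (s ⋆ g S₁.^ k)          ∎)
    where
    a = g S₁.^ ℕ.pred (q ℕ.^ t)
    k = ℕ.pred (q ℕ.^ D)

  -- Otherwise all elements would be equal, while the enumeration has at least two indices.
  1≉0 : ¬ (K.1# K.≈ K.0#)
  1≉0 1≈0 = Fin.<⇒≢ {i = fromℕ< 0<q} {j = fromℕ< 2≤q}
      (≡.subst₂ _<_ (≡.sym (Fin.toℕ-fromℕ< 0<q)) (≡.sym (Fin.toℕ-fromℕ< 2≤q)) (s≤s z≤n))
      (≡.trans (≡.sym (strictlyInverseˡ _)) (≡.trans (to-cong (K.trans (x≈0 _) (K.sym (x≈0 _)))) (strictlyInverseˡ _)))
    where
    open Inverse enumeration
    0<q : 0 < q
    0<q = ℕ.≤-trans (s≤s z≤n) 2≤q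

    x≈0 : ∀ x → x K.≈ K.0#
    x≈0 x = K.trans (K.sym (K.*-identityʳ x)) (K.trans (K.*-congˡ 1≈0) (K.zeroʳ x))

  X^-X-⋆ : ∀ Q V → X^[ Q ]-X ⋆ V ≋ shiftBy Q V S₁.- shift V
  X^-X-⋆ Q V = begin
    (X S₁.^ Q S₁.- X) ⋆ V                  ≈⟨ S₁.distribʳ V (X S₁.^ Q) (S₁.- X) ⟩
    X S₁.^ Q ⋆ V ⊕ (S₁.- X) ⋆ V            ≈⟨ S₁.+-cong (X^⋆ Q V) (S₁.trans (S₁.sym (-‿distribˡ-* X V)) (S₁.-‿cong (X⋆ V))) ⟩
    shiftBy Q V S₁.- shift V               ∎
    where open RingProperties S₁.ring using (-‿distribˡ-*)

  X^-X-0 : ∀ Q → X^[ suc Q ]-X 0 K.≈ K.0#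
  X^-X-0 Q = K.trans (S₁.trans (S₁.sym (S₁.*-identityʳ X^[ suc Q ]-X)) (X^-X-⋆ (suc Q) S₁.1#) 0) (K.-‿inverseʳ K.0#)

  module _ (Q : ℕ) (2≤Q : 2 ≤ Q) where

    X^-X-cancel : ∀ {z} → X^[ Q ]-X ⋆ z ≋ 0ˢ → z ≋ 0ˢ
    -- As Q ≥ 2, the coefficient of x in x^Q - x is -1, so a nonzero coefficient occurs among the
    -- first two.
    X^-X-cancel {z} = ⋆-cancelˡ ≈0? zero-product 2 X^[ Q ]-X z (1 , ℕ.≤-refl , coefficient-1)
      where
      ≈0? : ∀ a → a K.≈ K.0# ⊎ ¬ (a K.≈ K.0#)
      ≈0? a with a ≈? K.0#
      ... | yes a≈0 = inj₁ a≈0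
      ... | no a≉0  = inj₂ a≉0

      coefficient-1 : ¬ (X^[ Q ]-X 1 K.≈ K.0#)
      coefficient-1 e = 1≉0 (K.trans (K.sym (-‿involutive K.1#)) (K.trans (K.-‿cong -1≈0) -0#≈0#))
        where
        open RingProperties K.ring using (-‿involutive; -0#≈0#)
        -1≈0 : K.- K.1# K.≈ K.0#
        -1≈0 = K.trans (K.sym (K.trans (S₁.trans (S₁.sym (S₁.*-identityʳ X^[ Q ]-X)) (X^-X-⋆ Q S₁.1#) 1)
          (K.trans (K.+-congʳ (K.reflexive (shiftBy-< Q S₁.1# 1 2≤Q))) (K.+-identityˡ _)))) e

    X^-X^-cancel : ∀ n {z} → X^[ Q ]-X S₁.^ n ⋆ z ≋ 0ˢ → z ≋ 0ˢ
    X^-X^-cancel zero    {z} e = S₁.trans (S₁.sym (S₁.*-identityˡ z)) e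
    X^-X^-cancel (suc n) {z} e = X^-X^-cancel n (X^-X-cancel (S₁.trans (S₁.sym (S₁.*-assoc X^[ Q ]-X (X^[ Q ]-X S₁.^ n) z)) e))

-- Periodicity of the univariate orbits

module Periodicity {c ℓ q} (𝔽 : FiniteField c ℓ q) where

  open Polynomials 𝔽
  open FieldSeries 𝔽
  open Factorization 𝔽
  open Cartier 𝔽

  -- For u = x v with deg v ≤ m = Q - 1, the series V = u / (x^Q - x) = - v / (1 - x^m)
  -- is periodic of period m from its second coefficient on, hence V (n Q) = V n.
  module QuotientSeries (m : ℕ) .{{_ : ℕ.NonZero m}} (u : Series) (u0≈0 : u 0 K.≈ K.0#) (deg-u : Deg≤ (suc m) u) where

    private
      Q = suc m

      -- In - v / (1 - x^m) with v = u/x of degree at most m, the coefficients v_m and v_0 meet at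
      -- every positive multiple of m; `δ` contributes v_0 = u_1 there.
      δ : ℕ → K.Carrier
      δ zero    = u 1
      δ (suc _) = K.0#

    V : Series
    V zero    = K.- u 1
    V (suc n) = K.- (u (2 ℕ.+ n % m) K.+ δ (suc n % m))

    section-V : section Q 0 V ≋ V
    section-V zero    = K.refl
    section-V (suc n) = K.reflexive (≡.cong₂ (λ a b → K.- (u (2 ℕ.+ a) K.+ δ b))
      (≡.trans (≡.cong (_% m) (position n)) ([m+kn]%n≡m%n n (suc n) m))
      (≡.trans (≡.cong ((_% m) ∘ suc) (position n)) ([m+kn]%n≡m%n (suc n) (suc n) m)))
      where
      position : ∀ n → m ℕ.+ n ℕ.* suc m ≡ n ℕ.+ suc n ℕ.* m
      position n = ≡.trans (≡.cong (m ℕ.+_) (ℕ.*-suc n m)) (x∙yz≈y∙xz m n (n ℕ.* m))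

    V-quotient : X^[ Q ]-X ⋆ V ≋ u
    V-quotient n = K.trans (X^-X-⋆ Q V n) (recurrence n)
      where
      open SetoidReasoning K.setoid
      open RingProperties K.ring using (-‿involutive)

      initial-terms : ∀ n → n < m → K.- V n K.≈ u (suc n)
      initial-terms zero    _ = -‿involutive (u 1)
      initial-terms (suc n) n<m = begin
        K.- (K.- (u (2 ℕ.+ n % m) K.+ δ (suc n % m)))     ≈⟨ -‿involutive _ ⟩
        u (2 ℕ.+ n % m) K.+ δ (suc n % m)                 ≡⟨ ≡.cong₂ (λ a b → u (2 ℕ.+ a) K.+ δ b) (m<n⇒m%n≡m (ℕ.<-trans (ℕ.n<1+n n) n<m)) (m<n⇒m%n≡m n<m) ⟩
        u (2 ℕ.+ n) K.+ K.0#                              ≈⟨ K.+-identityʳ _ ⟩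
        u (2 ℕ.+ n)                                       ∎

      V-m : ∀ m′ → suc m′ ≡ m → V m K.≈ K.- (u (suc m) K.+ u 1)
      V-m m′ ≡.refl = K.reflexive (≡.cong₂ (λ a b → K.- (u (2 ℕ.+ a) K.+ δ b)) (m<n⇒m%n≡m (ℕ.n<1+n m′)) (n%n≡0 m))

      later-terms : ∀ i → V i K.- V (m ℕ.+ i) K.≈ u (suc (m ℕ.+ i))
      later-terms zero = begin
        K.- u 1 K.- V (m ℕ.+ 0)                           ≡⟨ ≡.cong (λ n → K.- u 1 K.- V n) (ℕ.+-identityʳ m) ⟩
        K.- u 1 K.- V m                                   ≈⟨ K.+-congˡ (K.trans (K.-‿cong (V-m (ℕ.pred m) (ℕ.suc-pred m))) (-‿involutive _)) ⟩
        K.- u 1 K.+ (u (suc m) K.+ u 1)                   ≈⟨ K.trans (K.sym (K.+-assoc _ _ _)) (K.trans (K.+-congʳ (K.+-comm _ _)) (K.trans (K.+-assoc _ _ _) (K.trans (K.+-congˡ (K.-‿inverseˡ (u 1))) (K.+-identityʳ _)))) ⟩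
        u (suc m)                                         ≡⟨ ≡.cong (u ∘ suc) (ℕ.+-identityʳ m) ⟨
        u (suc (m ℕ.+ 0))                                 ∎
      later-terms (suc j) = begin
        V (suc j) K.- V (m ℕ.+ suc j)                     ≈⟨ K.+-congˡ (K.-‿cong (K.reflexive periodic)) ⟩
        V (suc j) K.- V (suc j)                           ≈⟨ K.-‿inverseʳ _ ⟩
        K.0#                                              ≈⟨ deg-u _ (s≤s (≡.subst (m <_) (≡.sym (ℕ.+-suc m j)) (s≤s (ℕ.m≤m+n m j)))) ⟨
        u (suc (m ℕ.+ suc j))                             ∎
        where
        shift-% : ∀ i → (m ℕ.+ i) % m ≡ i % m
        shift-% i = ≡.trans (≡.cong (_% m) (ℕ.+-comm m i)) ([m+n]%n≡m%n i m)

        periodic : V (m ℕ.+ suc j) ≡ V (suc j)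
        periodic = ≡.trans (≡.cong V (ℕ.+-suc m j)) (≡.cong₂ (λ a b → K.- (u (2 ℕ.+ a) K.+ δ b)) (shift-% j)
          (≡.trans (≡.cong (_% m) (≡.sym (ℕ.+-suc m j))) (shift-% (suc j))))

      recurrence : ∀ n → shiftBy Q V n K.- shift V n K.≈ u n
      recurrence zero = K.trans (K.-‿inverseʳ K.0#) (K.sym u0≈0)
      recurrence (suc n) with n ℕ.<? m
      ... | yes n<m = K.trans (K.+-congʳ (K.reflexive (shiftBy-< m V n n<m))) (K.trans (K.+-identityˡ _) (initial-terms n n<m))
      ... | no n≮m = ≡.subst (λ n → shiftBy m V n K.- V n K.≈ u (suc n)) (ℕ.m+[n∸m]≡n (ℕ.≮⇒≥ n≮m))
                       (K.trans (K.+-congʳ (K.reflexive (shiftBy-+ m V (n ∸ m)))) (later-terms (n ∸ m)))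

  open SetoidReasoning S₁.setoid

  -- With Q = q^D and g = x^Q - x, the fraction u/g is the series `V`, which equals its own section;
  -- u g^(Q-1) = g^Q V carries this over to numerators.
  cartier-fixed : ∀ D → 1 ≤ D → ∀ u → u 0 K.≈ K.0# → Deg≤ (q ℕ.^ D) u → cartier D X^[ q ℕ.^ D ]-X u ≋ u
  cartier-fixed D 1≤D u u0≈0 deg-u = fixed (q ℕ.^ D) ≡.refl (2≤q^ 1≤D) deg-u
    where
    -- The modulus becomes a variable so that it can be matched as `suc m` with `m` nonzero, as
    -- `QuotientSeries` requires.
    fixed : ∀ Q → Q ≡ q ℕ.^ D → 2 ≤ Q → Deg≤ Q u → cartier D X^[ q ℕ.^ D ]-X u ≋ u
    fixed (suc zero)      _  (s≤s ()) _
    fixed (suc m@(suc _)) Q≡ _ deg-u = begin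
      section Q 0 (u ⋆ g S₁.^ ℕ.pred Q)      ≈⟨ section-cong Q 0 numerator ⟩
      section Q 0 (g S₁.^ Q ⋆ V)             ≈⟨ section-frobenius D 0 g V (q^t>0 D) ⟩
      g ⋆ section Q 0 V                      ≈⟨ S₁.*-congˡ {g} (≡.subst (λ Q → section Q 0 V ≋ V) Q≡ section-V) ⟩
      g ⋆ V                                  ≈⟨ gV≋u ⟩
      u                                      ∎
      where
      Q = q ℕ.^ D
      g = X^[ Q ]-X
      open QuotientSeries m u u0≈0 deg-u
      open Solver S₁.commutativeSemiring using (solve; _:=_; _:*_)

      gV≋u : g ⋆ V ≋ u
      gV≋u = ≡.subst (λ Q → X^[ Q ]-X ⋆ V ≋ u) Q≡ V-quotient

      numerator : u ⋆ g S₁.^ ℕ.pred Q ≋ g S₁.^ Q ⋆ V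
      numerator = begin
        u ⋆ g S₁.^ ℕ.pred Q              ≈⟨ S₁.*-congʳ {g S₁.^ ℕ.pred Q} gV≋u ⟨
        g ⋆ V ⋆ g S₁.^ ℕ.pred Q          ≈⟨ solve 3 (λ g v h → g :* v :* h := g :* h :* v) S₁.refl g V _ ⟩
        g ⋆ g S₁.^ ℕ.pred Q ⋆ V          ≡⟨ ≡.cong (λ n → g S₁.^ n ⋆ V) (ℕ.suc-pred Q {{ℕ.>-nonZero (q^t>0 D)}}) ⟩
        g S₁.^ Q ⋆ V                     ∎

  -- Writing s/p = s w / g^M with g = x^(q^D) - x and M = q^t, the operator for M turns
  -- the fraction into u/g, and such fractions are fixed by the operator for q^D.
  cartier-periodic : ∀ D t {p w s n} → 1 ≤ D → n < q ℕ.^ t → Deg≤ n s →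
    p ⋆ w ≋ X^[ q ℕ.^ D ]-X S₁.^ (q ℕ.^ t) → Deg≤ (q ℕ.^ t ℕ.* q ℕ.^ D) w → w 0 K.≈ K.0# →
    cartier (D ℕ.+ t) p s ≋ cartier t p s
  cartier-periodic D t {p} {w} {s} {n} 1≤D n<M deg-s pw≋ deg-w w0≈0 = S₁.trans (S₁.sym (cartier-∘ D t p s))
    -- The two numerators agree after multiplication by w. Multiplying by p as well produces g^M = p
    -- w, a power of x^Q - x, which can be cancelled.
    (x∙y⁻¹≈ε⇒x≈y (cartier D p a) a (X^-X^-cancel Q (2≤q^ 1≤D) M (begin
      g S₁.^ M ⋆ (cartier D p a S₁.- a)             ≈⟨ S₁.*-congʳ {cartier D p a S₁.- a} (S₁.sym pw≋) ⟩
      p ⋆ w ⋆ (cartier D p a S₁.- a)                ≈⟨ S₁.*-assoc p w _ ⟩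
      p ⋆ (w ⋆ (cartier D p a S₁.- a))              ≈⟨ S₁.*-congˡ {p} (S₁.trans (x[y-z]≈xy-xz w (cartier D p a) a) (x≈y⇒x∙y⁻¹≈ε wb≋wa)) ⟩
      p ⋆ 0ˢ                                        ≈⟨ S₁.zeroʳ p ⟩
      0ˢ                                            ∎)))
    where
    Q = q ℕ.^ D
    M = q ℕ.^ t
    g = X^[ Q ]-X
    a = cartier t p s
    u = section M 0 (w ⋆ s)
    open RingProperties S₁.ring using (x∙y⁻¹≈ε⇒x≈y; x≈y⇒x∙y⁻¹≈ε; x[y-z]≈xy-xz)

    u0≈0 : u 0 K.≈ K.0#
    u0≈0 = K.trans (⋆-zero w s) (K.trans (K.*-congʳ w0≈0) (K.zeroˡ _))

    -- deg (w s) ≤ M Q + n < M (Q + 1), so the section at multiples of M has degree at most Q; this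
    -- is where n < q^t enters.
    deg-u : Deg≤ Q u
    deg-u k Q<k = Deg≤-⋆ w s deg-w deg-s (k ℕ.* M) (ℕ.<-≤-trans (ℕ.+-monoʳ-< (M ℕ.* Q) n<M)
      (≡.subst (_≤ k ℕ.* M) (≡.trans (ℕ.+-comm M (Q ℕ.* M)) (≡.cong (ℕ._+ M) (ℕ.*-comm Q M))) (ℕ.*-monoˡ-≤ M Q<k)))

    wa≋ : w ⋆ a ≋ g S₁.^ ℕ.pred M ⋆ u
    wa≋ = S₁.trans (cartier-⋆ t {p} {w} s pw≋) (cartier-power-self t g (w ⋆ s))

    wb≋wa : w ⋆ cartier D p a ≋ w ⋆ a
    wb≋wa = begin
      w ⋆ cartier D p a                             ≈⟨ cartier-⋆ D {p} {w} a pw≋ ⟩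
      cartier D (g S₁.^ M) (w ⋆ a)                  ≈⟨ cartier-cong D (g S₁.^ M) wa≋ ⟩
      cartier D (g S₁.^ M) (g S₁.^ ℕ.pred M ⋆ u)    ≈⟨ cartier-power D t g u ⟩
      g S₁.^ ℕ.pred M ⋆ cartier D g u               ≈⟨ S₁.*-congˡ {g S₁.^ ℕ.pred M} (cartier-fixed D 1≤D u u0≈0 deg-u) ⟩
      g S₁.^ ℕ.pred M ⋆ u                           ≈⟨ wa≋ ⟨
      w ⋆ a                                         ∎

  Periodic : ℕ → Series → List ℕ → Set (c ⊔ˡ ℓ)
  Periodic n p σ = ∀ D t → 1 ≤ D → All (_∣ D) σ → n < q ℕ.^ t → ∀ s → Deg≤ n s → cartier (D ℕ.+ t) p s ≋ cartier t p s

  factored⇒periodic : ∀ {n i p} → i ≤ n → Deg≤ i p → ¬ (p i K.≈ K.0#) →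
    ∃ λ σ → All (1 ≤_) σ × sum σ ≡ i × Periodic n p σ
  factored⇒periodic {n} {i} {p} i≤n deg-p pi≉0 = degrees , positive , total , periodic
    where
    u = proj₁ (inverse (p i) pi≉0)
    f = const u ⋆ p

    monic : Monic i f
    monic = Deg≤-⋆ (const u) p (Deg≤-const u) deg-p , K.trans (const-⋆ u p i) (K.trans (K.*-comm u (p i)) (proj₂ (inverse (p i) pi≉0)))

    open Factored (factorize {f = f} monic)

    periodic : Periodic n p degrees
    periodic D t 1≤D ∣D n<M s deg-s = cartier-periodic D t {p} {w} 1≤D n<M deg-s pw≋ deg-w w0≈0
      where
      Q = q ℕ.^ D
      M = q ℕ.^ t
      g = X^[ Q ]-X
      L = length degrees
      w₀ = proj₁ (divides-power D ∣D)
      -- The number L of irreducible factors satisfies L ≤ i ≤ n < M, so the exponent M - L is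
      -- positive: the factor completes the power to g^M and, as g(0) = 0, yields w(0) = 0.
      w₁ = w₀ ⋆ g S₁.^ (M ∸ L)
      w = const u ⋆ w₁
      open Solver S₁.commutativeSemiring using (solve; _:=_; _:*_)

      L<M : L < M
      L<M = ℕ.≤-<-trans (≡.subst (L ≤_) total (length≤sum positive)) (ℕ.≤-<-trans i≤n n<M)

      fw₁≋ : f ⋆ w₁ ≋ g S₁.^ M
      fw₁≋ = begin
        f ⋆ (w₀ ⋆ g S₁.^ (M ∸ L))             ≈⟨ S₁.*-assoc f w₀ _ ⟨
        f ⋆ w₀ ⋆ g S₁.^ (M ∸ L)               ≈⟨ S₁.*-congʳ {g S₁.^ (M ∸ L)} (proj₂ (proj₂ (divides-power D ∣D))) ⟩
        g S₁.^ L ⋆ g S₁.^ (M ∸ L)             ≈⟨ S₁.^-homo-* g L (M ∸ L) ⟨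
        g S₁.^ (L ℕ.+ (M ∸ L))                ≡⟨ ≡.cong (g S₁.^_) (ℕ.m+[n∸m]≡n (ℕ.<⇒≤ L<M)) ⟩
        g S₁.^ M                              ∎

      pw≋ : p ⋆ w ≋ g S₁.^ M
      pw≋ = S₁.trans (solve 3 (λ p u w → p :* (u :* w) := u :* p :* w) S₁.refl p (const u) w₁) fw₁≋

      Deg≤-X : Deg≤ 1 X
      Deg≤-X = Deg≤-shift {f = S₁.1#} (Deg≤-const K.1#)

      Deg≤-g : Deg≤ Q g
      Deg≤-g = Deg<-⊕ {f = X S₁.^ Q} (≡.subst (λ n → Deg≤ n (X S₁.^ Q)) (ℕ.*-identityʳ Q) (Deg≤-^ X Deg≤-X Q))
                 (Deg<-neg (Deg<-mono (s≤s (q^t>0 D)) Deg≤-X))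

      deg-w : Deg≤ (M ℕ.* Q) w
      deg-w = Deg≤-⋆ (const u) w₁ (Deg≤-const u)
        (let m , dm = Poly-⋆ {w₀} (proj₁ (proj₂ (divides-power D ∣D))) (Poly-^ {g} (suc Q , Deg≤-g) (M ∸ L)) in
         cofactor-Deg< {f = f} monic m dm (suc (M ℕ.* Q))
           (Deg<-mono (ℕ.m≤n+m _ i) (Deg<-resp (S₁.sym fw₁≋) (Deg≤-^ g Deg≤-g M))))

      power-0 : ∀ k → 0 < k → ∀ {x} → x 0 K.≈ K.0# → (x S₁.^ k) 0 K.≈ K.0#
      power-0 (suc k) _ {x} x0≈0 = K.trans (⋆-zero x (x S₁.^ k)) (K.trans (K.*-congʳ x0≈0) (K.zeroˡ _))

      g0≈0 : g 0 K.≈ K.0#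
      g0≈0 = ≡.subst (λ Q → X^[ Q ]-X 0 K.≈ K.0#) (ℕ.suc-pred Q {{ℕ.>-nonZero (q^t>0 D)}}) (X^-X-0 (ℕ.pred Q))

      w0≈0 : w 0 K.≈ K.0#
      w0≈0 = K.trans (⋆-zero (const u) w₁) (K.trans (K.*-congˡ (K.trans (⋆-zero w₀ (g S₁.^ (M ∸ L)))
        (K.trans (K.*-congˡ (power-0 (M ∸ L) (ℕ.m<n⇒0<n∸m L<M) {g} g0≈0)) (K.zeroʳ _)))) (K.zeroʳ u))

  periodic-partition : ∀ {n p} → 1 ≤ n → Deg≤ n p → ¬ (p ≋ 0ˢ) →
    ∃ λ i → ∃ λ σ → 1 ≤ i × i ≤ n × IsPartition i σ × Periodic n p σ
  periodic-partition {n} {p} 1≤n deg-p p≉0 = fromLeading (leading (suc n) p deg-p)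
    where
    Result = ∃ λ i → ∃ λ σ → 1 ≤ i × i ≤ n × IsPartition i σ × Periodic n p σ

    fromDegrees : ∀ i → i ≤ n → (∃ λ σ → All (1 ≤_) σ × sum σ ≡ i × Periodic n p σ) → Result
    -- A constant modulus has no irreducible factors, whereas `𝓛` begins with partitions of 1. The
    -- partition of 1 serves instead: the list of degrees is empty, so every D is a common multiple
    -- of it.
    fromDegrees zero    _ (σ , 1≤σ , Σσ , periodic) = 1 , 1 ∷ [] , ℕ.≤-refl , 1≤n , ([-] , ℕ.≤-refl ∷ [] , ≡.refl) ,
      λ D t 1≤D _ → periodic D t 1≤D (empty D σ 1≤σ Σσ)
      where
      empty : ∀ D σ → All (1 ≤_) σ → sum σ ≡ 0 → All (_∣ D) σ
      empty D []      _         _ = []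
      empty D (_ ∷ _) (s≤s _ ∷ _) ()
    fromDegrees (suc i) i<n (σ , 1≤σ , Σσ , periodic) = suc i , sort σ , s≤s z≤n , i<n ,
      (sort-↗ σ , All-resp-↭ (↭-sym (sort-↭ σ)) 1≤σ , ≡.trans (sum-↭ (sort-↭ σ)) Σσ) ,
      λ D t 1≤D ∣D → periodic D t 1≤D (All-resp-↭ (sort-↭ σ) ∣D)

    fromLeading : p ≋ 0ˢ ⊎ (∃ λ i → i < suc n × Deg≤ i p × ¬ (p i K.≈ K.0#)) → Result
    fromLeading (inj₁ p≋0) = contradiction p≋0 p≉0
    fromLeading (inj₂ (i , s≤s i≤n , deg , pi≉0)) = fromDegrees i i≤n (factored⇒periodic i≤n deg pi≉0)

-- The bivariate Cartier operator

module Evaluation {c ℓ q} (𝔽 : FiniteField c ℓ q) where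

  open FieldSeries 𝔽
  -- Bivariate series are series in y over K[[x]]: S j i is the coefficient of xⁱ yʲ.
  module Y where
    open PowerSeries S₁ public
    open Degrees S₁ public

  open Mult S₁.+-commutativeMonoid using () renaming (_×_ to _·_)

  k : ℕ
  k = ℕ.pred q

  suc-k : suc k ≡ q
  suc-k = ℕ.suc-pred q {{q-nonZero}}

  Λ : Y.Series → ℕ → Y.Series → Y.Series
  Λ P r S j = section q r (Y.section q k (S Y.⋆ P S₂.^ k) j)

  ∂ : Y.Series → Y.Series
  ∂ f j = suc j · f (suc j)

  module _ (F : Series) where

    y-F : Y.Series
    y-F = Y.X S₂.- Y.const F

    infix 4 _≡F_
    _≡F_ : Y.Series → Y.Series → Set (c ⊔ˡ ℓ)
    _≡F_ = _≡ₘ_ S₂ y-F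

    private
      module Q = CommutativeRing (quotientRing S₂ y-F)

    ≡F-^ : ∀ n {a b} → a ≡F b → a S₂.^ n ≡F b S₂.^ n
    ≡F-^ zero            _ = Q.refl {S₂.1#}
    ≡F-^ (suc n) {a} {b} e = Q.*-cong {a} {b} {a S₂.^ n} {b S₂.^ n} e (≡F-^ n e)

    open RingProperties S₂.ring using (-‿distribˡ-*; xyx⁻¹≈y; //-rightDividesʳ; //-rightDividesˡ)

    y≡F : Y.X ≡F Y.const F
    y≡F = S₂.1# , S₂.sym (S₂.trans (S₂.+-congˡ {Y.const F} (S₂.*-identityʳ y-F))
      (S₂.trans (S₂.sym (S₂.+-assoc (Y.const F) Y.X (S₂.- Y.const F))) (xyx⁻¹≈y (Y.const F) Y.X)))

    y-F-⋆ : ∀ f → y-F Y.⋆ f Y.≋ Y.shift f S₂.- Y.scale F f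
    y-F-⋆ f = begin
      (Y.X S₂.- Y.const F) Y.⋆ f                      ≈⟨ S₂.distribʳ f Y.X (S₂.- Y.const F) ⟩
      Y.X Y.⋆ f Y.⊕ (S₂.- Y.const F) Y.⋆ f            ≈⟨ S₂.+-cong (Y.X⋆ f) (S₂.trans (S₂.sym (-‿distribˡ-* (Y.const F) f)) (S₂.-‿cong (Y.const-⋆ F f))) ⟩
      Y.shift f S₂.- Y.scale F f                      ∎
      where open SetoidReasoning S₂.setoid

    -- As F(0) = 0, the series y - F vanishes at (0, 0), so evaluation there respects the
    -- congruence.
    ≡F⇒constant-term : ∀ {S a} → F 0 K.≈ K.0# → S ≡F Y.const a → S 0 0 K.≈ a 0
    ≡F⇒constant-term {S} {a} F0≈0 (T , S≋) = K.trans (S≋ 0 0) (K.trans (K.+-congˡ (K.trans (y-F-⋆ T 0 0) (K.trans (K.+-identityˡ _)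
      (K.trans (K.-‿cong (K.trans (⋆-zero F (T 0)) (K.trans (K.*-congʳ F0≈0) (K.zeroˡ _)))) -0#≈0#)))) (K.+-identityʳ _))
      where open RingProperties K.ring using (-0#≈0#)

    -- The Leibniz rule with ∂(y - F) = 1; it yields ∂P ≡ R modulo y - F. On coefficients it rests
    -- on (j + 1) R_j = R_j + j R_j.
    ∂-product : ∀ R → ∂ (y-F Y.⋆ R) Y.≋ R Y.⊕ y-F Y.⋆ ∂ R
    ∂-product R j = begin
      suc j · (y-F Y.⋆ R) (suc j)                                            ≈⟨ ×-congʳ (suc j) (y-F-⋆ R (suc j)) ⟩
      suc j · (R j S₁.- F ⋆ R (suc j))                                       ≈⟨ ×-distrib-+ (R j) (S₁.- (F ⋆ R (suc j))) (suc j) ⟩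
      suc j · R j ⊕ suc j · (S₁.- (F ⋆ R (suc j)))                           ≈⟨ S₁.+-congˡ {suc j · R j} (·-neg (suc j) (R (suc j))) ⟩
      R j ⊕ j · R j S₁.- F ⋆ (suc j · R (suc j))                             ≈⟨ S₁.+-assoc (R j) (j · R j) (S₁.- (F ⋆ (suc j · R (suc j)))) ⟩
      R j ⊕ (j · R j S₁.- F ⋆ (suc j · R (suc j)))                           ≈⟨ S₁.+-congˡ {R j} (S₁.+-congʳ {S₁.- (F ⋆ (suc j · R (suc j)))} (shift-∂ j)) ⟩
      R j ⊕ (Y.shift (∂ R) j S₁.- F ⋆ (suc j · R (suc j)))                   ≈⟨ S₁.+-congˡ {R j} (y-F-⋆ (∂ R) j) ⟨
      R j ⊕ (y-F Y.⋆ ∂ R) j                                                  ∎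
      where
      open SetoidReasoning S₁.setoid
      open Mult S₁.+-commutativeMonoid using (×-congʳ; ×-distrib-+)
      open Frobenius S₁ using (×-1-*)
      open RingProperties S₁.ring using (-‿distribʳ-*)
      open Solver S₁.commutativeSemiring using (solve; _:=_; _:*_)

      shift-∂ : ∀ j → j · R j ≋ Y.shift (∂ R) j
      shift-∂ zero    = S₁.refl
      shift-∂ (suc j) = S₁.refl

      ·-neg : ∀ n a → n · (S₁.- (F ⋆ a)) ≋ S₁.- (F ⋆ (n · a))
      ·-neg n a = begin
        n · (S₁.- (F ⋆ a))                       ≈⟨ ×-1-* n (S₁.- (F ⋆ a)) ⟩
        (n · S₁.1#) ⋆ (S₁.- (F ⋆ a))             ≈⟨ -‿distribʳ-* (n · S₁.1#) (F ⋆ a) ⟨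
        S₁.- ((n · S₁.1#) ⋆ (F ⋆ a))             ≈⟨ S₁.-‿cong (S₁.trans (solve 3 (λ n F a → n :* (F :* a) := F :* (n :* a)) S₁.refl (n · S₁.1#) F a) (S₁.*-congˡ {F} (S₁.sym (×-1-* n a)))) ⟩
        S₁.- (F ⋆ (n · a))                       ∎

    const-Y^ : ∀ a n → Y.const a S₂.^ n Y.≋ Y.const (a S₁.^ n)
    const-Y^ a zero    = λ _ → S₁.refl
    const-Y^ a (suc n) = S₂.trans (S₂.*-congˡ {Y.const a} (const-Y^ a n)) (S₂.sym (Y.const-* a (a S₁.^ n)))

    private
      Deg≤-y-F : Y.Deg≤ 1 y-F
      Deg≤-y-F (suc (suc j)) _ n = K.trans (K.+-identityˡ _) (RingProperties.-0#≈0# K.ring)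
      Deg≤-y-F (suc zero) (s≤s ())

      -- (y - F)^k is monic of degree k in y, so only the exponent k itself is selected among those
      -- congruent to k modulo q.
      power-coefficient : ∀ j → Y.section q k (y-F S₂.^ k) j ≋ Y.const S₁.1# j
      power-coefficient zero = S₁.trans (S₁.reflexive (≡.cong (y-F S₂.^ k) (≡.trans (ℕ.+-identityʳ k) (≡.sym (ℕ.*-identityʳ k)))))
        (S₁.trans (Y.^-top y-F Deg≤-y-F k) (S₁.trans (S₁.^-congˡ k (λ n → K.trans (K.+-congˡ -0#≈0#) (K.+-identityʳ _))) (1^ k)))
        where
        open RingProperties K.ring using (-0#≈0#)
        1^ : ∀ n → S₁.1# S₁.^ n ≋ S₁.1#
        1^ zero    = S₁.refl
        1^ (suc n) = S₁.trans (S₁.*-identityˡ _) (1^ n)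
      power-coefficient (suc j) = Y.Deg≤-^ y-F Deg≤-y-F k (k ℕ.+ suc j ℕ.* q)
        (≡.subst (_< k ℕ.+ suc j ℕ.* q) (≡.sym (ℕ.*-identityʳ k)) (ℕ.m<m+n k (ℕ.<-≤-trans (ℕ.<-≤-trans (s≤s z≤n) 2≤q) (ℕ.m≤m+n q _))))

    -- Write T = S Rᵏ with k = q - 1, so that S Pᵏ = T (y - F)ᵏ. Modulo y^q - F^q the latter is
    -- T(x,F) (y - F)ᵏ, whose part with exponents ≡ k in y is T(x,F) yᵏ.
    Λ-represents : ∀ {P R D S a} → P Y.≋ y-F Y.⋆ R → R ≡F Y.const D → ∀ r → r < q →
      S ≡F Y.const (D ⋆ a) → Λ P r S ≡F Y.const (D ⋆ section q r a)
    Λ-represents {P} {R} {D} {S} {a} P≋ R≡ r r<q S≡ = T′ , result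
      where
      open Solver S₂.commutativeSemiring using (solve; _:=_; _:*_; _:+_)
      E = Y.section q k
      k<q : k < q
      k<q = ≡.subst (k <_) suc-k (ℕ.n<1+n k)

      r<q^1 : r < q ℕ.^ 1
      r<q^1 = ≡.subst (r <_) (≡.sym (ℕ.^-identityʳ q)) r<q

      section-power₁ : ∀ G H → section q r (G S₁.^ q ⋆ H) ≋ G ⋆ section q r H
      section-power₁ G H = ≡.subst (λ Q → section Q r (G S₁.^ Q ⋆ H) ≋ G ⋆ section Q r H) (ℕ.^-identityʳ q)
        (section-frobenius 1 r G H r<q^1)

      SRᵏ≡ : S Y.⋆ R S₂.^ k ≡F Y.const (D S₁.^ q ⋆ a)
      SRᵏ≡ = Q.trans {S Y.⋆ R S₂.^ k} {Y.const (D ⋆ a) Y.⋆ Y.const D S₂.^ k} {Y.const (D S₁.^ q ⋆ a)}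
        (Q.*-cong {S} {Y.const (D ⋆ a)} {R S₂.^ k} {Y.const D S₂.^ k} S≡ (≡F-^ k {R} {Y.const D} R≡))
        (≈⇒≡ₘ S₂ y-F (begin
          Y.const (D ⋆ a) Y.⋆ Y.const D S₂.^ k                    ≈⟨ S₂.*-congˡ {Y.const (D ⋆ a)} (const-Y^ D k) ⟩
          Y.const (D ⋆ a) Y.⋆ Y.const (D S₁.^ k)                  ≈⟨ Y.const-* (D ⋆ a) (D S₁.^ k) ⟨
          Y.const (D ⋆ a ⋆ D S₁.^ k)                              ≈⟨ Y.const-cong (S₁.trans (S₁.*-assoc D a _) (S₁.trans (S₁.*-congˡ {D} (S₁.*-comm a _)) (S₁.trans (S₁.sym (S₁.*-assoc D (D S₁.^ k) a)) (S₁.*-congʳ {a} (S₁.reflexive (≡.cong (D S₁.^_) suc-k)))))) ⟩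
          Y.const (D S₁.^ q ⋆ a)                                  ∎))
        where open SetoidReasoning S₂.setoid

      T₁ = proj₁ SRᵏ≡
      b = D S₁.^ q ⋆ a

      -- The cofactor of the new congruence: y^q and F^q leave the extraction as y and F, which
      -- turns the multiplier y^q - F^q of `T₁` into y - F.
      T′ : Y.Series
      T′ j = section q r (E T₁ j)

      power-sum : y-F S₂.^ q Y.⊕ Y.const F S₂.^ q Y.≋ Y.X S₂.^ q
      power-sum = S₂.trans (S₂.sym (≡.subst (Frobenius.Additive S₂) (ℕ.^-identityʳ q) (additive-S₂ 1) y-F (Y.const F)))
        (S₂.^-congˡ q (//-rightDividesˡ (Y.const F) Y.X))

      -- This is S P^k = b (y - F)^k + (y^q - F^q) T₁ with the negative term moved to the left, so
      -- that the semiring solver applies.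
      total : S Y.⋆ P S₂.^ k Y.⊕ Y.const (F S₁.^ q) Y.⋆ T₁ Y.≋ Y.const b Y.⋆ y-F S₂.^ k Y.⊕ Y.X S₂.^ q Y.⋆ T₁
      total = begin
        S Y.⋆ P S₂.^ k Y.⊕ Y.const (F S₁.^ q) Y.⋆ T₁
          ≈⟨ S₂.+-cong (S₂.*-congˡ {S} (S₂.trans (S₂.^-congˡ k P≋) (S₂.^-distrib-* y-F R k))) (S₂.*-congʳ {T₁} (S₂.sym (const-Y^ F q))) ⟩
        S Y.⋆ (y-F S₂.^ k Y.⋆ R S₂.^ k) Y.⊕ Y.const F S₂.^ q Y.⋆ T₁
          ≈⟨ S₂.+-congʳ {Y.const F S₂.^ q Y.⋆ T₁} (S₂.trans (solve 3 (λ s m r → s :* (m :* r) := s :* r :* m) S₂.refl S _ _) (S₂.*-congʳ {y-F S₂.^ k} (proj₂ SRᵏ≡))) ⟩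
        (Y.const b Y.⊕ y-F Y.⋆ T₁) Y.⋆ y-F S₂.^ k Y.⊕ Y.const F S₂.^ q Y.⋆ T₁
          ≈⟨ solve 5 (λ b m t mk fq → (b :+ m :* t) :* mk :+ fq :* t := b :* mk :+ (m :* mk :+ fq) :* t) S₂.refl (Y.const b) y-F T₁ _ _ ⟩
        Y.const b Y.⋆ y-F S₂.^ k Y.⊕ (y-F S₂.^ suc k Y.⊕ Y.const F S₂.^ q) Y.⋆ T₁
          ≈⟨ S₂.+-congˡ {Y.const b Y.⋆ y-F S₂.^ k} (S₂.*-congʳ {T₁} (S₂.trans (S₂.+-congʳ {Y.const F S₂.^ q} (S₂.reflexive (≡.cong (y-F S₂.^_) suc-k))) power-sum)) ⟩
        Y.const b Y.⋆ y-F S₂.^ k Y.⊕ Y.X S₂.^ q Y.⋆ T₁ ∎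
        where open SetoidReasoning S₂.setoid

      extracted : ∀ j → E (S Y.⋆ P S₂.^ k) j ⊕ F S₁.^ q ⋆ E T₁ j ≋ b ⋆ Y.const S₁.1# j ⊕ Y.shift (E T₁) j
      extracted j = begin
        E (S Y.⋆ P S₂.^ k) j ⊕ F S₁.^ q ⋆ E T₁ j             ≈⟨ S₁.+-congˡ {E (S Y.⋆ P S₂.^ k) j} (Y.const-⋆ (F S₁.^ q) T₁ _) ⟨
        E (S Y.⋆ P S₂.^ k) j ⊕ E (Y.const (F S₁.^ q) Y.⋆ T₁) j   ≈⟨ total _ ⟩
        E (Y.const b Y.⋆ y-F S₂.^ k) j ⊕ E (Y.X S₂.^ q Y.⋆ T₁) j ≈⟨ S₁.+-cong (S₁.trans (Y.const-⋆ b (y-F S₂.^ k) _) (S₁.*-congˡ {b} (power-coefficient j))) (Y.section-X^ q k T₁ k<q j) ⟩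
        b ⋆ Y.const S₁.1# j ⊕ Y.shift (E T₁) j               ∎
        where open SetoidReasoning S₁.setoid

      section-const : ∀ j → section q r (b ⋆ Y.const S₁.1# j ⊕ Y.shift (E T₁) j) ≋ Y.const (D ⋆ section q r a) j ⊕ Y.shift T′ j
      section-const zero    = S₁.+-cong (S₁.trans (section-cong q r (S₁.*-identityʳ b)) (section-power₁ D a)) S₁.refl
      section-const (suc j) = S₁.+-cong {_} {_} {T′ j} (section-cong q r (S₁.zeroʳ b)) S₁.refl

      represented : Λ P r S Y.⊕ Y.scale F T′ Y.≋ Y.const (D ⋆ section q r a) Y.⊕ Y.shift T′
      represented j = begin
        Λ P r S j ⊕ F ⋆ T′ j                                             ≈⟨ S₁.+-congˡ {Λ P r S j} (section-power₁ F (E T₁ j)) ⟨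
        section q r (E (S Y.⋆ P S₂.^ k) j ⊕ F S₁.^ q ⋆ E T₁ j)           ≈⟨ section-cong q r (extracted j) ⟩
        section q r (b ⋆ Y.const S₁.1# j ⊕ Y.shift (E T₁) j)             ≈⟨ section-const j ⟩
        Y.const (D ⋆ section q r a) j ⊕ Y.shift T′ j                     ∎
        where open SetoidReasoning S₁.setoid

      result : Λ P r S Y.≋ Y.const (D ⋆ section q r a) Y.⊕ y-F Y.⋆ T′
      result = begin
        Λ P r S                                                               ≈⟨ //-rightDividesʳ (Y.scale F T′) (Λ P r S) ⟨
        Λ P r S Y.⊕ Y.scale F T′ S₂.- Y.scale F T′                            ≈⟨ S₂.+-congʳ {S₂.- Y.scale F T′} represented ⟩
        Y.const (D ⋆ section q r a) Y.⊕ Y.shift T′ S₂.- Y.scale F T′          ≈⟨ S₂.+-assoc (Y.const (D ⋆ section q r a)) (Y.shift T′) (S₂.- Y.scale F T′) ⟩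
        Y.const (D ⋆ section q r a) Y.⊕ (Y.shift T′ S₂.- Y.scale F T′)        ≈⟨ S₂.+-congˡ {Y.const (D ⋆ section q r a)} (y-F-⋆ T′) ⟨
        Y.const (D ⋆ section q r a) Y.⊕ y-F Y.⋆ T′                            ∎
        where open SetoidReasoning S₂.setoid

-- Borders and interior of the coefficient rectangle

module Borders {c ℓ q} (𝔽 : FiniteField c ℓ q) where

  open FieldSeries 𝔽
  open Evaluation 𝔽
  open Extension 𝔽
  open Cartier 𝔽
  open Periodicity 𝔽

  DegX≤ : ℕ → Y.Series → Set ℓ
  DegX≤ a S = ∀ j → Deg≤ a (S j)

  column : ℕ → Y.Series → Series
  column a S j = S j a

  DegX≤-⋆ : ∀ {a b} f g → DegX≤ a f → DegX≤ b g → DegX≤ (a ℕ.+ b) (f Y.⋆ g)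
  DegX≤-⋆ f g df dg zero    = Deg≤-resp (S₁.sym (Y.⋆-zero f g)) (Deg≤-⋆ (f 0) (g 0) (df 0) (dg 0))
  DegX≤-⋆ f g df dg (suc j) = Deg≤-resp (S₁.sym (Y.⋆-suc f g j))
    (Deg≤-⊕ {f = f 0 ⋆ g (suc j)} (Deg≤-⋆ (f 0) (g (suc j)) (df 0) (dg (suc j))) (DegX≤-⋆ (Y.tail f) g (df ∘ suc) dg j))

  DegX≤-^ : ∀ {a} f → DegX≤ a f → ∀ n → DegX≤ (n ℕ.* a) (f S₂.^ n)
  DegX≤-^ f df zero    zero    = Deg≤-const K.1#
  DegX≤-^ f df zero    (suc j) = λ _ _ → K.refl
  DegX≤-^ f df (suc n) = DegX≤-⋆ f (f S₂.^ n) df (DegX≤-^ f df n)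

  open SetoidReasoning K.setoid

  column-top : ∀ {a b} f g → DegX≤ a f → DegX≤ b g → column (a ℕ.+ b) (f Y.⋆ g) ≋ column a f ⋆ column b g
  column-top {a} {b} f g df dg zero = K.trans (Y.⋆-zero f g (a ℕ.+ b))
    (K.trans (⋆-top (f 0) (g 0) (df 0) (dg 0)) (K.sym (⋆-zero (column a f) (column b g))))
  column-top {a} {b} f g df dg (suc j) = begin
    (f Y.⋆ g) (suc j) (a ℕ.+ b)                                                     ≈⟨ Y.⋆-suc f g j (a ℕ.+ b) ⟩
    (f 0 ⋆ g (suc j)) (a ℕ.+ b) K.+ (Y.tail f Y.⋆ g) j (a ℕ.+ b)                    ≈⟨ K.+-cong (⋆-top (f 0) (g (suc j)) (df 0) (dg (suc j))) (column-top (Y.tail f) g (df ∘ suc) dg j) ⟩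
    column a f 0 K.* column b g (suc j) K.+ (tail (column a f) ⋆ column b g) j      ≈⟨ ⋆-suc (column a f) (column b g) j ⟨
    (column a f ⋆ column b g) (suc j)                                               ∎

  column-top-^ : ∀ {a} f → DegX≤ a f → ∀ n → column (n ℕ.* a) (f S₂.^ n) ≋ column a f S₁.^ n
  column-top-^ f df zero    = λ { zero → K.refl ; (suc j) → K.refl }
  column-top-^ {a} f df (suc n) = S₁.trans (column-top f (f S₂.^ n) df (DegX≤-^ f df n)) (S₁.*-congˡ {column a f} (column-top-^ f df n))

  column-0 : ∀ f g → column 0 (f Y.⋆ g) ≋ column 0 f ⋆ column 0 g
  column-0 f g zero = K.trans (Y.⋆-zero f g 0) (K.trans (⋆-zero (f 0) (g 0)) (K.sym (⋆-zero (column 0 f) (column 0 g))))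
  column-0 f g (suc j) = begin
    (f Y.⋆ g) (suc j) 0                                                             ≈⟨ Y.⋆-suc f g j 0 ⟩
    (f 0 ⋆ g (suc j)) 0 K.+ (Y.tail f Y.⋆ g) j 0                                    ≈⟨ K.+-cong (⋆-zero (f 0) (g (suc j))) (column-0 (Y.tail f) g j) ⟩
    column 0 f 0 K.* column 0 g (suc j) K.+ (tail (column 0 f) ⋆ column 0 g) j      ≈⟨ ⋆-suc (column 0 f) (column 0 g) j ⟨
    (column 0 f ⋆ column 0 g) (suc j)                                               ∎

  column-0-^ : ∀ f n → column 0 (f S₂.^ n) ≋ column 0 f S₁.^ n
  column-0-^ f zero    = λ { zero → K.refl ; (suc j) → K.refl }
  column-0-^ f (suc n) = S₁.trans (column-0 f (f S₂.^ n)) (S₁.*-congˡ {column 0 f} (column-0-^ f n))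

  cartier-0 : ∀ p s → cartier 0 p s ≋ s
  cartier-0 p s n = K.trans (S₁.*-identityʳ s (n ℕ.* 1)) (K.reflexive (≡.cong s (ℕ.*-identityʳ n)))

  cartier-1 : ∀ p s → cartier 1 p s ≋ section q 0 (s ⋆ p S₁.^ k)
  cartier-1 p s = S₁.reflexive (≡.cong (λ Q → section Q 0 (s ⋆ p S₁.^ ℕ.pred Q)) (ℕ.^-identityʳ q))

  module _ (P : Y.Series) {a e : ℕ} (degX-P : DegX≤ (suc a) P) (degY-P : Y.Deg≤ (suc e) P) where

    -- With h = a + 1 and d = e + 1: U contains y ∂P/∂y, whose degree in y may be d; W receives the
    -- image of U under Λ_0; V is the stable space with q^(hd) elements.
    InU InV InW : Y.Series → Set ℓ
    InU S = DegX≤ (suc a) S × Y.Deg≤ (suc e) S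
    InV S = DegX≤ a S × Y.Deg≤ e S
    InW S = DegX≤ (suc a) S × Y.Deg≤ e S

    InW⇒InU : ∀ {S} → InW S → InU S
    InW⇒InU (dx , dy) = dx , Y.Deg≤-mono (ℕ.n≤1+n e) dy

    private
      n+kn : ∀ n → n ℕ.+ k ℕ.* n ≡ n ℕ.* q
      n+kn n = ≡.trans (≡.cong (ℕ._* n) suc-k) (ℕ.*-comm q n)

      Λ-degX : ∀ {b b′ S} r → DegX≤ b S → (∀ i → b′ < i → b ℕ.+ k ℕ.* suc a < r ℕ.+ i ℕ.* q) → DegX≤ b′ (Λ P r S)
      Λ-degX {S = S} r dx bound j i b′<i = DegX≤-⋆ S (P S₂.^ k) dx (DegX≤-^ P degX-P k) (k ℕ.+ j ℕ.* q) (r ℕ.+ i ℕ.* q) (bound i b′<i)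

      -- S P^k has degree at most d q in y, and the selected exponents k + j q with j ≥ d exceed d q
      -- because k ≥ 1.
      Λ-degY : ∀ {S} r → Y.Deg≤ (suc e) S → Y.Deg≤ e (Λ P r S)
      Λ-degY {S} r dy j e<j i = Y.Deg≤-⋆ S (P S₂.^ k) dy (Y.Deg≤-^ P degY-P k) (k ℕ.+ j ℕ.* q)
        (≡.subst (_< k ℕ.+ j ℕ.* q) (≡.sym (n+kn (suc e))) (ℕ.≤-<-trans (ℕ.*-monoˡ-≤ q e<j)
          (ℕ.m<n+m (j ℕ.* q) (ℕ.≤-pred (≡.subst (2 ≤_) (≡.sym suc-k) 2≤q))))) (r ℕ.+ i ℕ.* q)

    Λ-0 : ∀ {S} → InU S → InW (Λ P 0 S)
    Λ-0 {S} (dx , dy) = Λ-degX {S = S} 0 dx (λ i h<i → ≡.subst (_< i ℕ.* q) (≡.sym (n+kn (suc a)))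
      (ℕ.*-monoˡ-< q {{q-nonZero}} h<i)) , Λ-degY {S} 0 dy

    -- S P^k has degree at most h q in x, and r + 1 + i q exceeds it already for i = h: a nonzero
    -- digit gains one degree over `Λ-0`.
    Λ-suc : ∀ {S} r → InU S → InV (Λ P (suc r) S)
    Λ-suc {S} r (dx , dy) = Λ-degX {S = S} (suc r) dx (λ i a<i → ≡.subst (_< suc r ℕ.+ i ℕ.* q) (≡.sym (n+kn (suc a)))
      (s≤s (ℕ.≤-trans (ℕ.*-monoˡ-≤ q a<i) (ℕ.m≤n+m (i ℕ.* q) r)))) , Λ-degY {S} (suc r) dy

    Λ-V : ∀ {S} r → InV S → InV (Λ P r S)
    Λ-V {S} r (dx , dy) = Λ-degX {S = S} r dx (λ i a<i → ≡.subst (_≤ r ℕ.+ i ℕ.* q) (≡.sym (n+kn (suc a)))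
      (ℕ.≤-trans (ℕ.*-monoˡ-≤ q a<i) (ℕ.m≤n+m (i ℕ.* q) r))) , Λ-degY {S} r (Y.Deg≤-mono (ℕ.n≤1+n e) dy)

    orbit : Y.Series → ℕ → Y.Series
    orbit S zero    = S
    orbit S (suc t) = Λ P 0 (orbit S t)

    orbit-W : ∀ {S} → InW S → ∀ t → InW (orbit S t)
    orbit-W w zero    = w
    orbit-W w (suc t) = Λ-0 (InW⇒InU (orbit-W w t))

    -- An extreme row or column of the coefficients, on which Λ P 0 acts by a univariate Cartier operator.
    record Border : Set (c ⊔ˡ ℓ) where
      field
        border : Y.Series → Series
        modulus : Series
        step : ∀ {S} → InW S → border (Λ P 0 S) ≋ cartier 1 modulus (border S)

      border-orbit : ∀ {S} → InW S → ∀ t → border (orbit S t) ≋ cartier t modulus (border S)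
      border-orbit {S} w zero    = S₁.sym (cartier-0 modulus (border S))
      border-orbit {S} w (suc t) = S₁.trans (step (orbit-W w t))
        (S₁.trans (cartier-cong 1 modulus (border-orbit w t)) (cartier-∘ 1 t modulus (border S)))

      border-periodic : ∀ {n σ D t S} → Periodic n modulus σ → 1 ≤ D → All (_∣ D) σ → n < q ℕ.^ t →
        InW S → Deg≤ n (border S) → ∀ m → border (orbit S (m ℕ.* D ℕ.+ t)) ≋ border (orbit S t)
      border-periodic per 1≤D ∣D n<q^t w deg zero = S₁.refl
      border-periodic {n} {D = D} {t} {S} per 1≤D ∣D n<q^t w deg (suc m) = S₁.trans (S₁.reflexive (≡.cong (border ∘ orbit S) (ℕ.+-assoc D (m ℕ.* D) t)))
        (S₁.trans (border-orbit w (D ℕ.+ (m ℕ.* D ℕ.+ t)))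
        (S₁.trans (per D (m ℕ.* D ℕ.+ t) 1≤D ∣D
          (ℕ.<-≤-trans n<q^t (ℕ.^-monoʳ-≤ q {{q-nonZero}} (ℕ.m≤n+m t (m ℕ.* D)))) (border S) deg)
        (S₁.trans (S₁.sym (border-orbit w (m ℕ.* D ℕ.+ t))) (border-periodic {n} per 1≤D ∣D n<q^t w deg m))))

    private
      -- The coefficient of y^(k+jq) in A Bᵏ is that of y^((j+1)q) in (y A) Bᵏ.
      shifted-step : ∀ i A B S → (∀ j → Λ P 0 S j i K.≈ (A ⋆ B S₁.^ k) (k ℕ.+ j ℕ.* q)) →
        shift (column i (Λ P 0 S)) ≋ cartier 1 B (shift A)
      shifted-step i A B S e′ zero    = K.sym (K.trans (cartier-1 B (shift A) 0) (shift-⋆ A (B S₁.^ k) 0))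
      shifted-step i A B S e′ (suc j) = begin
        Λ P 0 S j i                                      ≈⟨ e′ j ⟩
        (A ⋆ B S₁.^ k) (k ℕ.+ j ℕ.* q)                   ≡⟨⟩
        shift (A ⋆ B S₁.^ k) (suc k ℕ.+ j ℕ.* q)         ≡⟨ ≡.cong (λ n → shift (A ⋆ B S₁.^ k) (n ℕ.+ j ℕ.* q)) suc-k ⟩
        shift (A ⋆ B S₁.^ k) (q ℕ.+ j ℕ.* q)             ≈⟨ shift-⋆ A (B S₁.^ k) (q ℕ.+ j ℕ.* q) ⟨
        (shift A ⋆ B S₁.^ k) (suc j ℕ.* q)               ≈⟨ cartier-1 B (shift A) (suc j) ⟨
        cartier 1 B (shift A) (suc j)                    ∎

    -- Unless d = 1, the row y^0 is not a side: it is read off at the exponent y^k of S P^k, which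
    -- is not extreme. Apart from its two ends it belongs to the interior.
    data Side : Set where
      left right top : Side

    side : Side → Border
    side right = record
      { border = λ S → shift (column (suc a) S)
      ; modulus = column (suc a) P
      ; step = λ {S} (dx , _) → shifted-step (suc a) (column (suc a) S) (column (suc a) P) S λ j → begin
          (S Y.⋆ P S₂.^ k) (k ℕ.+ j ℕ.* q) (suc a ℕ.* q)                       ≡⟨ ≡.cong ((S Y.⋆ P S₂.^ k) (k ℕ.+ j ℕ.* q)) (n+kn (suc a)) ⟨
          (S Y.⋆ P S₂.^ k) (k ℕ.+ j ℕ.* q) (suc a ℕ.+ k ℕ.* suc a)             ≈⟨ column-top S (P S₂.^ k) dx (DegX≤-^ P degX-P k) _ ⟩
          (column (suc a) S ⋆ column (k ℕ.* suc a) (P S₂.^ k)) (k ℕ.+ j ℕ.* q) ≈⟨ S₁.*-congˡ {column (suc a) S} (column-top-^ P degX-P k) _ ⟩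
          (column (suc a) S ⋆ column (suc a) P S₁.^ k) (k ℕ.+ j ℕ.* q)         ∎
      }

    side left = record
      { border = λ S → shift (column 0 S)
      ; modulus = column 0 P
      ; step = λ {S} _ → shifted-step 0 (column 0 S) (column 0 P) S λ j →
          K.trans (column-0 S (P S₂.^ k) _) (S₁.*-congˡ {column 0 S} (column-0-^ P k) _)
      }

    side top = record
      { border = λ S → S e
      ; modulus = P (suc e)
      ; step = λ {S} (_ , dy) → S₁.trans (section-cong q 0 (S₁.trans (S₁.reflexive (≡.cong (S Y.⋆ P S₂.^ k) position))
            (S₁.trans (Y.⋆-top S (P S₂.^ k) dy (Y.Deg≤-^ P degY-P k)) (S₁.*-congˡ {S e} (Y.^-top P degY-P k)))))
          (S₁.sym (cartier-1 (P (suc e)) (S e)))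
      }
      where
      position : k ℕ.+ e ℕ.* q ≡ e ℕ.+ k ℕ.* suc e
      position = ≡.trans (≡.cong (λ n → k ℕ.+ e ℕ.* n) (≡.sym suc-k)) (≡.trans (≡.cong (k ℕ.+_) (ℕ.*-suc e k))
        (≡.trans (x∙yz≈y∙xz k e (e ℕ.* k)) (≡.cong (e ℕ.+_) (≡.trans (≡.cong (k ℕ.+_) (ℕ.*-comm e k)) (≡.sym (ℕ.*-suc k e))))))

    interior : Y.Series → Fin (a ℕ.* e) → K.Carrier
    interior S x = S (toℕ (proj₂ (Fin.remQuot {a} e x))) (suc (toℕ (proj₁ (Fin.remQuot {a} e x))))

    determined : ∀ {S S′} → InW S → InW S′ → (∀ β → Border.border (side β) S ≋ Border.border (side β) S′) →
      (∀ x → interior S x K.≈ interior S′ x) → S Y.≋ S′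
    determined {S} {S′} (dx , dy) (dx′ , dy′) borders inside j i with ℕ.<-cmp j e
    ... | tri> _ _ e<j = K.trans (dy j e<j i) (K.sym (dy′ j e<j i))
    ... | tri≈ _ ≡.refl _ = borders top i
    ... | tri< j<e _ _ with i
    ...   | zero = borders left (suc j)
    ...   | suc i with ℕ.<-cmp i a
    ...     | tri> _ _ a<i = K.trans (dx j (suc i) (s≤s a<i)) (K.sym (dx′ j (suc i) (s≤s a<i)))
    ...     | tri≈ _ ≡.refl _ = borders right (suc j)
    ...     | tri< i<a _ _ = begin
      S j (suc i)                                       ≡⟨ at S ⟨
      interior S (Fin.combine (fromℕ< i<a) (fromℕ< j<e))     ≈⟨ inside (Fin.combine (fromℕ< i<a) (fromℕ< j<e)) ⟩
      interior S′ (Fin.combine (fromℕ< i<a) (fromℕ< j<e))    ≡⟨ at S′ ⟩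
      S′ j (suc i)                                      ∎
      where
      at : ∀ S → interior S (Fin.combine (fromℕ< i<a) (fromℕ< j<e)) ≡ S j (suc i)
      at S = ≡.trans (≡.cong (λ (x , y) → S (toℕ y) (suc (toℕ x))) (Fin.remQuot-combine (fromℕ< i<a) (fromℕ< j<e)))
        (≡.cong₂ (λ m n → S m (suc n)) (Fin.toℕ-fromℕ< j<e) (Fin.toℕ-fromℕ< i<a))

    -- Among the q^(ae) + 1 times m D + t two have the same interior, and their borders are those of
    -- time t anyway.
    orbit-repeats : ∀ {S} D t → 1 ≤ D → InW S →
      (∀ β m → Border.border (side β) (orbit S (m ℕ.* D ℕ.+ t)) ≋ Border.border (side β) (orbit S t)) →
      ∃ λ i → ∃ λ j → i < j × j ≤ t ℕ.+ q ℕ.^ (a ℕ.* e) ℕ.* D × orbit S i Y.≋ orbit S j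
    orbit-repeats {S} D t 1≤D w periodic =
      let x , y , x<y , same = Fin.pigeonhole (ℕ.n<1+n (q ℕ.^ (a ℕ.* e))) code
      in time (toℕ x) , time (toℕ y)
       , ℕ.+-monoˡ-< t (ℕ.*-monoˡ-< D {{ℕ.>-nonZero 1≤D}} x<y)
       , ≡.subst (time (toℕ y) ≤_) (ℕ.+-comm _ t) (ℕ.+-monoˡ-≤ t (ℕ.*-monoˡ-≤ D (ℕ.≤-pred (Fin.toℕ<n y))))
       , determined (orbit-W w (time (toℕ x))) (orbit-W w (time (toℕ y)))
           (λ β → S₁.trans (periodic β (toℕ x)) (S₁.sym (periodic β (toℕ y))))
           (λ z → K.trans (K.sym (decode-encode {a ℕ.* e} (interior (orbit S (time (toℕ x)))) z))
             (K.trans (K.reflexive (≡.cong (λ n → decode {a ℕ.* e} n z) same))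
               (decode-encode {a ℕ.* e} (interior (orbit S (time (toℕ y)))) z)))
      where
      time : ℕ → ℕ
      time m = m ℕ.* D ℕ.+ t

      code : Fin (suc (q ℕ.^ (a ℕ.* e))) → Fin (q ℕ.^ (a ℕ.* e))
      code m = encode {a ℕ.* e} (interior (orbit S (time (toℕ m))))

-- Automata

least : ∀ {n p} {P : Fin n → Set p} → Decidable₁ P → ∃ P → ∃ λ i → P i × ∀ j → j Fin.< i → ¬ P j
least {suc n} {P = P} P? (i , Pi) with P? Fin.zero
... | yes P0 = Fin.zero , P0 , λ _ ()
... | no ¬P0 = shifted i Pi
  where
  shifted : ∀ i → P i → ∃ λ i → P i × ∀ j → j Fin.< i → ¬ P j
  shifted Fin.zero    P0 = contradiction P0 ¬P0
  shifted (Fin.suc i) Pi =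
    let j , Pj , below = least (P? ∘ Fin.suc) (i , Pi)
    in Fin.suc j , Pj , λ { Fin.zero _ → ¬P0 ; (Fin.suc l) (s≤s l<j) → below l l<j }

AllPairs-lookup : ∀ {a r} {A : Set a} {R : A → A → Set r} {xs} → AllPairs R xs →
                  ∀ {i j} → i Fin.< j → R (lookup xs i) (lookup xs j)
AllPairs-lookup (px ∷ _)  {Fin.zero}  {Fin.suc j} _         = All.lookup px (∈-lookup j)
AllPairs-lookup (_ ∷ pxs) {Fin.suc i} {Fin.suc j} (s≤s i<j) = AllPairs-lookup pxs i<j

module Reachability {n q : ℕ} (δ : Fin n → Fin q → Fin n) where

  -- A path with at least n letters visits some state twice; cut out the loop.
  shorten : ∀ x (w : List (Fin q)) → ∃ λ w′ → length w′ ≤ n × foldl δ x w′ ≡ foldl δ x w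
  shorten x w = cut w (<-wellFounded (length w))
    where
    cut : ∀ w → Acc _<_ (length w) → ∃ λ w′ → length w′ ≤ n × foldl δ x w′ ≡ foldl δ x w
    cut w (acc smaller) with length w ℕ.≤? n
    ... | yes short = w , short , ≡.refl
    ... | no long =
      let i , j , i<j , same = Fin.pigeonhole (ℕ.n<1+n n) (λ i → foldl δ x (take (toℕ i) w))
          w₁ , short , eq = cut (loopless i j) (smaller (loopless-shorter i j i<j))
      in w₁ , short , ≡.trans eq (loopless-end i j same)
      where
      loopless : Fin (suc n) → Fin (suc n) → List (Fin q)
      loopless i j = take (toℕ i) w ++ drop (toℕ j) w

      loopless-shorter : ∀ i j → i Fin.< j → length (loopless i j) < length w
      loopless-shorter i j i<j = ≡.subst (_< length w) (≡.sym (≡.trans (length-++ (take (toℕ i) w)) (≡.cong₂ ℕ._+_ (length-take (toℕ i) w) (length-drop (toℕ j) w))))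
        (ℕ.≤-<-trans (ℕ.+-monoˡ-≤ (length w ∸ toℕ j) (ℕ.m⊓n≤m (toℕ i) (length w)))
          (≡.subst (toℕ i ℕ.+ (length w ∸ toℕ j) <_) (ℕ.m+[n∸m]≡n (ℕ.≤-trans (ℕ.≤-pred (Fin.toℕ<n j)) (ℕ.<⇒≤ (ℕ.≰⇒> long))))
            (ℕ.+-monoˡ-< (length w ∸ toℕ j) i<j)))

      loopless-end : ∀ i j → foldl δ x (take (toℕ i) w) ≡ foldl δ x (take (toℕ j) w) → foldl δ x (loopless i j) ≡ foldl δ x w
      loopless-end i j same = ≡.trans (foldl-++ δ x (take (toℕ i) w) (drop (toℕ j) w))
        (≡.trans (≡.cong (λ y → foldl δ y (drop (toℕ j) w)) same)
        (≡.trans (≡.sym (foldl-++ δ x (take (toℕ j) w) (drop (toℕ j) w)))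
          (≡.cong (foldl δ x) (take++drop≡id (toℕ j) w))))

  -- By `shorten`, words of length at most n suffice, and these can be searched exhaustively.
  reaches? : ∀ {p} {P : Fin n → Set p} → Decidable₁ P → ∀ x → Dec (∃ λ w → P (foldl δ x w))
  reaches? {P = P} P? x = map′ (λ (w , _ , Pw) → w , Pw)
      (λ (w , Pw) → let w′ , short , eq = shorten x w in w′ , short , ≡.subst P (≡.sym eq) Pw)
      (bounded? n x)
    where
    bounded? : ∀ l x → Dec (∃ λ w → length w ≤ l × P (foldl δ x w))
    bounded? zero x = map′ (λ Px → [] , z≤n , Px) (λ { ([] , _ , Px) → Px }) (P? x)
    bounded? (suc l) x = map′
      [ (λ Px → [] , z≤n , Px) , (λ (r , w , short , Pw) → r ∷ w , s≤s short , Pw) ]′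
      (λ { ([] , _ , Px) → inj₁ Px ; (r ∷ w , s≤s short , Pw) → inj₂ (r , w , short , Pw) })
      (P? x ⊎-dec Fin.any? (λ r → bounded? l (δ x r)))

fromDigits-zeros : ∀ {q} {zs : Expansion q} → All (λ d → toℕ d ≡ 0) zs → fromDigits zs ≡ 0
fromDigits-zeros []               = ≡.refl
fromDigits-zeros {q} (z ∷ zs) = ≡.cong₂ (λ a b → a ℕ.+ b ℕ.* q) z (fromDigits-zeros zs)

fromDigits-++-zeros : ∀ {q} (w : Expansion q) {zs} → All (λ d → toℕ d ≡ 0) zs → fromDigits (w ++ zs) ≡ fromDigits w
fromDigits-++-zeros []          zeros = fromDigits-zeros zeros
fromDigits-++-zeros {q} (d ∷ w) zeros = ≡.cong (λ n → toℕ d ℕ.+ n ℕ.* q) (fromDigits-++-zeros w zeros)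

standardize : ∀ {q} (w : Expansion q) → ∃ λ u → ∃ λ zs → w ≡ u ++ zs × All (λ d → toℕ d ≡ 0) zs × IsStandardRep (fromDigits w) u
standardize [] = [] , [] , ≡.refl , [] , ≡.refl , Maybe.nothing
standardize {q} (d ∷ w) with standardize w
... | x ∷ u , zs , ≡.refl , zeros , value , nonzero = d ∷ x ∷ u , zs , ≡.refl , zeros , ≡.cong (λ n → toℕ d ℕ.+ n ℕ.* q) value , nonzero
... | [] , zs , ≡.refl , zeros , value , _ with toℕ d ℕ.≟ 0
...   | yes d≡0 = [] , d ∷ zs , ≡.refl , d≡0 ∷ zeros , ≡.cong₂ (λ a b → a ℕ.+ b ℕ.* q) (≡.sym d≡0) value , Maybe.nothing
...   | no d≢0  = d ∷ [] , zs , ≡.refl , zeros , ≡.cong (λ n → toℕ d ℕ.+ n ℕ.* q) value , Maybe.just d≢0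

-- Minimization of automata

module Minimization {o ℓ} {Output : Set o} {_≈_ : Output → Output → Set ℓ}
  (≈-refl : ∀ {x} → x ≈ x) (≈-sym : ∀ {x y} → x ≈ y → y ≈ x) (≈-trans : ∀ {x y z} → x ≈ y → y ≈ z → x ≈ z)
  (_≈?_ : ∀ x y → Dec (x ≈ y)) {q : ℕ} where

  open Automatic _≈_ {q}
  open DFAO

  -- Every word is a standard representation followed by zeros, so being unaffected by leading zeros
  -- amounts to being correct on all words.
  unaffected⇒run : ∀ M {a} → UnaffectedByLeadingZeros M a → ∀ w → run M w ≈ a (fromDigits w)
  unaffected⇒run M u w with standardize w
  ... | v , zs , ≡.refl , zeros , standard = u _ v zs standard zeros

  run⇒unaffected : ∀ M {a} → (∀ w → run M w ≈ a (fromDigits w)) → UnaffectedByLeadingZeros M a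
  run⇒unaffected M {a} r n w zs (≡.refl , _) zeros = ≡.subst (λ n → run M (w ++ zs) ≈ a n) (fromDigits-++-zeros w zeros) (r (w ++ zs))

  run⇒generates : ∀ M {a} → (∀ w → run M w ≈ a (fromDigits w)) → Generates M a
  run⇒generates M r n w (≡.refl , _) = r w

  module _ (M : DFAO q Output) where

    private
      N = size M

      infix 4 _~_ _~?_
      _~_ : Fin N → Fin N → Set ℓ
      s ~ t = ∀ w → output M (foldl (δ M) s w) ≈ output M (foldl (δ M) t w)

      ~-sym : ∀ {s t} → s ~ t → t ~ s
      ~-sym e w = ≈-sym (e w)

      ~-trans : ∀ {s t u} → s ~ t → t ~ u → s ~ u
      ~-trans e f w = ≈-trans (e w) (f w)

      -- The product automaton: two states are inequivalent exactly if a pair with different outputs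
      -- can be reached from them, which makes equivalence decidable.
      pairδ : Fin (N ℕ.* N) → Fin q → Fin (N ℕ.* N)
      pairδ x r = Fin.combine (δ M (proj₁ (Fin.remQuot {N} N x)) r) (δ M (proj₂ (Fin.remQuot {N} N x)) r)

      pairδ-run : ∀ s t w → foldl pairδ (Fin.combine s t) w ≡ Fin.combine (foldl (δ M) s w) (foldl (δ M) t w)
      pairδ-run s t []      = ≡.refl
      pairδ-run s t (r ∷ w) = ≡.trans
        (≡.cong (λ (s , t) → foldl pairδ (Fin.combine (δ M s r) (δ M t r)) w) (Fin.remQuot-combine {N} s t))
        (pairδ-run (δ M s r) (δ M t r) w)

      Agree : Fin (N ℕ.* N) → Set ℓ
      Agree x = output M (proj₁ (Fin.remQuot {N} N x)) ≈ output M (proj₂ (Fin.remQuot {N} N x))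

      _~?_ : ∀ s t → Dec (s ~ t)
      s ~? t = map′ (λ none w → decidable-stable (_ ≈? _) λ bad → none (w , λ agree → bad (≡.subst id (agree≡ w) agree)))
          (λ e (w , bad) → bad (≡.subst id (≡.sym (agree≡ w)) (e w)))
          (¬? (Reachability.reaches? pairδ {P = λ x → ¬ Agree x} (λ x → ¬? (_ ≈? _)) (Fin.combine s t)))
        where
        agree≡ : ∀ w → Agree (foldl pairδ (Fin.combine s t) w) ≡ (output M (foldl (δ M) s w) ≈ output M (foldl (δ M) t w))
        agree≡ w = ≡.trans (≡.cong Agree (pairδ-run s t w))
          (≡.cong (λ (s , t) → output M s ≈ output M t) (Fin.remQuot-combine {N} (foldl (δ M) s w) (foldl (δ M) t w)))

      Reachable : Fin N → Set
      Reachable s = ∃ λ w → foldl (δ M) (initial M) w ≡ s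

      reachable? : Decidable₁ Reachable
      reachable? s = Reachability.reaches? (δ M) (Fin._≟ s) (initial M)

      reachable-δ : ∀ {s} r → Reachable s → Reachable (δ M s r)
      reachable-δ r (w , ≡.refl) = w ++ r ∷ [] , foldl-++ (δ M) (initial M) w (r ∷ [])

      -- Instead of forming a quotient, the reduced automaton keeps from each class of equivalent
      -- reachable states the one with the least index.
      SmallerTwin : Fin N → Set ℓ
      SmallerTwin s = ∃ λ t → t Fin.< s × Reachable t × t ~ s

      Canonical : Fin N → Set ℓ
      Canonical s = Reachable s × ¬ SmallerTwin s

      canonical? : Decidable₁ Canonical
      canonical? s = reachable? s ×-dec ¬? (Fin.any? λ t → (t Fin.<? s) ×-dec (reachable? t ×-dec (t ~? s)))

      states : List (Fin N)
      states = filter canonical? (allFin N)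

      state : Fin (length states) → Fin N
      state = lookup states

      state-canonical : ∀ i → Canonical (state i)
      state-canonical i = All.lookup (all-filter canonical? (allFin N)) (∈-lookup i)

      representative : ∀ s → Reachable s → ∃ λ i → state i ~ s
      representative s reach =
        let t , (reach-t , t~s) , below = least (λ t → reachable? t ×-dec (t ~? s)) (s , reach , λ _ → ≈-refl)
            t∈ = ∈-filter⁺ canonical? (∈-allFin t)
                   (reach-t , λ (u , u<t , reach-u , u~t) → below u u<t (reach-u , ~-trans u~t t~s))
        in Any.index t∈ , ≡.subst (_~ s) (lookup-index t∈) t~s

      next : ∀ i r → ∃ λ j → state j ~ δ M (state i) r
      next i r = representative (δ M (state i) r) (reachable-δ r (proj₁ (state-canonical i)))

      start-state : ∃ λ i → state i ~ initial M
      start-state = representative (initial M) ([] , ≡.refl)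

    reduced : DFAO q Output
    reduced = record
      { size    = length states
      ; initial = proj₁ start-state
      ; δ       = λ i r → proj₁ (next i r)
      ; output  = output M ∘ state
      }

    reduced-size : size reduced ≤ size M
    reduced-size = ≡.subst (length states ≤_) (length-tabulate id) (length-filter canonical? (allFin N))

    private
      reduced-~ : ∀ w i s → state i ~ s → state (foldl (δ reduced) i w) ~ foldl (δ M) s w
      reduced-~ []      i s e = e
      reduced-~ (r ∷ w) i s e = reduced-~ w (proj₁ (next i r)) (δ M s r) (~-trans (proj₂ (next i r)) (e ∘ (r ∷_)))

    reduced-run : ∀ w → run reduced w ≈ run M w
    reduced-run w = reduced-~ w (proj₁ start-state) (initial M) (proj₂ start-state) []

    reduced-minimal : ∀ {a} → (∀ w → run M w ≈ a (fromDigits w)) → IsMinimalFor reduced a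
    reduced-minimal {a} correct = run⇒generates reduced reduced-correct , run⇒unaffected reduced reduced-correct , smallest
      where
      reduced-correct : ∀ w → run reduced w ≈ a (fromDigits w)
      reduced-correct w = ≈-trans (reduced-run w) (correct w)

      -- Each kept state is reached by some word. In an automaton with fewer states two of these
      -- words would end in the same state, and the corresponding kept states would be equivalent.
      smallest : ∀ M′ → Generates M′ a → UnaffectedByLeadingZeros M′ a → size reduced ≤ size M′
      smallest M′ _ unaffected = ℕ.≮⇒≥ λ M′<M →
        let i , j , i<j , same = Fin.pigeonhole M′<M image in collision i j i<j same
        where
        access : Fin (length states) → Expansion q
        access i = proj₁ (proj₁ (state-canonical i))

        image : Fin (length states) → Fin (size M′)
        image i = foldl (δ M′) (initial M′) (access i)

        output-image : ∀ i w → output M (foldl (δ M) (state i) w) ≈ output M′ (foldl (δ M′) (image i) w)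
        output-image i w = ≡.subst₂ (λ s t → output M s ≈ output M′ t)
          (≡.trans (foldl-++ (δ M) (initial M) (access i) w) (≡.cong (λ s → foldl (δ M) s w) (proj₂ (proj₁ (state-canonical i)))))
          (foldl-++ (δ M′) (initial M′) (access i) w)
          (≈-trans (correct (access i ++ w)) (≈-sym (unaffected⇒run M′ unaffected (access i ++ w))))

        collision : ∀ i j → i Fin.< j → image i ≢ image j
        collision i j i<j same = separate (Fin.<-cmp (state i) (state j))
          where
          i~j : state i ~ state j
          i~j w = ≈-trans (output-image i w) (≡.subst (λ s → output M′ (foldl (δ M′) s w) ≈ _) (≡.sym same) (≈-sym (output-image j w)))

          separate : Tri (state i Fin.< state j) (state i ≡ state j) (state j Fin.< state i) → ⊥
          separate (tri< i<j _ _) = proj₂ (state-canonical j) (state i , i<j , proj₁ (state-canonical i) , i~j)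
          separate (tri≈ _ i≡j _) = AllPairs-lookup (filter⁺ canonical? (allFin⁺ N)) i<j i≡j
          separate (tri> _ _ j<i) = proj₂ (state-canonical i) (state j , j<i , proj₁ (state-canonical j) , ~-sym i~j)

-- Coefficient lists as bivariate series

module Coefficients {c ℓ q} (𝔽 : FiniteField c ℓ q) where

  open FieldSeries 𝔽
  open Evaluation 𝔽
  open Algebraic K using (Poly₂; entry; eval; eval₂; scaleFrom; ∂y; fromPoly; substY)
  open Mult K.+-commutativeMonoid using () renaming (_×_ to _·_)
  open Mult S₁.+-commutativeMonoid using () renaming (_×_ to _·ˢ_)

  ⟦_⟧ : Poly₂ → Y.Series
  ⟦ P ⟧ j = fromPoly (entry [] P j)

  private
    ·-0 : ∀ n → n · K.0# K.≈ K.0#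
    ·-0 n = K.trans (Frobenius.×-1-* K n K.0#) (K.zeroʳ _)

    entry-map : ∀ n p i → entry K.0# (map (n ·_) p) i K.≈ n · entry K.0# p i
    entry-map n []      i       = K.sym (·-0 n)
    entry-map n (x ∷ p) zero    = K.refl
    entry-map n (x ∷ p) (suc i) = entry-map n p i

    scaleFrom-coefficients : ∀ n P j → ⟦ scaleFrom n P ⟧ j ≋ (n ℕ.+ j) ·ˢ ⟦ P ⟧ j
    scaleFrom-coefficients n []      j       i = K.sym (K.trans (K.reflexive (·-coefficient K (n ℕ.+ j) 0ˢ i)) (·-0 (n ℕ.+ j)))
    scaleFrom-coefficients n (p ∷ P) zero    i = K.trans (entry-map n p i) (K.sym (K.reflexive (≡.trans (·-coefficient K (n ℕ.+ 0) (fromPoly p) i) (≡.cong (_· fromPoly p i) (ℕ.+-identityʳ n)))))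
    scaleFrom-coefficients n (p ∷ P) (suc j) = S₁.trans (scaleFrom-coefficients (suc n) P j) (S₁.reflexive (≡.cong (_·ˢ ⟦ P ⟧ j) (≡.sym (ℕ.+-suc n j))))

  ∂y-coefficients : ∀ P → ⟦ ∂y P ⟧ Y.≋ ∂ ⟦ P ⟧
  ∂y-coefficients []      j i = K.sym (K.trans (K.reflexive (·-coefficient K (suc j) 0ˢ i)) (·-0 (suc j)))
  ∂y-coefficients (p ∷ P) = scaleFrom-coefficients 1 P

  eval₂-0 : ∀ P → eval₂ P K.0# K.0# K.≈ ⟦ P ⟧ 0 0
  eval₂-0 []      = K.refl
  eval₂-0 (p ∷ P) = K.trans (K.trans (K.+-congˡ (K.zeroˡ _)) (K.+-identityʳ _)) (eval-0 p)
    where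
    eval-0 : ∀ p → eval p K.0# K.≈ entry K.0# p 0
    eval-0 []      = K.refl
    eval-0 (x ∷ p) = K.trans (K.+-congˡ (K.zeroˡ _)) (K.+-identityʳ _)

  -- Horner's rule read modulo y - F. For P itself the value is 0, and the cofactor obtained is the
  -- R of P = (y - F) R.
  substY-value : ∀ F P → _≡F_ F ⟦ P ⟧ (Y.const (substY P F))
  substY-value F [] = ≈⇒≡ₘ S₂ (y-F F) λ { zero → S₁.refl ; (suc j) → S₁.refl }
  substY-value F (p ∷ P) = Q.trans {⟦ p ∷ P ⟧} {Y.const (fromPoly p) Y.⊕ Y.X Y.⋆ ⟦ P ⟧} {Y.const (substY (p ∷ P) F)}
    (≈⇒≡ₘ S₂ (y-F F) (S₂.trans (Y.head+tail ⟦ p ∷ P ⟧) (S₂.+-congˡ {Y.const (fromPoly p)} (S₂.sym (Y.X⋆ ⟦ P ⟧)))))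
    (Q.trans {Y.const (fromPoly p) Y.⊕ Y.X Y.⋆ ⟦ P ⟧} {Y.const (fromPoly p) Y.⊕ Y.const F Y.⋆ Y.const (substY P F)} {Y.const (substY (p ∷ P) F)}
      (Q.+-cong {Y.const (fromPoly p)} {Y.const (fromPoly p)} {Y.X Y.⋆ ⟦ P ⟧} {Y.const F Y.⋆ Y.const (substY P F)} (Q.refl {Y.const (fromPoly p)})
        (Q.*-cong {Y.X} {Y.const F} {⟦ P ⟧} {Y.const (substY P F)} (y≡F F) (substY-value F P)))
      (≈⇒≡ₘ S₂ (y-F F) (S₂.trans (S₂.+-congˡ {Y.const (fromPoly p)} (S₂.trans (S₂.sym (Y.const-* F (substY P F))) (Y.const-cong (⋆≈⊗ F (substY P F)))))
        (S₂.sym (Y.const-+ (fromPoly p) (F ⊗ substY P F))))))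
    where module Q = CommutativeRing (quotientRing S₂ (y-F F))

-- The automaton of an eventually periodic orbit

module OrbitAutomaton {c ℓ q} (𝔽 : FiniteField c ℓ q) where

  open FieldSeries 𝔽
  open Evaluation 𝔽
  open Borders 𝔽

  module Construction
    (P : Y.Series) {a e : ℕ} (degX-P : DegX≤ (suc a) P) (degY-P : Y.Deg≤ (suc e) P)
    (F D : Series) (R : Y.Series) (F0≈0 : F 0 K.≈ K.0#) (P≋ : P Y.≋ y-F F Y.⋆ R) (R≡D : _≡F_ F R (Y.const D)) (D0≉0 : ¬ (D 0 K.≈ K.0#))
    where

    open Extension 𝔽
    private
      h = suc a
      d = suc e
      module Q = CommutativeRing (quotientRing S₂ (y-F F))

    initialState : Y.Series
    initialState = Y.shift (∂ P)

    Represents : Y.Series → Series → Set (c ⊔ˡ ℓ)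
    Represents S f = _≡F_ F S (Y.const (D ⋆ f))

    Represents-resp : ∀ {S S′ f} → S Y.≋ S′ → Represents S f → Represents S′ f
    Represents-resp {S} {S′} {f} e r = Q.trans {S′} {S} {Y.const (D ⋆ f)} (≈⇒≡ₘ S₂ (y-F F) (S₂.sym e)) r

    initial-represents : Represents initialState F
    initial-represents = Q.trans {Y.shift (∂ P)} {Y.X Y.⋆ ∂ P} {Y.const (D ⋆ F)} (≈⇒≡ₘ S₂ (y-F F) (S₂.sym (Y.X⋆ (∂ P))))
      (Q.trans {Y.X Y.⋆ ∂ P} {Y.const F Y.⋆ Y.const D} {Y.const (D ⋆ F)}
        (Q.*-cong {Y.X} {Y.const F} {∂ P} {Y.const D} (y≡F F)
          (Q.trans {∂ P} {R} {Y.const D} (∂ R , S₂.trans (∂-cong P≋) (∂-product F R)) R≡D))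
        (≈⇒≡ₘ S₂ (y-F F) (S₂.trans (S₂.sym (Y.const-* F D)) (Y.const-cong (S₁.*-comm F D)))))
      where
      open Mult S₁.+-commutativeMonoid using (×-congʳ)
      ∂-cong : ∀ {f g} → f Y.≋ g → ∂ f Y.≋ ∂ g
      ∂-cong e j = ×-congʳ (suc j) (e (suc j))

    initial-U : InU P degX-P degY-P initialState
    initial-U = degX , degY
      where
      open Mult S₁.+-commutativeMonoid using () renaming (_×_ to _·ˢ_)
      ·-vanishes : ∀ n (f : Series) i → f i K.≈ K.0# → (n ·ˢ f) i K.≈ K.0#
      ·-vanishes zero    f i e = K.refl
      ·-vanishes (suc n) f i e = K.trans (K.+-cong e (·-vanishes n f i e)) (K.+-identityʳ _)

      degX : DegX≤ h initialState
      degX zero    i _   = K.refl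
      degX (suc j) i h<i = ·-vanishes (suc j) (P (suc j)) i (degX-P (suc j) i h<i)

      degY : Y.Deg≤ d initialState
      degY (suc j) d<j i = ·-vanishes (suc j) (P (suc j)) i (degY-P (suc j) d<j i)

    decodeV : Fin (q ℕ.^ (h ℕ.* d)) → Y.Series
    decodeV x j i with i ℕ.<? h | j ℕ.<? d
    ... | yes i<h | yes j<d = decode {h ℕ.* d} x (Fin.combine (fromℕ< i<h) (fromℕ< j<d))
    ... | yes _   | no _    = K.0#
    ... | no _    | _       = K.0#

    box : Y.Series → Fin (h ℕ.* d) → K.Carrier
    box S x = S (toℕ (proj₂ (Fin.remQuot {h} d x))) (toℕ (proj₁ (Fin.remQuot {h} d x)))

    encodeV : Y.Series → Fin (q ℕ.^ (h ℕ.* d))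
    encodeV S = encode {h ℕ.* d} (box S)

    decodeV-InV : ∀ x → InV P degX-P degY-P (decodeV x)
    decodeV-InV x = degX , degY
      where
      degX : DegX≤ a (decodeV x)
      degX j i a<i with i ℕ.<? h | j ℕ.<? d
      ... | yes i<h | _     = contradiction i<h (ℕ.≤⇒≯ a<i)
      ... | no _    | yes _ = K.refl
      ... | no _    | no _  = K.refl

      degY : Y.Deg≤ e (decodeV x)
      degY j e<j i with i ℕ.<? h | j ℕ.<? d
      ... | _     | yes j<d = contradiction j<d (ℕ.≤⇒≯ e<j)
      ... | yes _ | no _    = K.refl
      ... | no _  | no _    = K.refl

    decodeV-encodeV : ∀ {S} → InV P degX-P degY-P S → decodeV (encodeV S) Y.≋ S
    decodeV-encodeV {S} (dx , dy) j i with i ℕ.<? h | j ℕ.<? d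
    ... | no i≮h | _      = K.sym (dx j i (ℕ.≮⇒≥ i≮h))
    ... | yes _  | no j≮d = K.sym (dy j (ℕ.≮⇒≥ j≮d) i)
    ... | yes i<h | yes j<d = K.trans (decode-encode {h ℕ.* d} (box S) (Fin.combine (fromℕ< i<h) (fromℕ< j<d)))
      (K.reflexive (≡.trans (≡.cong (λ (x , y) → S (toℕ y) (toℕ x)) (Fin.remQuot-combine (fromℕ< i<h) (fromℕ< j<d)))
        (≡.cong₂ S (Fin.toℕ-fromℕ< j<d) (Fin.toℕ-fromℕ< i<h))))

    orbit₀ : ℕ → Y.Series
    orbit₀ = orbit P degX-P degY-P initialState

    orbit₀-U : ∀ t → InU P degX-P degY-P (orbit₀ t)
    orbit₀-U zero    = initial-U
    orbit₀-U (suc t) = InW⇒InU P degX-P degY-P (Λ-0 P degX-P degY-P (orbit₀-U t))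

    module _ {i T} (i<T : i < T) (repeats : orbit₀ i Y.≋ orbit₀ T) where

      private
        -- On the left the polynomials of V, entered with the first nonzero digit; on the right the
        -- times at which only zeros have been read.
        State = Fin (q ℕ.^ (h ℕ.* d)) ⊎ Fin T

        series : State → Y.Series
        series (inj₁ x) = decodeV x
        series (inj₂ t) = orbit₀ (toℕ t)

        -- After the last time T - 1 the automaton returns to time i, since the orbit carries the
        -- same polynomial at i and T.
        advance : ∀ t → Dec (suc t < T) → Fin T
        advance t (yes t+1<T) = fromℕ< t+1<T
        advance t (no _)      = fromℕ< i<T

        step : State → ℕ → State
        step (inj₁ x) r       = inj₁ (encodeV (Λ P r (decodeV x)))
        step (inj₂ t) zero    = inj₂ (advance (toℕ t) (suc (toℕ t) ℕ.<? T))
        step (inj₂ t) (suc r) = inj₁ (encodeV (Λ P (suc r) (orbit₀ (toℕ t))))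

        advance-series : ∀ t → t < T → ∀ t+1<T? → orbit₀ (toℕ (advance t t+1<T?)) Y.≋ orbit₀ (suc t)
        advance-series t t<T (yes t+1<T) = S₂.reflexive (≡.cong orbit₀ (Fin.toℕ-fromℕ< t+1<T))
        advance-series t t<T (no t+1≮T)  = S₂.trans (S₂.reflexive (≡.cong orbit₀ (Fin.toℕ-fromℕ< i<T)))
          (S₂.trans repeats (S₂.reflexive (≡.cong orbit₀ (ℕ.≤-antisym (ℕ.≮⇒≥ t+1≮T) t<T))))

        step-series : ∀ s r → series (step s r) Y.≋ Λ P r (series s)
        step-series (inj₁ x) r       = decodeV-encodeV (Λ-V P degX-P degY-P r (decodeV-InV x))
        step-series (inj₂ t) zero    = advance-series (toℕ t) (Fin.toℕ<n t) (suc (toℕ t) ℕ.<? T)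
        step-series (inj₂ t) (suc r) = decodeV-encodeV (Λ-suc P degX-P degY-P r (orbit₀-U (toℕ t)))

        D0⁻¹ = proj₁ (inverse (D 0) D0≉0)

        readout : State → K.Carrier
        readout s = series s 0 0 K.* D0⁻¹

        readout-represents : ∀ s {f} → Represents (series s) f → readout s K.≈ f 0
        readout-represents s {f} rep = begin
          series s 0 0 K.* D0⁻¹      ≈⟨ K.*-congʳ (K.trans (≡F⇒constant-term F F0≈0 rep) (⋆-zero D f)) ⟩
          D 0 K.* f 0 K.* D0⁻¹       ≈⟨ K.trans (K.*-congʳ (K.*-comm (D 0) (f 0))) (K.*-assoc (f 0) (D 0) D0⁻¹) ⟩
          f 0 K.* (D 0 K.* D0⁻¹)     ≈⟨ K.*-congˡ (proj₂ (inverse (D 0) D0≉0)) ⟩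
          f 0 K.* K.1#               ≈⟨ K.*-identityʳ (f 0) ⟩
          f 0                        ∎
          where open SetoidReasoning K.setoid

        start : State
        start = inj₂ (fromℕ< (ℕ.≤-<-trans z≤n i<T))

        toState : Fin (q ℕ.^ (h ℕ.* d) ℕ.+ T) → State
        toState = splitAt (q ℕ.^ (h ℕ.* d))

        fromState : State → Fin (q ℕ.^ (h ℕ.* d) ℕ.+ T)
        fromState = join (q ℕ.^ (h ℕ.* d)) T

      automaton : DFAO q K.Carrier
      automaton = record
        { size    = q ℕ.^ (h ℕ.* d) ℕ.+ T
        ; initial = fromState start
        ; δ       = λ s r → fromState (step (toState s) (toℕ r))
        ; output  = readout ∘ toState
        }

      private
        open DFAO automaton using (run; δ; output; initial)

        -- Reading the digit r replaces f by its section at r, whose value at n is f(r + q n); at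
        -- the end of the word f(0) is output.
        correct : ∀ w s f → Represents (series (toState s)) f → output (foldl δ s w) K.≈ f (fromDigits w)
        correct []      s f rep = readout-represents (toState s) rep
        correct (r ∷ w) s f rep = correct w (δ s r) (section q (toℕ r) f)
          (Represents-resp {S = Λ P (toℕ r) (series (toState s))} {S′ = series (toState (δ s r))}
            (S₂.sym (S₂.trans (S₂.reflexive (≡.cong series (Fin.splitAt-join (q ℕ.^ (h ℕ.* d)) T (step (toState s) (toℕ r))))) (step-series (toState s) (toℕ r))))
            (Λ-represents F {P} {R} {D} {series (toState s)} {f} P≋ R≡D (toℕ r) (Fin.toℕ<n r) rep))

      automaton-run : ∀ w → run w K.≈ F (fromDigits w)
      automaton-run w = correct w initial F (Represents-resp {S = initialState} {S′ = series (toState initial)}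
        (S₂.sym (S₂.reflexive (≡.trans (≡.cong series (Fin.splitAt-join (q ℕ.^ (h ℕ.* d)) T start)) (≡.cong orbit₀ (Fin.toℕ-fromℕ< (ℕ.≤-<-trans z≤n i<T))))))
        initial-represents)

-- The size bound

lcm>0 : ∀ {m n} → 0 < m → 0 < n → 0 < lcm m n
lcm>0 {m} {n} 0<m 0<n = ℕ.n≢0⇒n>0 λ lcm≡0 → ℕ.<⇒≢ (ℕ.*-mono-< 0<m 0<n)
  (≡.trans (≡.sym (ℕ.*-zeroʳ (gcd m n))) (≡.trans (≡.cong (gcd m n ℕ.*_) (≡.sym lcm≡0)) (gcd*lcm m n)))

lcmOf>0 : ∀ {σ} → All (1 ≤_) σ → 0 < lcmOf σ
lcmOf>0 []           = s≤s z≤n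
lcmOf>0 (1≤s ∷ 1≤σ) = lcm>0 1≤s (lcmOf>0 1≤σ)

≤-maxOver : ∀ {a} {A : Set a} {xs : List A} (f : A → ℕ) {x m} → x ∈ xs → m ≤ f x → m ≤ maxOver xs f
≤-maxOver {xs = xs} f x∈ m≤ = ℕ.≤-trans m≤ (All.lookup (xs≤max 0 (map f xs)) (∈-map⁺ f x∈))

module _ (l m n : ℕ) (value : List ℕ → List ℕ → List ℕ → ℕ) where

  private
    over-partitions : ℕ → ℕ → ℕ → ℕ
    over-partitions i j k = max[ σ₁ ∈ parts i ] max[ σ₂ ∈ parts j ] max[ σ₃ ∈ parts k ] value σ₁ σ₂ σ₃

    ∈parts : ∀ {n σ} → IsPartition n σ → σ ∈ parts n
    ∈parts {n} {σ} = Equivalence.from (∈-parts {n} {σ})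

    ∈range : ∀ {i n} → 1 ≤ i → i ≤ n → i ∈ [1⋯ n ]
    ∈range {suc i} _ i<n = ∈-map⁺ suc (∈-upTo⁺ i<n)

  -- Stated for an arbitrary `value`, so that the six nested maxima are handled without unfolding
  -- the lcm.
  ≤-max-partitions : ∀ {i j k σ₁ σ₂ σ₃} → 1 ≤ i → i ≤ l → IsPartition i σ₁ → 1 ≤ j → j ≤ m → IsPartition j σ₂ →
    1 ≤ k → k ≤ n → IsPartition k σ₃ →
    value σ₁ σ₂ σ₃ ≤ max[ i ∈ [1⋯ l ] ] max[ j ∈ [1⋯ m ] ] max[ k ∈ [1⋯ n ] ]
      max[ σ₁ ∈ parts i ] max[ σ₂ ∈ parts j ] max[ σ₃ ∈ parts k ] value σ₁ σ₂ σ₃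
  ≤-max-partitions {i} {j} {k} {σ₁} {σ₂} {σ₃} 1≤i i≤l p₁ 1≤j j≤m p₂ 1≤k k≤n p₃ =
    ≤-maxOver {xs = [1⋯ l ]} (λ i → max[ j ∈ [1⋯ m ] ] max[ k ∈ [1⋯ n ] ] over-partitions i j k) {i} {value σ₁ σ₂ σ₃} (∈range 1≤i i≤l)
    (≤-maxOver {xs = [1⋯ m ]} (λ j → max[ k ∈ [1⋯ n ] ] over-partitions i j k) {j} {value σ₁ σ₂ σ₃} (∈range 1≤j j≤m)
    (≤-maxOver {xs = [1⋯ n ]} (λ k → over-partitions i j k) {k} {value σ₁ σ₂ σ₃} (∈range 1≤k k≤n)
    (≤-maxOver {xs = parts i} (λ σ₁ → max[ σ₂ ∈ parts j ] max[ σ₃ ∈ parts k ] value σ₁ σ₂ σ₃) {σ₁} {value σ₁ σ₂ σ₃} (∈parts p₁)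
    (≤-maxOver {xs = parts j} (λ σ₂ → max[ σ₃ ∈ parts k ] value σ₁ σ₂ σ₃) {σ₂} {value σ₁ σ₂ σ₃} (∈parts p₂)
    (≤-maxOver {xs = parts k} (λ σ₃ → value σ₁ σ₂ σ₃) {σ₃} {value σ₁ σ₂ σ₃} (∈parts p₃) ℕ.≤-refl)))))

lcm₃ : List ℕ → List ℕ → List ℕ → ℕ
lcm₃ σ₁ σ₂ σ₃ = lcm (lcm (lcmOf σ₁) (lcmOf σ₂)) (lcmOf σ₃)

lcm₃≤𝓛 : ∀ {l m n i j k σ₁ σ₂ σ₃} → 1 ≤ i → i ≤ l → IsPartition i σ₁ → 1 ≤ j → j ≤ m → IsPartition j σ₂ →
  1 ≤ k → k ≤ n → IsPartition k σ₃ → lcm₃ σ₁ σ₂ σ₃ ≤ 𝓛 l m n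
lcm₃≤𝓛 {l} {m} {n} = ≤-max-partitions l m n lcm₃

-- Besides v polynomials there are j + 1 orbit states, at most v + b + l₂ + 2 states in all; l₁ + 1
-- makes up the difference to the stated bound.
+-size : ∀ v l₁ l₂ {j x b} → x ≤ b → j ≤ suc l₂ ℕ.+ x → v ℕ.+ suc j ≤ v ℕ.+ b ℕ.+ l₁ ℕ.+ l₂ ℕ.+ 3
+-size v l₁ l₂ {j} {x} {b} x≤b j≤ = ℕ.≤-trans
  (ℕ.+-monoʳ-≤ v (s≤s (ℕ.≤-trans j≤ (ℕ.+-monoʳ-≤ (suc l₂) x≤b))))
  (≡.subst (v ℕ.+ suc (suc l₂ ℕ.+ b) ≤_)
    (solve 4 (λ v b l₁ l₂ → v :+ (con 2 :+ l₂ :+ b) :+ (con 1 :+ l₁) := v :+ b :+ l₁ :+ l₂ :+ con 3) ≡.refl v b l₁ l₂)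
    (ℕ.m≤m+n (v ℕ.+ suc (suc l₂ ℕ.+ b)) (suc l₁)))
  where open ℕSolver.+-*-Solver

heytingFiniteField : ∀ {c ℓ₁ ℓ₂} {q} → IsPrimePower q → (𝔽q : HeytingField c ℓ₁ ℓ₂) →
  Inverse (HeytingField.setoid 𝔽q) (≡.setoid (Fin q)) → FiniteField c ℓ₁ q
heytingFiniteField {q = q} primePower 𝔽q enumeration = record
  { commutativeRing-K = commutativeRing 𝔽q
  ; enumeration = enumeration
  ; primePower = primePower
  ; inverse = invert
  }
  where
  open HeytingField 𝔽q
  open Inverse enumeration
  open RingProperties (CommutativeRing.ring (commutativeRing 𝔽q)) using (-0#≈0#)

  _≈?_ : Decidable _≈_
  _≈?_ = enumerated⇒decidable enumeration

  -- Finiteness makes invertibility decidable, so tightness upgrades a ≉ 0 to a # 0.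
  invert : ∀ a → ¬ (a ≈ 0#) → ∃ λ b → a * b ≈ 1#
  invert a a≉0 with Fin.any? (λ i → (a * from i) ≈? 1#)
  ... | yes (i , e) = from i , e
  ... | no none = contradiction (proj₁ (tight a 0#) λ a#0 →
          let b , _ , e = #⇒invertible a#0
          in none (to b , trans (*-cong (sym a-0≈a) (strictlyInverseʳ b)) e)) a≉0
    where
    a-0≈a : a - 0# ≈ a
    a-0≈a = trans (+-cong refl -0#≈0#) (+-identityʳ a)

module SizeBound {c ℓ q} (𝔽 : FiniteField c ℓ q) where

  open FieldSeries 𝔽
  open Evaluation 𝔽
  open Borders 𝔽
  open Periodicity 𝔽
  open Coefficients 𝔽
  open Algebraic K using (Poly₂; ∂y; substY; IsDegX; IsDegY; FurstenbergCondition; IsFurstenbergSeries)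

  bound : ℕ → ℕ → ℕ
  bound h d = q ℕ.^ (h ℕ.* d) ℕ.+ q ℕ.^ ((h ∸ 1) ℕ.* (d ∸ 1)) ℕ.* 𝓛 h d d
                ℕ.+ ⌊log[ q ] h ⌋ ℕ.+ ⌊log[ q ] (h ⊔ d) ⌋ ℕ.+ 3

  module _ (P : Poly₂) (condition : FurstenbergCondition P) (F : Series) (root : IsFurstenbergSeries P F) (F≉0 : ¬ (F ≋ 0ˢ)) where

    private
      module Q = CommutativeRing (quotientRing S₂ (y-F F))

      F0≈0 : F 0 K.≈ K.0#
      F0≈0 = proj₁ root

      R : Y.Series
      R = proj₁ (substY-value F P)

      D : Series
      D = substY (∂y P) F

      P≋ : ⟦ P ⟧ Y.≋ y-F F Y.⋆ R
      P≋ = S₂.trans (proj₂ (substY-value F P)) (S₂.trans (S₂.+-congʳ {y-F F Y.⋆ R} const≋0) (S₂.+-identityˡ (y-F F Y.⋆ R)))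
        where
        const≋0 : Y.const (substY P F) Y.≋ S₂.0#
        const≋0 zero    = proj₂ root
        const≋0 (suc j) = S₁.refl

      R≡D : _≡F_ F R (Y.const D)
      R≡D = Q.trans {R} {⟦ ∂y P ⟧} {Y.const D} (Q.sym {⟦ ∂y P ⟧} {R}
        (∂ R , S₂.trans (∂y-coefficients P) (S₂.trans (λ j → Mult.×-congʳ S₁.+-commutativeMonoid (suc j) (P≋ (suc j))) (∂-product F R))))
        (substY-value F (∂y P))

      ∂P00≉0 : ¬ (⟦ ∂y P ⟧ 0 0 K.≈ K.0#)
      ∂P00≉0 e = proj₂ condition (K.trans (eval₂-0 (∂y P)) e)

      D0≉0 : ¬ (D 0 K.≈ K.0#)
      D0≉0 e = ∂P00≉0 (K.trans (≡F⇒constant-term F F0≈0 (substY-value F (∂y P))) e)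

      P10≉0 : ¬ (⟦ P ⟧ 1 0 K.≈ K.0#)
      P10≉0 e = ∂P00≉0 (K.trans (∂y-coefficients P 0 0) (K.trans (K.+-identityʳ _) e))

      ≈0-dec : ∀ x → x K.≈ K.0# ⊎ ¬ (x K.≈ K.0#)
      ≈0-dec x with x ≈? K.0#
      ... | yes e = inj₁ e
      ... | no ne = inj₂ ne

      -- For h = 0 the coefficient of y^0 in P is constant, hence 0. Compared with (y - F) R it
      -- gives F R_0 = 0, and R_0(0) = D(0) ≠ 0 would force F = 0.
      h≢0 : ¬ IsDegX P 0
      h≢0 (degX , _) = F≉0 (⋆-cancelˡ ≈0-dec zero-product 1 (R 0) F (0 , s≤s z≤n , R00≉0) (S₁.trans (S₁.*-comm (R 0) F) F⋆R0≋0))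
        where
        open RingProperties S₁.ring using (-‿involutive; -0#≈0#)
        R00≉0 : ¬ (R 0 0 K.≈ K.0#)
        R00≉0 e = D0≉0 (K.trans (K.sym (≡F⇒constant-term F F0≈0 R≡D)) e)

        P0≋0 : ⟦ P ⟧ 0 ≋ 0ˢ
        P0≋0 zero    = K.trans (K.sym (eval₂-0 P)) (proj₁ condition)
        P0≋0 (suc i) = degX (suc i) 0 (s≤s z≤n)

        F⋆R0≋0 : F ⋆ R 0 ≋ 0ˢ
        F⋆R0≋0 = S₁.trans (S₁.sym (-‿involutive (F ⋆ R 0))) (S₁.trans (S₁.-‿cong
          (S₁.trans (S₁.sym (S₁.+-identityˡ (S₁.- (F ⋆ R 0)))) (S₁.trans (S₁.sym (y-F-⋆ F R 0)) (S₁.trans (S₁.sym (P≋ 0)) P0≋0)))) -0#≈0#)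

      d≢0 : ¬ IsDegY P 0
      d≢0 (degY , _) = P10≉0 (degY 0 1 (s≤s z≤n))

      module _ {a e : ℕ} (degX : IsDegX P (suc a)) (degY : IsDegY P (suc e)) where

        h = suc a
        d = suc e
        -- The least t with q^t above max(h, d), the common degree bound for numerators and moduli
        -- on all three borders.
        t = suc ⌊log[ q ] (h ⊔ d) ⌋

        degX-P : DegX≤ h ⟦ P ⟧
        degX-P j i = proj₁ degX i j

        degY-P : Y.Deg≤ d ⟦ P ⟧
        degY-P j d<j i = proj₁ degY i j d<j

        open OrbitAutomaton.Construction 𝔽 ⟦ P ⟧ degX-P degY-P F D R F0≈0 P≋ R≡D D0≉0

        -- y ∂P/∂y may have degree d in y and so lie outside W; one application of Λ_0 leads into W,
        -- where the border operators apply. This accounts for one more state in front of the orbit.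
        firstState : Y.Series
        firstState = Λ ⟦ P ⟧ 0 initialState

        firstState-W : InW ⟦ P ⟧ degX-P degY-P firstState
        firstState-W = Λ-0 ⟦ P ⟧ degX-P degY-P initial-U

        orbit-suc : ∀ n → orbit ⟦ P ⟧ degX-P degY-P firstState n ≡ orbit₀ (suc n)
        orbit-suc zero    = ≡.refl
        orbit-suc (suc n) = ≡.cong (Λ ⟦ P ⟧ 0) (orbit-suc n)

        h⊔d<q^t : h ⊔ d < q ℕ.^ t
        h⊔d<q^t = proj₂ (⌊log⌋-spec 2≤q (ℕ.≤-trans (s≤s z≤n) (ℕ.m≤m⊔n h d)))

        top-period : ∃ λ i → ∃ λ σ → 1 ≤ i × i ≤ h × IsPartition i σ × Periodic h (⟦ P ⟧ d) σ
        top-period = periodic-partition (s≤s z≤n) (degX-P d) λ P≋0 → proj₂ (proj₂ degY) (P≋0 (proj₁ (proj₂ degY)))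

        right-period : ∃ λ i → ∃ λ σ → 1 ≤ i × i ≤ d × IsPartition i σ × Periodic d (column h ⟦ P ⟧) σ
        right-period = periodic-partition (s≤s z≤n) (λ j d<j → degY-P j d<j h) λ P≋0 → proj₂ (proj₂ degX) (P≋0 (proj₁ (proj₂ degX)))

        -- The column x^0 is P(0, y), nonzero because its coefficient of y is ∂P/∂y(0, 0); the
        -- moduli of the other two borders are nonzero by the choice of h and d.
        left-period : ∃ λ i → ∃ λ σ → 1 ≤ i × i ≤ d × IsPartition i σ × Periodic d (column 0 ⟦ P ⟧) σ
        left-period = periodic-partition (s≤s z≤n) (λ j d<j → degY-P j d<j 0) λ P≋0 → P10≉0 (P≋0 1)

        combine-periods : (∃ λ i → ∃ λ σ → 1 ≤ i × i ≤ h × IsPartition i σ × Periodic h (⟦ P ⟧ d) σ) →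
          (∃ λ i → ∃ λ σ → 1 ≤ i × i ≤ d × IsPartition i σ × Periodic d (column h ⟦ P ⟧) σ) →
          (∃ λ i → ∃ λ σ → 1 ≤ i × i ≤ d × IsPartition i σ × Periodic d (column 0 ⟦ P ⟧) σ) →
          ∃ λ (M : DFAO q K.Carrier) → (∀ w → DFAO.run M w K.≈ F (fromDigits w)) × DFAO.size M ≤ bound h d
        combine-periods (i₁ , σ₁ , 1≤i₁ , i₁≤h , p₁ , per₁) (i₂ , σ₂ , 1≤i₂ , i₂≤d , p₂ , per₂) (i₃ , σ₃ , 1≤i₃ , i₃≤d , p₃ , per₃) =
          assemble (orbit-repeats ⟦ P ⟧ degX-P degY-P period t 1≤period firstState-W periodic)
          where
          period = lcm₃ σ₁ σ₂ σ₃

          1≤period : 1 ≤ period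
          1≤period = lcm>0 (lcm>0 (lcmOf>0 (proj₁ (proj₂ p₁))) (lcmOf>0 (proj₁ (proj₂ p₂)))) (lcmOf>0 (proj₁ (proj₂ p₃)))

          ∣period : ∀ σ → lcmOf σ ∣ period → All (_∣ period) σ
          ∣period σ d = All.map (λ e → ∣-trans e d) (∣lcmOf σ)

          h<q^t = ℕ.≤-<-trans (ℕ.m≤m⊔n h d) h⊔d<q^t
          d<q^t = ℕ.≤-<-trans (ℕ.m≤n⊔m h d) h⊔d<q^t

          periodic : ∀ β m → Border.border (side ⟦ P ⟧ degX-P degY-P β) (orbit ⟦ P ⟧ degX-P degY-P firstState (m ℕ.* period ℕ.+ t))
                           ≋ Border.border (side ⟦ P ⟧ degX-P degY-P β) (orbit ⟦ P ⟧ degX-P degY-P firstState t)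
          periodic top = Border.border-periodic (side ⟦ P ⟧ degX-P degY-P top) {h} {σ₁} per₁ 1≤period
            (∣period σ₁ (∣-trans (m∣lcm[m,n] (lcmOf σ₁) (lcmOf σ₂)) (m∣lcm[m,n] _ (lcmOf σ₃)))) h<q^t firstState-W (proj₁ firstState-W e)
          periodic right = Border.border-periodic (side ⟦ P ⟧ degX-P degY-P right) {d} {σ₂} per₂ 1≤period
            (∣period σ₂ (∣-trans (n∣lcm[m,n] (lcmOf σ₁) (lcmOf σ₂)) (m∣lcm[m,n] _ (lcmOf σ₃)))) d<q^t firstState-W
            -- The shift by y raises the degree bound e of the column to d, the bound for which the
            -- modulus is periodic.
            (Deg≤-shift {f = column h firstState} λ j e<j → proj₂ firstState-W j e<j h)
          periodic left = Border.border-periodic (side ⟦ P ⟧ degX-P degY-P left) {d} {σ₃} per₃ 1≤period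
            (∣period σ₃ (n∣lcm[m,n] (lcm (lcmOf σ₁) (lcmOf σ₂)) (lcmOf σ₃))) d<q^t firstState-W
            (Deg≤-shift {f = column 0 firstState} λ j e<j → proj₂ firstState-W j e<j 0)

          recurrence = q ℕ.^ (a ℕ.* e) ℕ.* period
          size≤ : ∀ j → j ≤ t ℕ.+ recurrence → q ℕ.^ (h ℕ.* d) ℕ.+ suc j ≤ bound h d
          size≤ j j≤ = +-size (q ℕ.^ (h ℕ.* d)) ⌊log[ q ] h ⌋ ⌊log[ q ] (h ⊔ d) ⌋
            (ℕ.*-monoʳ-≤ (q ℕ.^ (a ℕ.* e)) (lcm₃≤𝓛 {σ₁ = σ₁} {σ₂} {σ₃} 1≤i₁ i₁≤h p₁ 1≤i₂ i₂≤d p₂ 1≤i₃ i₃≤d p₃)) j≤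

          assemble : (∃ λ i → ∃ λ j → i < j × j ≤ t ℕ.+ recurrence ×
              orbit ⟦ P ⟧ degX-P degY-P firstState i Y.≋ orbit ⟦ P ⟧ degX-P degY-P firstState j) →
            ∃ λ (M : DFAO q K.Carrier) → (∀ w → DFAO.run M w K.≈ F (fromDigits w)) × DFAO.size M ≤ bound h d
          assemble (i , j , i<j , j≤ , same) =
            -- The orbit of `firstState` runs one step ahead of `orbit₀`, so its repetition at i and
            -- j closes the cycle at the times i + 1 and j + 1.
            automaton (s≤s i<j) repeats , automaton-run (s≤s i<j) repeats , size≤ j j≤
            where
            repeats : orbit₀ (suc i) Y.≋ orbit₀ (suc j)
            repeats = S₂.trans (S₂.reflexive (≡.sym (orbit-suc i))) (S₂.trans same (S₂.reflexive (orbit-suc j)))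

    bounded-automaton : ∀ h d → IsDegX P h → IsDegY P d →
      ∃ λ (M : DFAO q K.Carrier) → (∀ w → DFAO.run M w K.≈ F (fromDigits w)) × DFAO.size M ≤ bound h d
    bounded-automaton zero    d       degX degY = contradiction degX h≢0
    bounded-automaton (suc a) zero    degX degY = contradiction degY d≢0
    bounded-automaton (suc a) (suc e) degX degY = combine-periods degX degY (top-period degX degY) (right-period degX degY) (left-period degX degY)

open import Data.Nat.Base using (_+_; _*_; _^_)
open import Relation.Binary.PropositionalEquality using (setoid)

theorem1 :
    ∀ {c ℓ₁ ℓ₂} (q : ℕ) → IsPrimePower q →
    (𝔽q : HeytingField c ℓ₁ ℓ₂) → Inverse (HeytingField.setoid 𝔽q) (setoid (Fin q)) →
    let open Algebraic (commutativeRing 𝔽q)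
        open Automatic (HeytingField._≈_ 𝔽q)
    in
    (P : Poly₂) → FurstenbergCondition P →
    (h d : ℕ) → IsDegX P h → IsDegY P d →
    (F : Series) → IsFurstenbergSeries P F → ¬ (F ≋ 0ˢ) →
    ∃ λ (M : DFAO q (HeytingField.Carrier 𝔽q)) → IsMinimalFor M F ×
      DFAO.size M ≤
        q ^ (h * d) + q ^ ((h ∸ 1) * (d ∸ 1)) * 𝓛 h d d
          + ⌊log[ q ] h ⌋ + ⌊log[ q ] (h ⊔ d) ⌋ + 3
theorem1 q primePower 𝔽q enumeration P condition h d degX degY F root F≉0 =
  minimize (SizeBound.bounded-automaton 𝔽 P condition F root F≉0 h d degX degY)
  where
  𝔽 = heytingFiniteField primePower 𝔽q enumeration
  open FiniteField 𝔽 using (_≈?_)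
  open HeytingField 𝔽q using (refl; sym; trans)
  open Minimization {_≈_ = HeytingField._≈_ 𝔽q} refl sym trans _≈?_ {q}

  minimize : ∀ {N} → (∃ λ M → (∀ w → HeytingField._≈_ 𝔽q (DFAO.run M w) (F (fromDigits w))) × DFAO.size M ≤ N) →
             ∃ λ M → Automatic.IsMinimalFor (HeytingField._≈_ 𝔽q) M F × DFAO.size M ≤ N
  minimize (M , correct , size≤) = reduced M , reduced-minimal M correct , ℕ.≤-trans (reduced-size M) size≤
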